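{- For every fixed $\alpha>0$ and every $\epsilon>0$ there exists $N=N(\alpha,\epsilon)$ such that for all $n>N$: if $G$ is a graph on $n$ vertices with diameter $2$ that has at most $n^{2-\alpha}$ edges or at least $\binom{n}{2}-n^{2-\alpha}$ edges, then $h(G)\ge n/2-\epsilon n$.
   Context: For a graph $G$ and $S\subseteq V(G)$, the distance multiset $D(S)$ is the multiset of shortest-path distances in $G$ between all unordered pairs of distinct vertices of $S$. Two vertex sets $S_1,S_2$ are homometric if $D(S_1)=D(S_2)$. $h(G)$ is the largest integer $h$ such that $G$ contains two disjoint homometric sets $S_1,S_2$ with $|S_1|=|S_2|=h$. -}

module Defs where

open import Data.Bool using (Bool; true; false; _∧_; _∨_; if_then_else_)
open import Data.Nat using (ℕ; zero; suc; _+_; _*_; _≤_; _<_; _<ᵇ_; _≡ᵇ_)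
open import Data.Nat.Combinatorics using (_C_)
open import Data.Fin using (Fin; toℕ; _≟_)
open import Data.List using (List; map)
open import Data.Nat.ListAction using (sum)
open import Data.Bool.ListAction using (any)
open import Data.List using () renaming (allFin to allFinL)
open import Data.Product using (Σ; ∃; ∃-syntax; _×_)
open import Relation.Nullary.Decidable using (⌊_⌋)
open import Relation.Binary.PropositionalEquality using (_≡_)

record Graph (n : ℕ) : Set where
  field
    adj    : Fin n → Fin n → Bool
    sym    : ∀ i j → adj i j ≡ adj j i
    irrefl : ∀ i → adj i i ≡ false
open Graph public

countV : {n : ℕ} → (Fin n → Bool) → ℕ
countV {n} P = sum (map (λ i → if P i then 1 else 0) (allFinL n))

countPairs : {n : ℕ} → (Fin n → Fin n → Bool) → ℕ
countPairs {n} P =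
  sum (map (λ i → sum (map (λ j → if (toℕ i <ᵇ toℕ j) ∧ P i j then 1 else 0)
                            (allFinL n)))
           (allFinL n))

edges : {n : ℕ} → Graph n → ℕ
edges G = countPairs (adj G)

reach : {n : ℕ} → Graph n → ℕ → Fin n → Fin n → Bool
reach G zero    u v = ⌊ u ≟ v ⌋
reach {n} G (suc k) u v =
  reach G k u v ∨ any (λ w → reach G k u w ∧ adj G w v) (allFinL n)

-- Shortest-path distance: least k < n with a walk of length ≤ k from u to v;
-- returns n (a sentinel for "infinite") if v is unreachable from u.
dist : {n : ℕ} → Graph n → Fin n → Fin n → ℕ
dist {n} G u v = search n 0
  where
  search : ℕ → ℕ → ℕ
  search zero    k = k
  search (suc f) k = if reach G k u v then k else search f (suc k)

Diameter2 : {n : ℕ} → Graph n → Set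
Diameter2 {n} G =
  (∀ (u v : Fin n) → dist G u v ≤ 2) × (∃[ u ] ∃[ v ] dist G u v ≡ 2)

VSet : ℕ → Set
VSet n = Fin n → Bool

-- Multiplicity of distance k in the distance multiset D(S).
Dmult : {n : ℕ} → Graph n → VSet n → ℕ → ℕ
Dmult G S k = countPairs (λ i j → S i ∧ S j ∧ (dist G i j ≡ᵇ k))

Homometric : {n : ℕ} → Graph n → VSet n → VSet n → Set
Homometric G S₁ S₂ = ∀ k → Dmult G S₁ k ≡ Dmult G S₂ k

Disjoint : {n : ℕ} → VSet n → VSet n → Set
Disjoint S₁ S₂ = ∀ i → (S₁ i ∧ S₂ i) ≡ false

HomPair : {n : ℕ} → Graph n → ℕ → Set
HomPair {n} G h = ∃[ S₁ ] ∃[ S₂ ]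
  (Disjoint {n} S₁ S₂ × countV S₁ ≡ h × countV S₂ ≡ h × Homometric G S₁ S₂)

{-# OPTIONS --safe #-}

-- In a graph of diameter 2 the distance multiset of S is determined by |S| and by the number of
-- edges inside S, and also by |S| and the number of non-edges.  So it suffices to find, in a sparse
-- graph H on n vertices (G or its complement), disjoint sets A and B of equal size that span equally
-- many edges and leave out only o(n) vertices.
--
-- For W = A ∪ B the difference e(A) - e(B) is half of Σ_A deg_W - Σ_B deg_W, hence linear in A and B
-- once W is fixed.  Fix r, a small power of n.  Deleting O(n / r) vertices makes H nearly regular:
-- all degrees are at most Δ, and the degree sum is at least nΔ / r².
--
-- If Δ < r⁵, greedily isolate Δ edges uv together with isolated vertices w, z: the pairs (u, w) and
-- (v, z) have degree difference exactly 1.  All other vertices are paired arbitrarily and signed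
-- greedily up to an error Δ, which the unit differences remove (the last unit by parity).
--
-- If Δ ≥ r⁵, pair vertices of nearly equal degree, then pair these pairs so that the differences
-- nearly cancel, and so on: every level divides the differences by r and drops few vertices, so after
-- a bounded number of levels most groups are exactly balanced.  To obtain unit differences, set aside
-- a small set Q with many edges to the rest.  Whenever two groups are merged, their number of common
-- neighbours in Q is kept small (by averaging, a maximal matching does this), so that most edges
-- between Q and the groups stay the only edge from a vertex of Q to its group.  The same matching
-- argument inside Q yields x, y of nearly equal degree such that many balanced groups receive exactly
-- one edge from {x, y}; adding x and y makes each of these groups off by exactly one.
module Submission where

open import Defs renaming (sym to adj-sym; irrefl to adj-irrefl)
open import Algebra.Bundles using (CommutativeMonoid)
import Algebra.Properties.CommutativeSemigroup as CS
open import Data.Bool using (Bool; true; false; if_then_else_; _∧_; _∨_; not) renaming (T to IsTrue)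
open import Data.Bool.ListAction using (any)
open import Data.Bool.Properties using (T-≡; ∧-zeroʳ)
open import Data.Empty using (⊥-elim)
open import Data.Fin using (Fin; toℕ) renaming (zero to fzero; suc to fsuc; _≟_ to _≟ᶠ_)
open import Data.Fin.Properties using (toℕ-injective) renaming (suc-injective to suc-injectiveᶠ)
open import Data.List using (List; []; _∷_; _++_; [_]; map; length; concatMap; filter; take; drop; allFin)
open import Data.List.Membership.Propositional using (lose)
open import Data.List.Membership.Propositional.Properties using (∈-allFin)
open import Data.List.Properties
  using (map-++; length-++; ++-assoc; ++-identityʳ; take++drop≡id; length-drop; length-take; length-map; map-tabulate; length-tabulate)
open import Data.List.Relation.Binary.Permutation.Propositional as P using (_↭_; ↭-sym; ↭-trans; ↭-refl; prep)
import Data.List.Relation.Binary.Permutation.Propositional.Properties as Pₚ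
open import Data.List.Relation.Unary.All as All using (All; []; _∷_)
import Data.List.Relation.Unary.All.Properties as Allₚ
open import Data.List.Relation.Unary.AllPairs using (AllPairs; []; _∷_)
import Data.List.Relation.Unary.AllPairs.Properties as AllPairsₚ
open import Data.List.Relation.Unary.Any using (satisfied)
open import Data.List.Relation.Unary.Any.Properties using (any⁺; any⁻)
open import Data.Nat
open import Data.Nat.Combinatorics using (_C_; nC1≡n; nCk+nC[k+1]≡[n+1]C[k+1])
open import Data.Nat.DivMod
open import Data.Nat.ListAction using (sum)
open import Data.Nat.ListAction.Properties using (sum-++; sum-↭)
open import Data.Nat.Properties
open import Data.Nat.Tactic.RingSolver using (solve-∀)
open import Data.Product using (∃; ∃-syntax; _×_; _,_; proj₁; proj₂; uncurry)
open import Data.Sum using (_⊎_; inj₁; inj₂)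
open import Function using (_∘_; id; case_of_; it)
open import Function.Bundles using (Equivalence)
open import Level using (0ℓ)
open import Relation.Binary.Definitions using (tri<; tri≈; tri>)
open import Relation.Binary.PropositionalEquality
  using (_≡_; _≢_; refl; sym; trans; cong; cong₂; subst; subst₂; module ≡-Reasoning)
open import Relation.Nullary
open import Relation.Nullary.Decidable using (⌊_⌋; _×-dec_)
open import Relation.Unary using (Pred; Decidable)

private variable
  A B X : Set

-- Sums over lists

∑ : (A → ℕ) → List A → ℕ
∑ f xs = sum (map f xs)

∑-++ : ∀ (f : A → ℕ) xs ys → ∑ f (xs ++ ys) ≡ ∑ f xs + ∑ f ys
∑-++ f xs ys = trans (cong sum (map-++ f xs ys)) (sum-++ (map f xs) (map f ys))

∑-↭ : ∀ (f : A → ℕ) {xs ys} → xs ↭ ys → ∑ f xs ≡ ∑ f ys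
∑-↭ f p = sum-↭ (Pₚ.map⁺ f p)

∑-cong : ∀ {f g : A → ℕ} → (∀ x → f x ≡ g x) → ∀ xs → ∑ f xs ≡ ∑ g xs
∑-cong f≗g []       = refl
∑-cong f≗g (x ∷ xs) = cong₂ _+_ (f≗g x) (∑-cong f≗g xs)

∑-distrib-+ : ∀ (f g : A → ℕ) xs → ∑ (λ x → f x + g x) xs ≡ ∑ f xs + ∑ g xs
∑-distrib-+ f g []       = refl
∑-distrib-+ f g (x ∷ xs) = trans (cong (f x + g x +_) (∑-distrib-+ f g xs))
  (CS.interchange +-commutativeSemigroup (f x) (g x) (∑ f xs) (∑ g xs))

*-distribˡ-∑ : ∀ c (f : A → ℕ) xs → ∑ (λ x → c * f x) xs ≡ c * ∑ f xs
*-distribˡ-∑ c f []       = sym (*-zeroʳ c)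
*-distribˡ-∑ c f (x ∷ xs) = trans (cong (c * f x +_) (*-distribˡ-∑ c f xs))
  (sym (*-distribˡ-+ c (f x) (∑ f xs)))

∑-zero : ∀ (xs : List A) → ∑ (λ _ → 0) xs ≡ 0
∑-zero []       = refl
∑-zero (_ ∷ xs) = ∑-zero xs

∑-swap : ∀ (f : A → B → ℕ) xs ys → ∑ (λ x → ∑ (f x) ys) xs ≡ ∑ (λ y → ∑ (λ x → f x y) xs) ys
∑-swap f []       ys = sym (∑-zero ys)
∑-swap f (x ∷ xs) ys = trans (cong (∑ (f x) ys +_) (∑-swap f xs ys))
  (sym (∑-distrib-+ (f x) (λ y → ∑ (λ x → f x y) xs) ys))

∑-map : ∀ (f : B → ℕ) (g : A → B) xs → ∑ f (map g xs) ≡ ∑ (f ∘ g) xs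
∑-map f g []       = refl
∑-map f g (x ∷ xs) = cong (f (g x) +_) (∑-map f g xs)

∑-concatMap : ∀ (f : B → ℕ) (g : A → List B) xs → ∑ f (concatMap g xs) ≡ ∑ (λ x → ∑ f (g x)) xs
∑-concatMap f g []       = refl
∑-concatMap f g (x ∷ xs) = trans (∑-++ f (g x) (concatMap g xs))
  (cong (∑ f (g x) +_) (∑-concatMap f g xs))

∑-mono : ∀ {f g : A → ℕ} {xs} → All (λ x → f x ≤ g x) xs → ∑ f xs ≤ ∑ g xs
∑-mono []       = z≤n
∑-mono (p ∷ ps) = +-mono-≤ p (∑-mono ps)

∑≤length* : ∀ {f : A → ℕ} {c xs} → All (λ x → f x ≤ c) xs → ∑ f xs ≤ length xs * c
∑≤length* []       = z≤n
∑≤length* (p ∷ ps) = +-mono-≤ p (∑≤length* ps)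

length*≤∑ : ∀ {f : A → ℕ} {c xs} → All (λ x → c ≤ f x) xs → length xs * c ≤ ∑ f xs
length*≤∑ []       = z≤n
length*≤∑ (p ∷ ps) = +-mono-≤ p (length*≤∑ ps)

∑-filter-≤ : ∀ {P : Pred A 0ℓ} (P? : Decidable P) (f : A → ℕ) xs → ∑ f (filter P? xs) ≤ ∑ f xs
∑-filter-≤ P? f []       = z≤n
∑-filter-≤ P? f (x ∷ xs) with P? x
... | yes _ = +-monoʳ-≤ (f x) (∑-filter-≤ P? f xs)
... | no  _ = ≤-trans (∑-filter-≤ P? f xs) (m≤n+m _ (f x))

filter-split : ∀ {P : Pred A 0ℓ} (P? : Decidable P) xs → filter P? xs ++ filter (¬? ∘ P?) xs ↭ xs
filter-split P? []       = ↭-refl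
filter-split P? (x ∷ xs) with P? x
... | yes _ = prep x (filter-split P? xs)
... | no  _ = ↭-trans (Pₚ.shift x (filter P? xs) _) (prep x (filter-split P? xs))

∑-max : ∀ (f : A → ℕ) x xs → ∃ λ y → ∃ λ ys → (x ∷ xs ↭ y ∷ ys) × ∑ f (x ∷ xs) ≤ length (x ∷ xs) * f y
∑-max f x []        = x , [] , ↭-refl , ≤-refl
∑-max f x (x′ ∷ xs) with ∑-max f x′ xs
... | y , ys , p , b with ≤-total (f x) (f y)
...   | inj₁ fx≤fy = y , x ∷ ys , ↭-trans (prep x p) (P.swap x y ↭-refl) , +-mono-≤ fx≤fy b
...   | inj₂ fy≤fx = x , x′ ∷ xs , ↭-refl ,
          +-monoʳ-≤ (f x) (≤-trans b (*-monoʳ-≤ (length (x′ ∷ xs)) fy≤fx))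

-- The heaviest of `t` blocks of length at most `s` carries at least the average. This yields the
-- few vertices of large degree sum in `small-cut`.
∑-chunk : ∀ (f : A → ℕ) s t xs → length xs ≤ s * t →
  ∃ λ ys → ∃ λ zs → (ys ++ zs ↭ xs) × length ys ≤ s × ∑ f xs ≤ t * ∑ f ys
∑-chunk f s zero    xs l with xs | subst (length xs ≤_) (*-zeroʳ s) l
... | [] | _ = [] , [] , ↭-refl , z≤n , z≤n
∑-chunk f s (suc t) xs l = choose (∑-chunk f s t (drop s xs) l′)
  where
  hd = take s xs
  tl = drop s xs
  eq = take++drop≡id s xs
  l′ : length tl ≤ s * t
  l′ = subst (_≤ s * t) (sym (length-drop s xs)) (m≤n+o⇒m∸n≤o (length xs) s (subst (length xs ≤_) (*-suc s t) l))
  lh : length hd ≤ s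
  lh = subst (_≤ s) (sym (length-take s xs)) (m⊓n≤m s _)
  split : ∑ f xs ≡ ∑ f hd + ∑ f tl
  split = trans (cong (∑ f) (sym eq)) (∑-++ f hd tl)
  choose : (∃ λ ys → ∃ λ zs → (ys ++ zs ↭ tl) × length ys ≤ s × ∑ f tl ≤ t * ∑ f ys) →
    ∃ λ ys → ∃ λ zs → (ys ++ zs ↭ xs) × length ys ≤ s × ∑ f xs ≤ suc t * ∑ f ys
  choose (ys , zs , p , lys , b) with ≤-total (∑ f hd) (∑ f ys)
  ... | inj₁ hd≤ys = ys , zs ++ hd ,
          subst (ys ++ zs ++ hd ↭_) eq
            (subst (_↭ hd ++ tl) (++-assoc ys zs hd)
              (↭-trans (Pₚ.++-comm (ys ++ zs) hd) (Pₚ.++⁺ˡ hd p))) ,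
          lys , subst (_≤ suc t * ∑ f ys) (sym split) (+-mono-≤ hd≤ys b)
  ... | inj₂ ys≤hd = hd , tl , P.↭-reflexive eq , lh ,
          subst (_≤ suc t * ∑ f hd) (sym split)
            (+-monoʳ-≤ (∑ f hd) (≤-trans b (*-monoʳ-≤ t ys≤hd)))

++-interchange : (ws xs ys zs : List A) → (ws ++ xs) ++ (ys ++ zs) ↭ (ws ++ ys) ++ (xs ++ zs)
++-interchange = CS.interchange (CommutativeMonoid.commutativeSemigroup Pₚ.++-commutativeMonoid)

concatMap-++ : ∀ (f : A → List B) xs ys → concatMap f (xs ++ ys) ≡ concatMap f xs ++ concatMap f ys
concatMap-++ f []       ys = refl
concatMap-++ f (x ∷ xs) ys = trans (cong (f x ++_) (concatMap-++ f xs ys))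
  (sym (++-assoc (f x) (concatMap f xs) (concatMap f ys)))

concatMap-↭ : ∀ (f : A → List B) {xs ys} → xs ↭ ys → concatMap f xs ↭ concatMap f ys
concatMap-↭ f P.refl          = ↭-refl
concatMap-↭ f (prep x p)      = Pₚ.++⁺ˡ (f x) (concatMap-↭ f p)
concatMap-↭ f (P.swap x y p)  = ↭-trans (Pₚ.shifts (f x) (f y)) (Pₚ.++⁺ˡ (f y) (Pₚ.++⁺ˡ (f x) (concatMap-↭ f p)))
concatMap-↭ f (P.trans p q)   = ↭-trans (concatMap-↭ f p) (concatMap-↭ f q)

All-concatMap⁺ : ∀ {P : Pred B 0ℓ} (f : A → List B) {xs} → All (All P ∘ f) xs → All P (concatMap f xs)
All-concatMap⁺ f []       = []
All-concatMap⁺ f (p ∷ ps) = Allₚ.++⁺ p (All-concatMap⁺ f ps)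

All-concatMap⁻ : ∀ {P : Pred B 0ℓ} (f : A → List B) xs → All P (concatMap f xs) → All (All P ∘ f) xs
All-concatMap⁻ f []       _  = []
All-concatMap⁻ f (x ∷ xs) ps = Allₚ.++⁻ˡ (f x) ps ∷ All-concatMap⁻ f xs (Allₚ.++⁻ʳ (f x) ps)

-- Differences of natural numbers up to a tolerance

Close : ℕ → ℕ → ℕ → Set
Close T p m = p ≤ m + T × m ≤ p + T

close-mono : ∀ {S T p m} → S ≤ T → Close S p m → Close T p m
close-mono {p = p} {m} S≤T (u , l) = ≤-trans u (+-monoʳ-≤ m S≤T) , ≤-trans l (+-monoʳ-≤ p S≤T)

close-swap : ∀ {T p m} → Close T p m → Close T m p
close-swap (u , l) = l , u

close-0 : ∀ {p m} → Close 0 p m → p ≡ m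
close-0 {p} {m} (u , l) = ≤-antisym (subst (p ≤_) (+-identityʳ m) u) (subst (m ≤_) (+-identityʳ p) l)

close-+ : ∀ {S T p m p′ m′} → Close S p m → Close T p′ m′ → Close (S + T) (p + p′) (m + m′)
close-+ {S} {T} {p} {m} {p′} {m′} (u , l) (u′ , l′) =
  ≤-trans (+-mono-≤ u u′) (≤-reflexive (shuffle m S m′ T)) , ≤-trans (+-mono-≤ l l′) (≤-reflexive (shuffle p S p′ T))
  where
  shuffle : ∀ a b c d → (a + b) + (c + d) ≡ (a + c) + (b + d)
  shuffle = solve-∀

close-bounded : ∀ {T p m} → p ≤ T → m ≤ T → Close T p m
close-bounded {T} {p} {m} p≤ m≤ = ≤-trans p≤ (m≤n+m T m) , ≤-trans m≤ (m≤n+m T p)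

-- Two signed differences of absolute value at most `T` either have opposite signs, and their sum
-- stays within `T`, or have equal signs, and their difference does.
close-merge : ∀ {T p m p′ m′} → Close T p m → Close T p′ m′ →
  Close T (p + p′) (m + m′) ⊎ Close T (p + m′) (m + p′)
close-merge {T} {p} {m} {p′} {m′} (u , l) (u′ , l′) = go (≤-total p m) (≤-total p′ m′)
  where
  right : ∀ {p r} q s → p ≤ q → r ≤ s + T → p + r ≤ (q + s) + T
  right q s a b = ≤-trans (+-mono-≤ a b) (≤-reflexive (sym (+-assoc q s T)))
  left : ∀ {p r} q s → p ≤ q + T → r ≤ s → p + r ≤ (q + s) + T
  left q s a b = ≤-trans (+-mono-≤ a b) (≤-reflexive (shuffle q T s))
    where
    shuffle : ∀ a b c → (a + b) + c ≡ (a + c) + b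
    shuffle = solve-∀
  go : p ≤ m ⊎ m ≤ p → p′ ≤ m′ ⊎ m′ ≤ p′ → Close T (p + p′) (m + m′) ⊎ Close T (p + m′) (m + p′)
  go (inj₁ x) (inj₁ y) = inj₂ (right m p′ x l′ , left p m′ l y)
  go (inj₁ x) (inj₂ y) = inj₁ (right m m′ x u′ , left p p′ l y)
  go (inj₂ x) (inj₁ y) = inj₁ (left m m′ u y , right p p′ x l′)
  go (inj₂ x) (inj₂ y) = inj₂ (left m p′ u y , right p m′ x u′)

-- The side that lags gains one more than the other. The new tolerance is max(s, 1), written
-- `suc (s ∸ 1)`: for `s` = 0 the step may overshoot by one.
close-step : ∀ {s p m p′ m′} → p ≤ m → Close (suc s) p m → p′ ≡ suc m′ → Close (suc (s ∸ 1)) (p + p′) (m + m′)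
close-step {s} {p} {m} {m′ = m′} p≤m (_ , l) refl =
  (begin
    p + suc m′              ≡⟨ +-suc p m′ ⟩
    suc (p + m′)            ≤⟨ s≤s (+-monoˡ-≤ m′ p≤m) ⟩
    suc (m + m′)            ≤⟨ s≤s (m≤m+n (m + m′) (s ∸ 1)) ⟩
    suc (m + m′ + (s ∸ 1))  ≡⟨ +-suc (m + m′) (s ∸ 1) ⟨
    m + m′ + suc (s ∸ 1)    ∎) ,
  (begin
    m + m′                       ≤⟨ +-monoˡ-≤ m′ l ⟩
    p + suc s + m′               ≤⟨ +-monoˡ-≤ m′ (+-monoʳ-≤ p (s≤s (s≤1+[s∸1] s))) ⟩
    p + suc (suc (s ∸ 1)) + m′   ≡⟨ shuffle p (s ∸ 1) m′ ⟩
    p + suc m′ + suc (s ∸ 1)     ∎)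
  where
  open ≤-Reasoning
  s≤1+[s∸1] : ∀ s → s ≤ suc (s ∸ 1)
  s≤1+[s∸1] zero    = z≤n
  s≤1+[s∸1] (suc s) = ≤-refl
  shuffle : ∀ a b c → a + suc (suc b) + c ≡ a + suc c + suc b
  shuffle = solve-∀

even-close : ∀ {x y} → Close 1 (x + x) (y + y) → x ≡ y
even-close {x} {y} (u , l) = ≤-antisym (half u) (half l)
  where
  half : ∀ {x y} → x + x ≤ y + y + 1 → x ≤ y
  half {x} {y} h with x ≤? y
  ... | yes p = p
  ... | no ¬p = ⊥-elim (<-irrefl refl (begin-strict
      y + y + 1       <⟨ n<1+n _ ⟩
      suc (y + y + 1) ≡⟨ shuffle y ⟩
      suc y + suc y   ≤⟨ +-mono-≤ (≰⇒> ¬p) (≰⇒> ¬p) ⟩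
      x + x           ≤⟨ h ⟩
      y + y + 1       ∎))
    where
    open ≤-Reasoning
    shuffle : ∀ a → suc (a + a + 1) ≡ suc a + suc a
    shuffle = solve-∀

-- Groups of vertices with two sides

Group : Set → Set
Group V = List V × List V

verts : Group A → List A
verts (P , N) = P ++ N

flat : List (Group A) → List A
flat = concatMap verts

Balanced : Group A → Set
Balanced (P , N) = length P ≡ length N

-- The two lists of a group are destined for opposite sides of the split, but which list goes where
-- remains free: `cross` turns the second group over, so that its difference is subtracted instead
-- of added.
straight cross : Group A → Group A → Group A
straight (P , N) (P′ , N′) = P ++ P′ , N ++ N′
cross    (P , N) (P′ , N′) = P ++ N′ , N ++ P′

verts-straight : ∀ (g h : Group A) → verts (straight g h) ↭ verts g ++ verts h
verts-straight (P , N) (P′ , N′) = ++-interchange P P′ N N′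

verts-cross : ∀ (g h : Group A) → verts (cross g h) ↭ verts g ++ verts h
verts-cross (P , N) (P′ , N′) = ↭-trans (++-interchange P N′ N P′) (Pₚ.++⁺ˡ (P ++ N) (Pₚ.++-comm N′ P′))

balanced-straight : ∀ (g h : Group A) → Balanced g → Balanced h → Balanced (straight g h)
balanced-straight (P , N) (P′ , N′) b b′ =
  trans (length-++ P) (trans (cong₂ _+_ b b′) (sym (length-++ N)))

-- Edge counts and the balancing of groups

module Bilinear {V : Set} (a : V → V → ℕ) (a-sym : ∀ u v → a u v ≡ a v u)
  (a-irrefl : ∀ v → a v v ≡ 0) (a≤1 : ∀ u v → a u v ≤ 1) where

  e : V → List V → ℕ
  e v = ∑ (a v)

  -- Ordered pairs are counted, so `E X X` is the degree sum inside `X`, twice the number of edges.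
  E : List V → List V → ℕ
  E X Y = ∑ (λ x → e x Y) X

  E-++ˡ : ∀ X X′ Y → E (X ++ X′) Y ≡ E X Y + E X′ Y
  E-++ˡ X X′ Y = ∑-++ (λ x → e x Y) X X′

  E-++ʳ : ∀ X Y Y′ → E X (Y ++ Y′) ≡ E X Y + E X Y′
  E-++ʳ X Y Y′ = trans (∑-cong (λ x → ∑-++ (a x) Y Y′) X) (∑-distrib-+ (λ x → e x Y) (λ x → e x Y′) X)

  E-↭ˡ : ∀ {X X′} Y → X ↭ X′ → E X Y ≡ E X′ Y
  E-↭ˡ Y = ∑-↭ (λ x → e x Y)

  e-↭ : ∀ x {Y Y′} → Y ↭ Y′ → e x Y ≡ e x Y′
  e-↭ x = ∑-↭ (a x)

  E-↭ʳ : ∀ X {Y Y′} → Y ↭ Y′ → E X Y ≡ E X Y′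
  E-↭ʳ X p = ∑-cong (λ x → e-↭ x p) X

  E-sym : ∀ X Y → E X Y ≡ E Y X
  E-sym X Y = trans (∑-swap a X Y) (∑-cong (λ y → ∑-cong (λ x → a-sym x y) X) Y)

  E-singleton : ∀ x Y → E [ x ] Y ≡ e x Y
  E-singleton x Y = +-identityʳ (e x Y)

  e≡E : ∀ x Y → e x Y ≡ E Y [ x ]
  e≡E x Y = trans (sym (E-singleton x Y)) (E-sym [ x ] Y)

  E-even : ∀ X → ∃ λ k → E X X ≡ k + k
  E-even []      = 0 , refl
  E-even (x ∷ X) with E-even X
  ... | k , eq = e x X + k , (begin
    a x x + e x X + E X (x ∷ X)        ≡⟨ cong₂ _+_ (cong (_+ e x X) (a-irrefl x)) (E-++ʳ X [ x ] X) ⟩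
    e x X + (E X [ x ] + E X X)        ≡⟨ cong₂ (λ s t → e x X + (s + t)) (sym (e≡E x X)) eq ⟩
    e x X + (e x X + (k + k))          ≡⟨ shuffle (e x X) k ⟩
    e x X + k + (e x X + k)            ∎)
    where
    open ≡-Reasoning
    shuffle : ∀ a b → a + (a + (b + b)) ≡ a + b + (a + b)
    shuffle = solve-∀

  e≤length : ∀ x Y → e x Y ≤ length Y
  e≤length x Y = subst (e x Y ≤_) (*-identityʳ (length Y)) (∑≤length* (All.universal (a≤1 x) Y))

  E≤length* : ∀ X Y {d} → All (λ x → e x Y ≤ d) X → E X Y ≤ length X * d
  E≤length* X Y = ∑≤length*

  E-monoʳ : ∀ X Y Y′ → E X Y ≤ E X (Y ++ Y′)
  E-monoʳ X Y Y′ = subst (E X Y ≤_) (sym (E-++ʳ X Y Y′)) (m≤m+n _ _)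

  -- For fixed `W` the difference of `E P W` and `E N W` is additive over groups, unlike that of
  -- `E P P` and `E N N`. Hence imbalance is measured against a reference list, in the end the list
  -- of all kept vertices.
  Near : List V → ℕ → Group V → Set
  Near W T (P , N) = Close T (E P W) (E N W)

  Unit : List V → Group V → Set
  Unit W (P , N) = E P W ≡ suc (E N W) ⊎ E N W ≡ suc (E P W)

  near-↭ : ∀ {W W′ T} → W ↭ W′ → ∀ {g} → Near W T g → Near W′ T g
  near-↭ p {P , N} = subst₂ (Close _) (E-↭ʳ P p) (E-↭ʳ N p)

  near-straight : ∀ {T} W (g h : Group V) → Close T (E (proj₁ g) W + E (proj₁ h) W) (E (proj₂ g) W + E (proj₂ h) W) →
    Near W T (straight g h)
  near-straight W (P , N) (P′ , N′) = subst₂ (Close _) (sym (E-++ˡ P P′ W)) (sym (E-++ˡ N N′ W))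

  swap-group : Group V → Group V
  swap-group (P , N) = N , P

  -- Greedy signing: `close-merge` lets each group be turned against the imbalance accumulated so
  -- far, so the tolerance stays `T` however many groups there are.
  merge-all : ∀ W T gs → All Balanced gs → All (Near W T) gs →
    ∃ λ g → (verts g ↭ flat gs) × Balanced g × Near W T g
  merge-all W T []       []       []       = ([] , []) , ↭-refl , refl , z≤n , z≤n
  merge-all W T (g@(P , N) ∷ gs) (b ∷ bs) (c ∷ cs) with merge-all W T gs bs cs
  ... | h@(P′ , N′) , p , b′ , c′ with close-merge c c′
  ...   | inj₁ d = straight g h , ↭-trans (verts-straight g h) (Pₚ.++⁺ˡ (P ++ N) p) ,
            balanced-straight g h b b′ , near-straight W g h d
  ...   | inj₂ d = cross g h , ↭-trans (verts-cross g h) (Pₚ.++⁺ˡ (P ++ N) p) ,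
            balanced-straight g (swap-group h) b (sym b′) , near-straight W g (swap-group h) d

  -- The unit is turned so that its larger side joins the side with the smaller degree sum.
  merge-unit : ∀ W s g u → Balanced g → Near W (suc s) g → Balanced u → Unit W u →
    ∃ λ h → (verts h ↭ verts u ++ verts g) × Balanced h × Near W (suc (s ∸ 1)) h
  merge-unit W s g@(P , N) u@(P′ , N′) b c b′ c′ with ≤-total (E P W) (E N W) | c′
  ... | inj₁ x | inj₁ y = straight g u , ↭-trans (verts-straight g u) (Pₚ.++-comm (P ++ N) (P′ ++ N′)) ,
          balanced-straight g u b b′ , near-straight W g u (close-step x c y)
  ... | inj₁ x | inj₂ y = cross g u , ↭-trans (verts-cross g u) (Pₚ.++-comm (P ++ N) (P′ ++ N′)) ,
          balanced-straight g (swap-group u) b (sym b′) , near-straight W g (swap-group u) (close-step x c y)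
  ... | inj₂ x | inj₁ y = cross g u , ↭-trans (verts-cross g u) (Pₚ.++-comm (P ++ N) (P′ ++ N′)) ,
          balanced-straight g (swap-group u) b (sym b′) ,
          near-straight W g (swap-group u) (close-swap (close-step x (close-swap c) y))
  ... | inj₂ x | inj₂ y = straight g u , ↭-trans (verts-straight g u) (Pₚ.++-comm (P ++ N) (P′ ++ N′)) ,
          balanced-straight g u b b′ , near-straight W g u (close-swap (close-step x (close-swap c) y))

  -- Each unit lowers the tolerance by one until it is 1; surplus units keep it there.
  merge-units : ∀ W s us g → s ≤ length us → Balanced g → Near W (suc s) g → All Balanced us → All (Unit W) us →
    ∃ λ h → (verts h ↭ flat us ++ verts g) × Balanced h × Near W 1 h
  merge-units W .0 []       g z≤n b c _ _ = g , ↭-refl , b , c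
  merge-units W s (u ∷ us) g s≤ b c (b′ ∷ bs) (c′ ∷ cs) with merge-unit W s g u b c b′ c′
  ... | h , p , bh , ch with merge-units W (s ∸ 1) us h (∸-monoˡ-≤ 1 s≤) bh ch bs cs
  ...   | k , q , bk , ck = k ,
          ↭-trans q (↭-trans (Pₚ.++⁺ˡ (flat us) p) (↭-trans (Pₚ.shifts (flat us) (verts u))
            (P.↭-reflexive (sym (++-assoc (verts u) (flat us) (verts g)))))) , bk , ck

  -- The edges between the sides contribute `E P N` to both degree sums and cancel. What remains are
  -- two even numbers at distance at most 1.
  near-1⇒equal : ∀ P N → Near (P ++ N) 1 (P , N) → E P P ≡ E N N
  near-1⇒equal P N (u , l) with E-even P | E-even N
  ... | j , eqj | k , eqk = trans eqj (trans (cong (λ x → x + x) (even-close {j} {k} close)) (sym eqk))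
    where
    c = E P N
    strip : ∀ {x y} → x + c ≤ c + y + 1 → x ≤ y + 1
    strip {x} {y} h = +-cancelʳ-≤ c x (y + 1) (≤-trans h (≤-reflexive (shuffle c y)))
      where
      shuffle : ∀ a b → a + b + 1 ≡ b + 1 + a
      shuffle = solve-∀
    EP : E P (P ++ N) ≡ (j + j) + c
    EP = trans (E-++ʳ P P N) (cong (_+ c) eqj)
    EN : E N (P ++ N) ≡ c + (k + k)
    EN = trans (E-++ʳ N P N) (cong₂ _+_ (E-sym N P) eqk)
    close : Close 1 (j + j) (k + k)
    close = strip (subst₂ (λ s t → s ≤ t + 1) EP EN u) ,
            strip (subst₂ (λ s t → s ≤ t + 1) (trans EN (+-comm c _)) (trans EP (+-comm _ c)) l)

  Split : List V → Set
  Split W = ∃ λ A → ∃ λ B → (A ++ B ↭ W) × length A ≡ length B × E A A ≡ E B B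

  -- The groups `os` are signed greedily, the units `us` then reduce the imbalance to 1, and parity
  -- removes the last one; this is why `T` may exceed the number of units by one.
  finish : ∀ W T us os → (flat us ++ flat os ↭ W) →
    All Balanced us → All (Unit W) us → All Balanced os → All (Near W T) os → T ≤ suc (length us) → Split W
  finish W T us os p bu cu bo co T≤ with merge-all W T os bo co
  ... | g , q , bg , cg with merge-units W (length us) us g ≤-refl bg (close-mono T≤ cg) bu cu
  ...   | (A , B) , r , b , c = A , B , s , b , near-1⇒equal A B (near-↭ (↭-sym s) {A , B} c)
    where s = ↭-trans r (↭-trans (Pₚ.++⁺ˡ (flat us) q) p)

-- Maximal matchings

unpair : X × X → List X
unpair (x , y) = x ∷ y ∷ []

unpair-All : ∀ {P : Pred X 0ℓ} ps → All P (concatMap unpair ps) → All (λ (x , y) → P x × P y) ps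
unpair-All []       []             = []
unpair-All (_ ∷ ps) (px ∷ py ∷ qs) = (px , py) ∷ unpair-All ps qs

length-unpair : ∀ (ps : List (X × X)) → length (concatMap unpair ps) ≡ length ps + length ps
length-unpair []       = refl
length-unpair (_ ∷ ps) = cong suc (trans (cong suc (length-unpair ps)) (sym (+-suc (length ps) (length ps))))

module _ {R : X → X → Set} (R? : ∀ x y → Dec (R x y)) where

  Unmatched : List X → Set
  Unmatched = AllPairs (λ x y → ¬ R x y)

  -- `Unmatched` depends on the order of the list, so it cannot be carried along `ys ↭ y ∷ zs`; the
  -- last component records that deleting `y` in place preserves it.
  find-match : ∀ x ys →
    (∃ λ y → ∃ λ zs → R x y × (ys ↭ y ∷ zs) × (Unmatched ys → Unmatched zs)) ⊎ All (λ y → ¬ R x y) ys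
  find-match x []       = inj₂ []
  find-match x (y ∷ ys) with R? x y | find-match x ys
  ... | yes r | _                         = inj₁ (y , ys , r , ↭-refl , λ { (_ ∷ us) → us })
  ... | no _  | inj₁ (z , zs , r , p , f) = inj₁ (z , y ∷ zs , r , ↭-trans (prep y p) (P.swap y z ↭-refl) ,
                                              λ { (u ∷ us) → All.tail (Pₚ.All-resp-↭ p u) ∷ f us })
  ... | no ¬r | inj₂ all                  = inj₂ (¬r ∷ all)

  maximal-matching : ∀ xs → ∃ λ ps → ∃ λ rest →
    (concatMap unpair ps ++ rest ↭ xs) × All (uncurry R) ps × Unmatched rest
  maximal-matching []       = [] , [] , ↭-refl , [] , []
  maximal-matching (x ∷ xs) with maximal-matching xs
  ... | ps , rest , p , rs , us with find-match x rest
  ...   | inj₁ (y , zs , r , q , f) = (x , y) ∷ ps , zs ,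
            prep x (↭-trans (↭-sym (Pₚ.shift y (concatMap unpair ps) zs)) (↭-trans (Pₚ.++⁺ˡ (concatMap unpair ps) (↭-sym q)) p)) ,
            r ∷ rs , f us
  ...   | inj₂ all = ps , x ∷ rest , ↭-trans (Pₚ.shift x (concatMap unpair ps) rest) (prep x p) , rs , all ∷ us

-- An element of an unmatched list has large weight towards all later elements of its own bucket.
module _ (bucket : X → ℕ) (w : X → X → ℕ) (θ : ℕ) where

  Compatible : X → X → Set
  Compatible x y = bucket x ≡ bucket y × w x y ≤ θ

  compatible? : ∀ x y → Dec (Compatible x y)
  compatible? x y = (bucket x ≟ bucket y) ×-dec (w x y ≤? θ)

  length-one-bucket : ∀ {m Ω} b xs → Unmatched compatible? xs → All (λ x → bucket x ≡ b) xs →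
    All (λ x → ∑ (w x) xs ≤ Ω) xs → Ω < suc θ * suc m → length xs ≤ suc m
  length-one-bucket b []       _        _        _       _  = z≤n
  -- From here on `xs` is the tail: it has fewer than `suc m` elements, and the strict inequality
  -- leaves room for the head.
  length-one-bucket {m} {Ω} b (x ∷ xs) (us ∷ _) (q ∷ qs) (o ∷ _) lt = *-cancelˡ-< (suc θ) (length xs) (suc m) (begin-strict
    suc θ * length xs ≡⟨ *-comm (suc θ) (length xs) ⟩
    length xs * suc θ ≤⟨ length*≤∑ (heavy us qs) ⟩
    ∑ (w x) xs        ≤⟨ m≤n+m _ (w x x) ⟩
    ∑ (w x) (x ∷ xs)  ≤⟨ o ⟩
    Ω                 <⟨ lt ⟩
    suc θ * suc m     ∎)
    where
    open ≤-Reasoning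
    heavy : ∀ {ys} → All (λ y → ¬ Compatible x y) ys → All (λ y → bucket y ≡ b) ys → All (λ y → θ < w x y) ys
    heavy []       []       = []
    heavy (u ∷ us) (r ∷ rs) = ≰⇒> (λ h → u (trans q (sym r) , h)) ∷ heavy us rs

  -- Removing the last bucket leaves a sublist in the same order, so `Unmatched` and the weight
  -- bounds persist.
  length-unmatched : ∀ {m Ω} B xs → Unmatched compatible? xs → All (λ x → bucket x < B) xs →
    All (λ x → ∑ (w x) xs ≤ Ω) xs → Ω < suc θ * suc m → length xs ≤ B * suc m
  length-unmatched zero    []       _  _        _  _  = z≤n
  length-unmatched zero    (x ∷ xs) _  (() ∷ _) _  _
  length-unmatched {m} {Ω} (suc B) xs us bs os lt = begin
    length xs                   ≡⟨ Pₚ.↭-length (filter-split last? xs) ⟨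
    length (ys ++ zs)           ≡⟨ length-++ ys ⟩
    length ys + length zs       ≤⟨ +-mono-≤
      (length-one-bucket B ys (AllPairsₚ.filter⁺ last? us) (Allₚ.all-filter last? xs) (restrict last?) lt)
      (length-unmatched B zs (AllPairsₚ.filter⁺ (¬? ∘ last?) us) below (restrict (¬? ∘ last?)) lt) ⟩
    suc m + B * suc m           ∎
    where
    open ≤-Reasoning
    last? : ∀ x → Dec (bucket x ≡ B)
    last? x = bucket x ≟ B
    ys = filter last? xs
    zs = filter (¬? ∘ last?) xs
    restrict : ∀ {P : Pred X 0ℓ} (P? : Decidable P) → All (λ x → ∑ (w x) (filter P? xs) ≤ Ω) (filter P? xs)
    restrict P? = Allₚ.filter⁺ P? (All.map (λ {x} → ≤-trans (∑-filter-≤ P? (w x) xs)) os)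
    below : All (λ x → bucket x < B) zs
    below = All.zipWith (λ (l , ne) → ≤∧≢⇒< (≤-pred l) ne)
      (Allₚ.filter⁺ (¬? ∘ last?) bs , Allₚ.all-filter (¬? ∘ last?) xs)

-- Bucketing of signed differences

quotient-close : ∀ s s′ d → s / suc d ≡ s′ / suc d → s ≤ s′ + d
quotient-close s s′ d eq = begin
  s                               ≡⟨ m≡m%n+[m/n]*n s (suc d) ⟩
  s % suc d + s / suc d * suc d   ≤⟨ +-mono-≤ (≤-pred (m%n<n s (suc d))) (≤-reflexive (cong (_* suc d) eq)) ⟩
  d + s′ / suc d * suc d          ≤⟨ +-monoʳ-≤ d (m/n*n≤m s′ (suc d)) ⟩
  d + s′                          ≡⟨ +-comm d s′ ⟩
  s′ + d                          ∎
  where open ≤-Reasoning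

n<m*suc[n/m] : ∀ n m .{{_ : NonZero m}} → n < m * suc (n / m)
n<m*suc[n/m] n m = begin-strict
  n                   ≡⟨ m≡m%n+[m/n]*n n m ⟩
  n % m + n / m * m   <⟨ +-monoˡ-< (n / m * m) (m%n<n n m) ⟩
  m + n / m * m       ≡⟨ *-comm (suc (n / m)) m ⟩
  m * suc (n / m)     ∎
  where open ≤-Reasoning

-- `p + T ∸ m` is the signed difference p - m moved into the natural numbers; `Close T` rules out
-- truncation. Equal quotients put the two differences within `d` of each other, and `cross`
-- subtracts one from the other.
shifted-difference-close : ∀ {T p m p′ m′} d → Close T p m → Close T p′ m′ →
  (p + T ∸ m) / suc d ≡ (p′ + T ∸ m′) / suc d → Close d (p + m′) (m + p′)
shifted-difference-close {T} {p} {m} {p′} {m′} d (_ , l) (_ , l′) eq =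
  ≤-trans (half l l′ (quotient-close _ _ d eq)) (≤-reflexive (cong (_+ d) (+-comm p′ m))) ,
  ≤-trans (≤-reflexive (+-comm m p′)) (half l′ l (quotient-close _ _ d (sym eq)))
  where
  half : ∀ {p m p′ m′} → m ≤ p + T → m′ ≤ p′ + T → p + T ∸ m ≤ p′ + T ∸ m′ + d → p + m′ ≤ p′ + m + d
  half {p} {m} {p′} {m′} l l′ h = +-cancelʳ-≤ T _ _ (begin
    p + m′ + T                      ≡⟨ shuffle₁ p m′ T ⟩
    p + T + m′                      ≡⟨ cong (_+ m′) (m∸n+n≡m l) ⟨
    p + T ∸ m + m + m′              ≤⟨ +-monoˡ-≤ m′ (+-monoˡ-≤ m h) ⟩
    p′ + T ∸ m′ + d + m + m′        ≡⟨ shuffle₂ (p′ + T ∸ m′) d m m′ ⟩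
    p′ + T ∸ m′ + m′ + (m + d)      ≡⟨ cong (_+ (m + d)) (m∸n+n≡m l′) ⟩
    p′ + T + (m + d)                ≡⟨ shuffle₃ p′ T m d ⟩
    p′ + m + d + T                  ∎)
    where
    open ≤-Reasoning
    shuffle₁ : ∀ a b c → a + b + c ≡ a + c + b
    shuffle₁ = solve-∀
    shuffle₂ : ∀ a b c d → a + b + c + d ≡ a + d + (c + b)
    shuffle₂ = solve-∀
    shuffle₃ : ∀ a b c d → a + b + (c + d) ≡ a + c + d + b
    shuffle₃ = solve-∀

-- Pairing groups while preserving single edges

once : ℕ → ℕ
once 1 = 1
once _ = 0

once≤ : ∀ n → once n ≤ n
once≤ 0             = z≤n
once≤ 1             = ≤-refl
once≤ (suc (suc _)) = z≤n

-- Something is lost only if both numbers are positive; the loss is then at most 2, and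
-- `2 * (m * n)` covers it.
once-+ : ∀ m n → once m + once n ≤ once (m + n) + 2 * (m * n)
once-+ 0             n             = m≤m+n (once n) 0
once-+ 1             0             = ≤-refl
once-+ 1             1             = ≤-refl
once-+ 1             (suc (suc n)) = s≤s z≤n
once-+ (suc (suc m)) 0             = z≤n
once-+ (suc (suc m)) 1             = ≤-trans (s≤s z≤n) (m≤n+m _ (once (suc (suc m) + 1)))
once-+ (suc (suc m)) (suc (suc n)) = z≤n

module Pairing {V : Set} (a : V → V → ℕ) (a-sym : ∀ u v → a u v ≡ a v u)
  (a-irrefl : ∀ v → a v v ≡ 0) (a≤1 : ∀ u v → a u v ≤ 1) where
  open Bilinear a a-sym a-irrefl a≤1

  -- A general `Ys` serves two uses: when groups of vertices to be split are merged, it consists of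
  -- the single vertices of `Q`; when vertices of `Q` are paired, it consists of the vertex lists of
  -- the groups.
  gain : List (List V) → Group V → ℕ
  gain Ys g = ∑ (λ Y → once (E (verts g) Y)) Ys

  joint : List (List V) → Group V → Group V → ℕ
  joint Ys g h = ∑ (λ Y → E (verts g) Y * E (verts h) Y) Ys

  total : List (List V) → Group V → ℕ
  total Ys g = ∑ (E (verts g)) Ys

  gain≤total : ∀ Ys g → gain Ys g ≤ total Ys g
  gain≤total Ys g = ∑-mono (All.universal (λ Y → once≤ (E (verts g) Y)) Ys)

  gain-cross : ∀ Ys g h → gain Ys g + gain Ys h ≤ gain Ys (cross g h) + 2 * joint Ys g h
  gain-cross Ys g h = begin
    gain Ys g + gain Ys h
      ≡⟨ ∑-distrib-+ (λ Y → once (E (verts g) Y)) (λ Y → once (E (verts h) Y)) Ys ⟨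
    ∑ (λ Y → once (E (verts g) Y) + once (E (verts h) Y)) Ys
      ≤⟨ ∑-mono (All.universal once-cross Ys) ⟩
    ∑ (λ Y → once (E (verts (cross g h)) Y) + 2 * (E (verts g) Y * E (verts h) Y)) Ys
      ≡⟨ ∑-distrib-+ (λ Y → once (E (verts (cross g h)) Y)) (λ Y → 2 * (E (verts g) Y * E (verts h) Y)) Ys ⟩
    gain Ys (cross g h) + ∑ (λ Y → 2 * (E (verts g) Y * E (verts h) Y)) Ys
      ≡⟨ cong (gain Ys (cross g h) +_) (*-distribˡ-∑ 2 (λ Y → E (verts g) Y * E (verts h) Y) Ys) ⟩
    gain Ys (cross g h) + 2 * joint Ys g h ∎
    where
    open ≤-Reasoning
    cross-E : ∀ Y → E (verts (cross g h)) Y ≡ E (verts g) Y + E (verts h) Y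
    cross-E Y = trans (E-↭ˡ Y (verts-cross g h)) (E-++ˡ (verts g) (verts h) Y)
    once-cross : ∀ Y → once (E (verts g) Y) + once (E (verts h) Y) ≤
      once (E (verts (cross g h)) Y) + 2 * (E (verts g) Y * E (verts h) Y)
    once-cross Y = subst (λ z → once p + once q ≤ once z + 2 * (p * q)) (sym (cross-E Y)) (once-+ p q)
      where
      p = E (verts g) Y
      q = E (verts h) Y

  E-flat : ∀ L Y → E (flat L) Y ≡ ∑ (λ g → E (verts g) Y) L
  E-flat L Y = ∑-concatMap (λ x → e x Y) verts L

  -- Exchanging the sums gives the sum over `Y` of `E (verts g) Y * E (flat L) Y`. This bound on the
  -- total joint weight of one group is what lets a maximal matching keep every joint weight at most
  -- `θ`.
  ∑-joint : ∀ Ys {σ₁ σ₂} g L → All (λ Y → E (flat L) Y ≤ σ₁) Ys → total Ys g ≤ σ₂ → ∑ (joint Ys g) L ≤ σ₁ * σ₂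
  ∑-joint Ys {σ₁} {σ₂} g L b₁ b₂ = begin
    ∑ (joint Ys g) L
      ≡⟨ ∑-swap (λ h Y → E (verts g) Y * E (verts h) Y) L Ys ⟩
    ∑ (λ Y → ∑ (λ h → E (verts g) Y * E (verts h) Y) L) Ys
      ≤⟨ ∑-mono (All.map (λ {Y} → bound Y) b₁) ⟩
    ∑ (λ Y → σ₁ * E (verts g) Y) Ys
      ≡⟨ *-distribˡ-∑ σ₁ (E (verts g)) Ys ⟩
    σ₁ * total Ys g
      ≤⟨ *-monoʳ-≤ σ₁ b₂ ⟩
    σ₁ * σ₂ ∎
    where
    open ≤-Reasoning
    bound : ∀ Y → E (flat L) Y ≤ σ₁ → ∑ (λ h → E (verts g) Y * E (verts h) Y) L ≤ σ₁ * E (verts g) Y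
    bound Y b = begin
      ∑ (λ h → E (verts g) Y * E (verts h) Y) L   ≡⟨ *-distribˡ-∑ (E (verts g) Y) (λ h → E (verts h) Y) L ⟩
      E (verts g) Y * ∑ (λ h → E (verts h) Y) L   ≡⟨ cong (E (verts g) Y *_) (E-flat L Y) ⟨
      E (verts g) Y * E (flat L) Y                ≤⟨ *-monoʳ-≤ (E (verts g) Y) b ⟩
      E (verts g) Y * σ₁                          ≡⟨ *-comm (E (verts g) Y) σ₁ ⟩
      σ₁ * E (verts g) Y                          ∎

  crosses : List (Group V × Group V) → List (Group V)
  crosses = map (uncurry cross)

  flat-crosses : ∀ ps → flat (crosses ps) ↭ flat (concatMap unpair ps)
  flat-crosses []             = ↭-refl
  flat-crosses ((g , h) ∷ ps) = ↭-trans (Pₚ.++⁺ (verts-cross g h) (flat-crosses ps))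
    (P.↭-reflexive (++-assoc (verts g) (verts h) _))

  near-cross : ∀ {T} W (g h : Group V) → Close T (E (proj₁ g) W + E (proj₂ h) W) (E (proj₂ g) W + E (proj₁ h) W) →
    Near W T (cross g h)
  near-cross W g h = near-straight W g (swap-group h)

  record Paired (W : List V) (T′ : ℕ) (Ys : List (List V)) (θ B σ₂ : ℕ) (L : List (Group V)) : Set where
    field
      pairs : List (Group V × Group V)
      rest  : List (Group V)
      perm  : concatMap unpair pairs ++ rest ↭ L
      near  : All (Near W T′) (crosses pairs)
      few   : length rest ≤ B
      -- A matched pair loses at most `2 * θ` by `gain-cross`; an unmatched group is charged its
      -- whole gain.
      gains : ∑ (gain Ys) L ≤ ∑ (gain Ys) (crosses pairs) + length pairs * (2 * θ) + length rest * σ₂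

    All-pairs : ∀ {P : Pred (Group V) 0ℓ} → All P L → All (λ (g , h) → P g × P h) pairs
    All-pairs ps = unpair-All pairs (Allₚ.++⁻ˡ (concatMap unpair pairs) (Pₚ.All-resp-↭ (↭-sym perm) ps))

    All-rest : ∀ {P : Pred (Group V) 0ℓ} → All P L → All P rest
    All-rest ps = Allₚ.++⁻ʳ (concatMap unpair pairs) (Pₚ.All-resp-↭ (↭-sym perm) ps)

    flat-perm : flat (crosses pairs) ++ flat rest ↭ flat L
    flat-perm = ↭-trans (Pₚ.++⁺ʳ (flat rest) (flat-crosses pairs))
      (↭-trans (P.↭-reflexive (sym (concatMap-++ verts (concatMap unpair pairs) rest))) (concatMap-↭ verts perm))

    length-pairs : length pairs ≤ length L
    length-pairs = begin
      length pairs                                ≤⟨ m≤m+n _ _ ⟩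
      length pairs + length pairs                 ≡⟨ length-unpair pairs ⟨
      length (concatMap unpair pairs)             ≤⟨ m≤m+n _ _ ⟩
      length (concatMap unpair pairs) + length rest ≡⟨ length-++ (concatMap unpair pairs) ⟨
      length (concatMap unpair pairs ++ rest)     ≡⟨ Pₚ.↭-length perm ⟩
      length L                                    ∎
      where open ≤-Reasoning

  -- Two groups may be matched when their shifted differences lie in one bucket of width
  -- `suc (T / ρ)` and their joint weight is at most `θ`. A maximal matching leaves at most `suc m`
  -- groups in each of the `ρ + ρ` buckets, since otherwise some group would violate `∑-joint`.
  pair-groups : ∀ W T ρ .{{_ : NonZero ρ}} Ys θ m σ₁ σ₂ L → All (Near W T) L →
    All (λ Y → E (flat L) Y ≤ σ₁) Ys → All (λ g → total Ys g ≤ σ₂) L → σ₁ * σ₂ < suc θ * suc m →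
    Paired W (T / ρ) Ys θ ((ρ + ρ) * suc m) σ₂ L
  pair-groups W T ρ Ys θ m σ₁ σ₂ L nears b₁ b₂ lt with maximal-matching (compatible? bucket (joint Ys) θ) L
    where
    bucket : Group V → ℕ
    bucket (P , N) = (E P W + T ∸ E N W) / suc (T / ρ)
  ... | ps , rest , p , rs , us = record
    { pairs = ps ; rest = rest ; perm = p
    ; near = near-all ps rs (unpair-All ps (Allₚ.++⁻ˡ (concatMap unpair ps) nears′))
    ; few = length-unmatched bucket (joint Ys) θ (ρ + ρ) rest us (All.map (λ {g} → bucket< g) (Allₚ.++⁻ʳ (concatMap unpair ps) nears′))
        (All.map (λ {g} b → ≤-trans (rest≤ g) (∑-joint Ys g L b₁ b)) (Allₚ.++⁻ʳ (concatMap unpair ps) b₂′)) lt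
    ; gains = begin
        ∑ (gain Ys) L                                      ≡⟨ ∑-↭ (gain Ys) p ⟨
        ∑ (gain Ys) (concatMap unpair ps ++ rest)          ≡⟨ ∑-++ (gain Ys) (concatMap unpair ps) rest ⟩
        ∑ (gain Ys) (concatMap unpair ps) + ∑ (gain Ys) rest
          ≤⟨ +-mono-≤ (gain-all ps rs) (∑≤length* (All.map (λ {g} → ≤-trans (gain≤total Ys g)) (Allₚ.++⁻ʳ (concatMap unpair ps) b₂′))) ⟩
        ∑ (gain Ys) (crosses ps) + length ps * (2 * θ) + length rest * σ₂ ∎
    }
    where
    open ≤-Reasoning
    bucket : Group V → ℕ
    bucket (P , N) = (E P W + T ∸ E N W) / suc (T / ρ)
    nears′ : All (Near W T) (concatMap unpair ps ++ rest)
    nears′ = Pₚ.All-resp-↭ (↭-sym p) nears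
    b₂′ : All (λ g → total Ys g ≤ σ₂) (concatMap unpair ps ++ rest)
    b₂′ = Pₚ.All-resp-↭ (↭-sym p) b₂
    rest≤ : ∀ g → ∑ (joint Ys g) rest ≤ ∑ (joint Ys g) L
    rest≤ g = begin
      ∑ (joint Ys g) rest                                                ≤⟨ m≤n+m _ _ ⟩
      ∑ (joint Ys g) (concatMap unpair ps) + ∑ (joint Ys g) rest         ≡⟨ ∑-++ (joint Ys g) (concatMap unpair ps) rest ⟨
      ∑ (joint Ys g) (concatMap unpair ps ++ rest)                       ≡⟨ ∑-↭ (joint Ys g) p ⟩
      ∑ (joint Ys g) L                                                   ∎
    -- The shifted difference is at most `T + T`, and `T` is less than `ρ * suc (T / ρ)`.
    bucket< : ∀ g → Near W T g → bucket g < ρ + ρ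
    bucket< (P , N) (u , l) = m<n*o⇒m/o<n (begin-strict
      E P W + T ∸ E N W           ≤⟨ m≤n+o⇒m∸n≤o (E P W + T) (E N W) (≤-trans (+-monoˡ-≤ T u) (≤-reflexive (+-assoc (E N W) T T))) ⟩
      T + T                       <⟨ +-mono-< (n<m*suc[n/m] T ρ) (n<m*suc[n/m] T ρ) ⟩
      ρ * suc (T / ρ) + ρ * suc (T / ρ) ≡⟨ *-distribʳ-+ (suc (T / ρ)) ρ ρ ⟨
      (ρ + ρ) * suc (T / ρ)       ∎)
    near-all : ∀ qs → All (uncurry (Compatible bucket (joint Ys) θ)) qs → All (λ (g , h) → Near W T g × Near W T h) qs →
      All (Near W (T / ρ)) (crosses qs)
    near-all []             []             []             = []
    near-all ((g , h) ∷ qs) ((eq , _) ∷ rs) ((c , d) ∷ cs) =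
      near-cross W g h (shifted-difference-close (T / ρ) c d eq) ∷ near-all qs rs cs
    gain-all : ∀ qs → All (uncurry (Compatible bucket (joint Ys) θ)) qs →
      ∑ (gain Ys) (concatMap unpair qs) ≤ ∑ (gain Ys) (crosses qs) + length qs * (2 * θ)
    gain-all []             []             = z≤n
    gain-all ((g , h) ∷ qs) ((_ , b) ∷ rs) = begin
      gain Ys g + (gain Ys h + G)                  ≡⟨ +-assoc (gain Ys g) (gain Ys h) G ⟨
      gain Ys g + gain Ys h + G                    ≤⟨ +-mono-≤ (≤-trans (gain-cross Ys g h) (+-monoʳ-≤ (gain Ys (cross g h)) (*-monoʳ-≤ 2 b))) (gain-all qs rs) ⟩
      (gain Ys (cross g h) + 2 * θ) + (∑ (gain Ys) (crosses qs) + length qs * (2 * θ))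
        ≡⟨ +-interchange′ (gain Ys (cross g h)) (2 * θ) (∑ (gain Ys) (crosses qs)) (length qs * (2 * θ)) ⟩
      gain Ys (cross g h) + ∑ (gain Ys) (crosses qs) + (2 * θ + length qs * (2 * θ)) ∎
      where
      G = ∑ (gain Ys) (concatMap unpair qs)
      +-interchange′ : ∀ a b c d → (a + b) + (c + d) ≡ a + c + (b + d)
      +-interchange′ = solve-∀

-- Bookkeeping of one refinement: the good vertices split into the paired `G` and the unpaired `X`;
-- `X` joins the old junk `B`, which is paired into `J` up to a remainder `R`, and `R` joins the
-- dropped vertices `D`.
regroup : ∀ (G J R D X B : List A) {Y W} → J ++ R ↭ X ++ B → G ++ X ↭ Y → (Y ++ B) ++ D ↭ W → (G ++ J) ++ (R ++ D) ↭ W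
regroup G J R D X B {Y} {W} p q t = begin
  (G ++ J) ++ (R ++ D)   ≡⟨ ++-assoc (G ++ J) R D ⟨
  ((G ++ J) ++ R) ++ D   ≡⟨ cong (_++ D) (++-assoc G J R) ⟩
  (G ++ (J ++ R)) ++ D   ↭⟨ Pₚ.++⁺ʳ D (Pₚ.++⁺ˡ G p) ⟩
  (G ++ (X ++ B)) ++ D   ≡⟨ cong (_++ D) (++-assoc G X B) ⟨
  ((G ++ X) ++ B) ++ D   ↭⟨ Pₚ.++⁺ʳ D (Pₚ.++⁺ʳ B q) ⟩
  (Y ++ B) ++ D          ↭⟨ t ⟩
  W                      ∎
  where open P.PermutationReasoning

once-≤1 : ∀ {n} → n ≤ 1 → once n ≡ n
once-≤1 z≤n       = refl
once-≤1 (s≤s z≤n) = refl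

∑-once : ∀ (f : A → ℕ) xs → ∑ (λ x → once (f x)) xs ≡ length (filter (λ x → f x ≟ 1) xs)
∑-once f []       = refl
∑-once f (x ∷ xs) with f x
... | 0           = ∑-once f xs
... | 1           = cong suc (∑-once f xs)
... | suc (suc _) = ∑-once f xs

+≡1 : ∀ m n → m + n ≡ 1 → (m ≡ 1 × n ≡ 0) ⊎ (m ≡ 0 × n ≡ 1)
+≡1 0       1 refl = inj₂ (refl , refl)
+≡1 1       0 refl = inj₁ (refl , refl)
+≡1 (suc (suc _)) _ ()

length-flat : ∀ {s} (L : List (Group A)) → All (λ g → length (verts g) ≤ s) L → length (flat L) ≤ length L * s
length-flat []      []       = z≤n
length-flat (g ∷ L) (b ∷ bs) = ≤-trans (≤-reflexive (length-++ (verts g))) (+-mono-≤ b (length-flat L bs))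

single : A → Group A
single x = [ x ] , []

flat-single : ∀ (xs : List A) → flat (map single xs) ≡ xs
flat-single []       = refl
flat-single (x ∷ xs) = cong (x ∷_) (flat-single xs)

-- Single vertices have shape 1, every later group has shape 0.
Shape : ℕ → Group A → Set
Shape β (P , N) = length P ≡ length N + β

-- Turning the second group over makes its surplus `β` a deficit, which cancels the surplus of the
-- first.
shape-cross : ∀ {β} (g h : Group A) → Shape β g → Shape β h → Shape 0 (cross g h)
shape-cross {β = β} (P , N) (P′ , N′) b b′ = begin
  length (P ++ N′)                  ≡⟨ length-++ P ⟩
  length P + length N′              ≡⟨ cong (_+ length N′) b ⟩
  length N + β + length N′          ≡⟨ shuffle (length N) β (length N′) ⟩
  length N + (length N′ + β) + 0    ≡⟨ cong (λ x → length N + x + 0) b′ ⟨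
  length N + length P′ + 0          ≡⟨ cong (_+ 0) (length-++ N) ⟨
  length (N ++ P′) + 0              ∎
  where
  open ≡-Reasoning
  shuffle : ∀ a b c → a + b + c ≡ a + (c + b) + 0
  shuffle = solve-∀

shape⇒balanced : ∀ {g : Group A} → Shape 0 g → Balanced g
shape⇒balanced {g = _ , N} b = trans b (+-identityʳ (length N))

-- Refinement into exactly balanced groups, and units from a reserved set

module Refinement {V : Set} (a : V → V → ℕ) (a-sym : ∀ u v → a u v ≡ a v u)
  (a-irrefl : ∀ v → a v v ≡ 0) (a≤1 : ∀ u v → a u v ≤ 1) where
  open Bilinear a a-sym a-irrefl a≤1 public
  open Pairing a a-sym a-irrefl a≤1 public

  SplitUpTo : ℕ → List V → Set
  SplitUpTo d L = ∃ λ kept → ∃ λ rest → (kept ++ rest ↭ L) × length rest ≤ d × Split kept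

  All-crosses : ∀ {W T Ys θ B σ L} {P Q : Pred (Group V) 0ℓ} → (∀ g h → P g → P h → Q (cross g h)) →
    (p : Paired W T Ys θ B σ L) → All P L → All Q (crosses (Paired.pairs p))
  All-crosses f p ps = Allₚ.map⁺ (All.map (λ {(g , h)} (x , y) → f g h x y) (Paired.All-pairs p ps))

  e-part : ∀ x X {Y W d} → X ++ Y ↭ W → e x W ≤ d → e x X ≤ d
  e-part x X {Y} p b = ≤-trans (≤-trans (m≤m+n _ _) (≤-reflexive (sym (∑-++ (a x) X Y))))
    (≤-trans (≤-reflexive (e-↭ x p)) b)

  length-cross≤ : ∀ {s} (g h : Group V) → length (verts g) ≤ s → length (verts h) ≤ s → length (verts (cross g h)) ≤ s + s
  length-cross≤ g h b b′ = ≤-trans (≤-reflexive (trans (Pₚ.↭-length (verts-cross g h)) (length-++ (verts g)))) (+-mono-≤ b b′)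

  length-proj₁≤ : ∀ {s} (g : Group V) → length (verts g) ≤ s → length (proj₁ g) ≤ s
  length-proj₁≤ (P , N) b = ≤-trans (≤-trans (m≤m+n _ _) (≤-reflexive (sym (length-++ P)))) b

  length-proj₂≤ : ∀ {s} (g : Group V) → length (verts g) ≤ s → length (proj₂ g) ≤ s
  length-proj₂≤ (P , N) b = ≤-trans (≤-trans (m≤n+m _ (length P)) (≤-reflexive (sym (length-++ P)))) b

  E≤ : ∀ X Y → E X Y ≤ length X * length Y
  E≤ X Y = E≤length* X Y (All.universal (λ x → e≤length x Y) X)

  -- Passing to the kept part `W` loses at most one edge for each pair of a group vertex and a
  -- dropped vertex.
  near-drop : ∀ {W W₀ D T s d} (g : Group V) → W ++ D ↭ W₀ → length (verts g) ≤ s → length D ≤ d →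
    Near W₀ T g → Near W (T + s * d) g
  near-drop {W} {W₀} {D} {T} {s} {d} g@(P , N) p bs bd (u , l) =
    half P N (length-proj₂≤ g bs) u , half N P (length-proj₁≤ g bs) l
    where
    open ≤-Reasoning
    half : ∀ X Y → length Y ≤ s → E X W₀ ≤ E Y W₀ + T → E X W ≤ E Y W + (T + s * d)
    half X Y bY h = begin
      E X W                      ≤⟨ E-monoʳ X W D ⟩
      E X (W ++ D)               ≡⟨ E-↭ʳ X p ⟩
      E X W₀                     ≤⟨ h ⟩
      E Y W₀ + T                 ≡⟨ cong (_+ T) (E-↭ʳ Y p) ⟨
      E Y (W ++ D) + T           ≡⟨ cong (_+ T) (E-++ʳ Y W D) ⟩
      E Y W + E Y D + T          ≤⟨ +-monoˡ-≤ T (+-monoʳ-≤ (E Y W) (≤-trans (E≤ Y D) (*-mono-≤ bY bd))) ⟩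
      E Y W + s * d + T          ≡⟨ shuffle (E Y W) (s * d) T ⟩
      E Y W + (T + s * d)        ∎
      where
      shuffle : ∀ a b c → a + b + c ≡ a + (c + b)
      shuffle = solve-∀

  near-add : ∀ {T s q} W (g : Group V) D → length (verts g) ≤ s → length D ≤ q → Near W T g → Near (D ++ W) (s * q + T) g
  near-add {T} {s} {q} W g@(P , N) D bs bq c = subst₂ (Close _) (sym (E-++ʳ P D W)) (sym (E-++ʳ N D W))
    (close-+ (close-bounded (≤-trans (E≤ P D) (*-mono-≤ (length-proj₁≤ g bs) bq))
                            (≤-trans (E≤ N D) (*-mono-≤ (length-proj₂≤ g bs) bq))) c)

  -- The single edge from `D` ends on one side of `g`, and the sides had equal degree sums into `W`.
  -- So exactly that side is ahead by one.
  unit-add : ∀ W (g : Group V) D → Near W 0 g → E D (verts g) ≡ 1 → Unit (D ++ W) g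
  unit-add W (P , N) D c one with +≡1 (E P D) (E N D) (trans (sym (E-++ˡ P N D)) (trans (E-sym (P ++ N) D) one))
  ... | inj₁ (p , n) = inj₁ (trans (E-++ʳ P D W) (trans (cong₂ _+_ p (close-0 c)) (cong suc (sym (trans (E-++ʳ N D W) (cong (_+ E N W) n))))))
  ... | inj₂ (p , n) = inj₂ (trans (E-++ʳ N D W) (trans (cong₂ _+_ n (sym (close-0 c))) (cong suc (sym (trans (E-++ʳ P D W) (cong (_+ E P W) p))))))

  singles : List V → List (List V)
  singles = map [_]

  total-singles : ∀ Q g → total (singles Q) g ≡ E (verts g) Q
  total-singles Q g = trans (∑-map (E (verts g)) [_] Q)
    (trans (∑-cong (λ x → sym (e≡E x (verts g))) Q) (E-sym Q (verts g)))

  -- `S` bounds the group sizes before the last merge, so `(S + S) * Δ` bounds the edges between a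
  -- group and `Q`. The product in `small` bounds the total joint weight, both when groups of `W₀`
  -- are paired and when vertices of `Q` are.
  module Dense (W₀ Q : List V) (Δ n r S θ m : ℕ) .{{_ : NonZero r}}
    (degW : All (λ v → e v W₀ ≤ Δ) W₀) (degWQ : All (λ v → e v Q ≤ Δ) W₀) (degQ : All (λ x → e x W₀ ≤ Δ) Q)
    (lenW : length W₀ ≤ n) (lenQ : length Q ≤ n) (small : Δ * ((S + S) * Δ) < suc θ * suc m) where

    σ : ℕ
    σ = (S + S) * Δ

    -- Gain given up by one pairing into `ρ + ρ` buckets: `2 * θ` for each of at most `n` pairs, and
    -- `σ` for each unmatched group.
    loss : ℕ → ℕ
    loss ρ = n * (2 * θ) + (ρ + ρ) * suc m * σ

    -- Groups in `good` are merged with regard to `Q`. Those left unmatched become `junk` and are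
    -- merged for balance only, because dropping them all would shift the differences too much. `c`
    -- is the gain lost so far.
    record State (T s β d c : ℕ) : Set where
      field
        good junk : List (Group V)
        dropped   : List V
        perm      : (flat good ++ flat junk) ++ dropped ↭ W₀
        near      : All (Near W₀ T) (good ++ junk)
        shape     : All (Shape β) (good ++ junk)
        size      : All (λ g → length (verts g) ≤ s) (good ++ junk)
        length-good    : length good ≤ n
        length-dropped : length dropped ≤ d
        gains     : E W₀ Q ≤ ∑ (gain (singles Q)) good + c

    weaken : ∀ {T s s′ β d d′ c c′} → s ≤ s′ → d ≤ d′ → c ≤ c′ → State T s β d c → State T s′ β d′ c′
    weaken s≤ d≤ c≤ st = record
      { State st
      ; size = All.map (λ b → ≤-trans b s≤) size
      ; length-dropped = ≤-trans length-dropped d≤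
      ; gains = ≤-trans gains (+-monoʳ-≤ _ c≤) }
      where open State st

    initial : State Δ 1 1 0 0
    initial = record
      { good = map single W₀ ; junk = [] ; dropped = []
      ; perm = P.↭-reflexive (trans (++-identityʳ _) (trans (++-identityʳ _) (flat-single W₀)))
      ; near = lift (All.map (λ {v} b → close-bounded (≤-trans (≤-reflexive (E-singleton v W₀)) b) z≤n) degW)
      ; shape = lift (All.universal (λ _ → refl) W₀)
      ; size = lift (All.universal (λ _ → ≤-refl) W₀)
      ; length-good = ≤-trans (≤-reflexive (length-map single W₀)) lenW
      ; length-dropped = z≤n
      ; gains = ≤-reflexive (trans (∑-cong gain-single W₀) (trans (sym (∑-map (gain (singles Q)) single W₀)) (sym (+-identityʳ _))))
      }
      where
      lift : ∀ {P : Pred (Group V) 0ℓ} → All (P ∘ single) W₀ → All P (map single W₀ ++ [])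
      lift ps = Allₚ.++⁺ (Allₚ.map⁺ ps) []
      gain-single : ∀ v → e v Q ≡ gain (singles Q) (single v)
      gain-single v = trans (∑-cong (λ x → trans (sym (once-≤1 (a≤1 v x))) (cong once (sym (trans (+-identityʳ _) (+-identityʳ _))))) Q)
        (sym (∑-map (λ Y → once (E [ v ] Y)) [_] Q))

    bound-σ₁ : ∀ L {D} → L ++ D ↭ W₀ → All (λ Y → E L Y ≤ Δ) (singles Q)
    bound-σ₁ L p = Allₚ.map⁺ (All.map (λ {x} b → subst (_≤ Δ) (e≡E x L) (e-part x L p b)) degQ)

    bound-σ₂ : ∀ L {D s} → flat L ++ D ↭ W₀ → s ≤ S → All (λ g → length (verts g) ≤ s) L → All (λ g → total (singles Q) g ≤ σ) L
    bound-σ₂ L {D} {s} p s≤S sz = All.zipWith (λ {g} (b , ds) → bound g b ds)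
      (sz , All-concatMap⁻ verts L (Allₚ.++⁻ˡ (flat L) (Pₚ.All-resp-↭ (↭-sym p) degWQ)))
      where
      bound : ∀ g → length (verts g) ≤ s → All (λ v → e v Q ≤ Δ) (verts g) → total (singles Q) g ≤ σ
      bound g b ds = ≤-trans (≤-reflexive (total-singles Q g)) (≤-trans (E≤length* (verts g) Q ds)
        (*-monoˡ-≤ Δ (≤-trans b (≤-trans s≤S (m≤m+n S S)))))

    pair-good : ∀ {D s T W} ρ .{{_ : NonZero ρ}} L → flat L ++ D ↭ W₀ → s ≤ S → All (λ g → length (verts g) ≤ s) L →
      All (Near W T) L → Paired W (T / ρ) (singles Q) θ ((ρ + ρ) * suc m) σ L
    pair-good {W = W} ρ L p s≤S sz nr =
      pair-groups W _ ρ (singles Q) θ m Δ σ L nr (bound-σ₁ (flat L) p) (bound-σ₂ L p s≤S sz) small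

    gains-after : ∀ {W T L c} ρ (p : Paired W T (singles Q) θ ((ρ + ρ) * suc m) σ L) → length L ≤ n →
      E W₀ Q ≤ ∑ (gain (singles Q)) L + c → E W₀ Q ≤ ∑ (gain (singles Q)) (crosses (Paired.pairs p)) + (c + loss ρ)
    gains-after {L = L} {c} ρ p l h = begin
      E W₀ Q                                          ≤⟨ h ⟩
      ∑ (gain (singles Q)) L + c                      ≤⟨ +-monoˡ-≤ c gains ⟩
      G + length pairs * (2 * θ) + length rest * σ + c
        ≤⟨ +-monoˡ-≤ c (+-mono-≤ (+-monoʳ-≤ G (*-monoˡ-≤ (2 * θ) (≤-trans length-pairs l))) (*-monoˡ-≤ σ few)) ⟩
      G + n * (2 * θ) + (ρ + ρ) * suc m * σ + c       ≡⟨ shuffle G (n * (2 * θ)) ((ρ + ρ) * suc m * σ) c ⟩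
      G + (c + loss ρ)                                ∎
      where
      open ≤-Reasoning
      open Paired p
      G = ∑ (gain (singles Q)) (crosses pairs)
      shuffle : ∀ a b c d → a + b + c + d ≡ a + (d + (b + c))
      shuffle = solve-∀

    -- The good groups are paired with regard to `Q`; their remainder and the old junk are paired by
    -- difference alone, and only the few groups left then are dropped.
    refine : ∀ {T s β d c} → s ≤ S → State T s β d c → State (T / r) (s + s) 0 (d + (r + r) * S) (c + loss r)
    refine {T} {s} {β} {d} {c} s≤S st = record
      { good = crosses PG.pairs
      ; junk = crosses PJ.pairs
      ; dropped = flat PJ.rest ++ dropped
      ; perm = perm′
      ; near = Allₚ.++⁺ PG.near PJ.near
      ; shape = Allₚ.++⁺ (All-crosses shape-cross pg (Allₚ.++⁻ˡ good shape)) (All-crosses shape-cross pj shape′)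
      ; size = Allₚ.++⁺ (All-crosses length-cross≤ pg (Allₚ.++⁻ˡ good size)) (All-crosses length-cross≤ pj size′)
      ; length-good = ≤-trans (≤-reflexive (length-map (uncurry cross) PG.pairs)) (≤-trans PG.length-pairs length-good)
      ; length-dropped = begin
          length (flat PJ.rest ++ dropped)          ≡⟨ length-++ (flat PJ.rest) ⟩
          length (flat PJ.rest) + length dropped    ≤⟨ +-mono-≤ (length-flat PJ.rest (PJ.All-rest size′)) length-dropped ⟩
          length PJ.rest * s + d                    ≤⟨ +-monoˡ-≤ d (*-mono-≤ (≤-trans PJ.few (≤-reflexive (*-identityʳ (r + r)))) s≤S) ⟩
          (r + r) * S + d                           ≡⟨ +-comm _ d ⟩
          d + (r + r) * S                           ∎
      ; gains = gains-after r pg length-good gains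
      }
      where
      open ≤-Reasoning
      open State st
      pg : Paired W₀ (T / r) (singles Q) θ ((r + r) * suc m) σ good
      pg = pair-good r good (↭-trans (P.↭-reflexive (sym (++-assoc (flat good) (flat junk) dropped))) perm) s≤S
        (Allₚ.++⁻ˡ good size) (Allₚ.++⁻ˡ good near)
      module PG = Paired pg
      shape′ : All (Shape β) (PG.rest ++ junk)
      shape′ = Allₚ.++⁺ (PG.All-rest (Allₚ.++⁻ˡ good shape)) (Allₚ.++⁻ʳ good shape)
      size′ : All (λ g → length (verts g) ≤ s) (PG.rest ++ junk)
      size′ = Allₚ.++⁺ (PG.All-rest (Allₚ.++⁻ˡ good size)) (Allₚ.++⁻ʳ good size)
      near′ : All (Near W₀ T) (PG.rest ++ junk)
      near′ = Allₚ.++⁺ (PG.All-rest (Allₚ.++⁻ˡ good near)) (Allₚ.++⁻ʳ good near)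
      -- With no `Ys` every joint weight is 0, so `θ` = `m` = 0 is possible and at most one group
      -- per bucket is left.
      pj : Paired W₀ (T / r) [] 0 ((r + r) * 1) 0 (PG.rest ++ junk)
      pj = pair-groups W₀ T r [] 0 0 0 0 (PG.rest ++ junk) near′ [] (All.universal (λ _ → z≤n) _) (s≤s z≤n)
      module PJ = Paired pj
      perm′ : (flat (crosses PG.pairs) ++ flat (crosses PJ.pairs)) ++ (flat PJ.rest ++ dropped) ↭ W₀
      perm′ = regroup (flat (crosses PG.pairs)) (flat (crosses PJ.pairs)) (flat PJ.rest) dropped (flat PG.rest) (flat junk)
        (↭-trans PJ.flat-perm (P.↭-reflexive (concatMap-++ verts PG.rest junk))) PG.flat-perm perm

    -- Each round divides the tolerance by `r` with rounding down, so a tolerance below `r ^ f`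
    -- reaches 0 after `f` rounds.
    iterate : ∀ f {T s d c} → T < r ^ f → s * 2 ^ f ≤ S → State T s 0 d c →
      State 0 S 0 (d + f * ((r + r) * S)) (c + f * loss r)
    iterate zero {zero} {s} {d} {c} _ s≤ st =
      weaken (subst (_≤ S) (*-identityʳ s) s≤) (m≤m+n d 0) (m≤m+n c 0) st
    iterate zero {suc T} (s≤s ()) _ _
    iterate (suc f) {T} {s} {d} {c} T< s≤ st =
      weaken ≤-refl (≤-reflexive (+-assoc d _ _)) (≤-reflexive (+-assoc c _ _))
        (iterate f (m<n*o⇒m/o<n (subst (T <_) (*-comm r (r ^ f)) T<))
          (≤-trans (≤-reflexive (shuffle s (2 ^ f))) s≤)
          (refine (≤-trans (m≤m*n s (2 ^ suc f) {{m^n≢0 2 (suc f)}}) s≤) st))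
      where
      shuffle : ∀ a b → (a + a) * b ≡ a * (2 * b)
      shuffle = solve-∀

    -- Exact balance holds with respect to `W₀`, but dropping `d` vertices can disturb it by
    -- `S * d`. One more pairing with divisor `suc T` has quotient 0, so the pairs `Z` are exact for
    -- the kept vertices. Nothing is dropped this time: the remainder joins `O` with tolerance `T`.
    zero-pairs : ∀ {c d} → State 0 S 0 d c → let T = S * d in
      ∃ λ Z → ∃ λ O → ∃ λ D →
        ((flat Z ++ flat O) ++ D ↭ W₀) × length D ≤ d ×
        All (Near (flat Z ++ flat O) 0) Z × All (Near (flat Z ++ flat O) T) O ×
        All Balanced Z × All Balanced O ×
        All (λ g → length (verts g) ≤ S + S) Z × All (λ g → length (verts g) ≤ S) O ×
        E W₀ Q ≤ ∑ (gain (singles Q)) Z + (c + loss (suc T))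
    zero-pairs {c} {d} st =
      Z , O , dropped , perm′ , length-dropped ,
      All.map (λ {g} → near-↭ W↭ {g}) (subst (λ t → All (Near W t) Z) (m<n⇒m/n≡0 (n<1+n (S * d))) PG.near) ,
      All.map (λ {g} → near-↭ W↭ {g}) (Allₚ.++⁺ (PG.All-rest (Allₚ.++⁻ˡ good nearW)) (Allₚ.++⁻ʳ good nearW)) ,
      All.map (λ {g} → shape⇒balanced {g = g}) (All-crosses shape-cross pg (Allₚ.++⁻ˡ good shape)) ,
      All.map (λ {g} → shape⇒balanced {g = g}) (Allₚ.++⁺ (PG.All-rest (Allₚ.++⁻ˡ good shape)) (Allₚ.++⁻ʳ good shape)) ,
      All-crosses length-cross≤ pg (Allₚ.++⁻ˡ good size) ,
      Allₚ.++⁺ (PG.All-rest (Allₚ.++⁻ˡ good size)) (Allₚ.++⁻ʳ good size) ,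
      gains-after (suc (S * d)) pg length-good gains
      where
      open State st
      W = flat good ++ flat junk
      nearW : All (Near W (S * d)) (good ++ junk)
      nearW = All.zipWith (λ {g} (nr , sz) → near-drop {W} {W₀} {dropped} {0} {S} {d} g perm sz length-dropped nr) (near , size)
      pg : Paired W (S * d / suc (S * d)) (singles Q) θ ((suc (S * d) + suc (S * d)) * suc m) σ good
      pg = pair-good (suc (S * d)) good (↭-trans (P.↭-reflexive (sym (++-assoc (flat good) (flat junk) dropped))) perm) ≤-refl
        (Allₚ.++⁻ˡ good size) (Allₚ.++⁻ˡ good nearW)
      module PG = Paired pg
      Z = crosses PG.pairs
      O = PG.rest ++ junk
      perm′ : (flat Z ++ flat O) ++ dropped ↭ W₀
      perm′ = regroup (flat Z) (flat O) [] dropped (flat PG.rest) (flat junk)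
        (P.↭-reflexive (trans (++-identityʳ (flat O)) (concatMap-++ verts PG.rest junk))) PG.flat-perm perm
      W↭ : W ↭ flat Z ++ flat O
      W↭ = ↭-trans (Pₚ.++⁺ʳ (flat junk) (↭-sym PG.flat-perm)) (P.↭-reflexive
        (trans (++-assoc (flat Z) (flat PG.rest) (flat junk)) (cong (flat Z ++_) (sym (concatMap-++ verts PG.rest junk)))))

    record Cut (M : ℕ) (Z : List (Group V)) (W : List V) (T : ℕ) : Set where
      field
        q        : Group V
        unused   : List V
        perm     : verts q ++ unused ↭ Q
        length-q : length (verts q) ≤ 2
        balanced : Balanced q
        near     : Near W T q
        gains    : M ≤ gain (map verts Z) q

    -- The roles are exchanged: vertices of `Q` are the groups and the vertex lists of `Z` are the
    -- targets. The best pair has gain `M` at least the average, which bounds `E W₀ Q` by `n * M`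
    -- plus all losses.
    find-cut : ∀ {D} Z O ρ .{{_ : NonZero ρ}} {c} → (flat Z ++ flat O) ++ D ↭ W₀ →
      All (λ g → length (verts g) ≤ S + S) Z → E W₀ Q ≤ ∑ (gain (singles Q)) Z + c →
      ∃ λ M → (E W₀ Q ≤ n * M + (c + (n * (2 * θ) + (ρ + ρ) * suc m * Δ))) ×
        (M ≡ 0 ⊎ Cut M Z (flat Z ++ flat O) (Δ / ρ))
    find-cut {D} Z O ρ {c} p sz h = go refl
      where
      W = flat Z ++ flat O
      L = map single Q
      Ys = map verts Z
      p′ : flat Z ++ (flat O ++ D) ↭ W₀
      p′ = ↭-trans (P.↭-reflexive (sym (++-assoc (flat Z) (flat O) D))) p
      nears : All (Near W Δ) L
      nears = Allₚ.map⁺ (All.map (λ {x} b → close-bounded (≤-trans (≤-reflexive (E-singleton x W)) (e-part x W p b)) z≤n) degQ)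
      total≤ : ∀ x → e x W₀ ≤ Δ → total Ys (single x) ≤ Δ
      total≤ x b = begin
        total Ys (single x)                         ≡⟨ ∑-map (E [ x ]) verts Z ⟩
        ∑ (λ g → E [ x ] (verts g)) Z               ≡⟨ ∑-cong (λ g → E-singleton x (verts g)) Z ⟩
        ∑ (λ g → e x (verts g)) Z                   ≡⟨ ∑-concatMap (a x) verts Z ⟨
        e x (flat Z)                                ≤⟨ e-part x (flat Z) p′ b ⟩
        Δ                                           ∎
        where open ≤-Reasoning
      bound₁ : All (λ Y → E (flat L) Y ≤ σ) Ys
      bound₁ = Allₚ.map⁺ (All.zipWith (λ {g} (b , ds) → bound g b ds)
          (sz , All-concatMap⁻ verts Z (Allₚ.++⁻ˡ (flat Z) (Pₚ.All-resp-↭ (↭-sym p′) degWQ))))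
        where
        bound : ∀ g → length (verts g) ≤ S + S → All (λ v → e v Q ≤ Δ) (verts g) → E (flat L) (verts g) ≤ σ
        bound g b ds = ≤-trans (≤-reflexive (trans (cong (λ X → E X (verts g)) (flat-single Q)) (E-sym Q (verts g))))
          (≤-trans (E≤length* (verts g) Q ds) (*-monoˡ-≤ Δ b))
      pq : Paired W (Δ / ρ) Ys θ ((ρ + ρ) * suc m) Δ L
      pq = pair-groups W Δ ρ Ys θ m σ Δ L nears bound₁ (Allₚ.map⁺ (All.map (λ {x} → total≤ x) degQ))
        (subst (_< suc θ * suc m) (*-comm Δ σ) small)
      module PQ = Paired pq
      -- Both sides count the pairs of a group of `Z` and a vertex of `Q` joined by exactly one
      -- edge.
      transposed : ∑ (gain (singles Q)) Z ≡ ∑ (gain Ys) L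
      transposed = begin
        ∑ (gain (singles Q)) Z                                   ≡⟨ ∑-cong (λ g → ∑-map (λ Y → once (E (verts g) Y)) [_] Q) Z ⟩
        ∑ (λ g → ∑ (λ x → once (E (verts g) [ x ])) Q) Z         ≡⟨ ∑-swap (λ g x → once (E (verts g) [ x ])) Z Q ⟩
        ∑ (λ x → ∑ (λ g → once (E (verts g) [ x ])) Z) Q         ≡⟨ ∑-cong (λ x → ∑-cong (λ g → cong once (E-sym (verts g) [ x ])) Z) Q ⟩
        ∑ (λ x → ∑ (λ g → once (E [ x ] (verts g))) Z) Q         ≡⟨ ∑-cong (λ x → ∑-map (λ Y → once (E [ x ] Y)) verts Z) Q ⟨
        ∑ (λ x → gain Ys (single x)) Q                           ≡⟨ ∑-map (gain Ys) single Q ⟨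
        ∑ (gain Ys) L                                            ∎
        where open ≡-Reasoning
      lenL : length L ≤ n
      lenL = ≤-trans (≤-reflexive (length-map single Q)) lenQ
      Γ = n * (2 * θ) + (ρ + ρ) * suc m * Δ
      bound : E W₀ Q ≤ ∑ (gain Ys) (crosses PQ.pairs) + (c + Γ)
      bound = begin
        E W₀ Q                               ≤⟨ h ⟩
        ∑ (gain (singles Q)) Z + c           ≡⟨ cong (_+ c) transposed ⟩
        ∑ (gain Ys) L + c                    ≤⟨ +-monoˡ-≤ c PQ.gains ⟩
        G + length PQ.pairs * (2 * θ) + length PQ.rest * Δ + c
          ≤⟨ +-monoˡ-≤ c (+-mono-≤ (+-monoʳ-≤ G (*-monoˡ-≤ (2 * θ) (≤-trans PQ.length-pairs lenL))) (*-monoˡ-≤ Δ PQ.few)) ⟩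
        G + n * (2 * θ) + (ρ + ρ) * suc m * Δ + c   ≡⟨ shuffle G (n * (2 * θ)) ((ρ + ρ) * suc m * Δ) c ⟩
        G + (c + Γ)                          ∎
        where
        open ≤-Reasoning
        G = ∑ (gain Ys) (crosses PQ.pairs)
        shuffle : ∀ a b c d → a + b + c + d ≡ a + (d + (b + c))
        shuffle = solve-∀
      lenC : length (crosses PQ.pairs) ≤ n
      lenC = ≤-trans (≤-reflexive (length-map (uncurry cross) PQ.pairs)) (≤-trans PQ.length-pairs lenL)
      flatC : flat (crosses PQ.pairs) ++ flat PQ.rest ↭ Q
      flatC = ↭-trans PQ.flat-perm (P.↭-reflexive (flat-single Q))
      shapes : All (Shape 1) L
      shapes = Allₚ.map⁺ (All.universal (λ _ → refl) Q)
      sizes : All (λ g → length (verts g) ≤ 1) L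
      sizes = Allₚ.map⁺ (All.universal (λ _ → ≤-refl) Q)
      go : ∀ {Cs} → crosses PQ.pairs ≡ Cs → ∃ λ M → (E W₀ Q ≤ n * M + (c + Γ)) × (M ≡ 0 ⊎ Cut M Z W (Δ / ρ))
      -- If nothing was paired then `M` = 0; `dense-split` excludes this by its hypothesis `large`.
      go {[]} eq = 0 , subst (λ x → E W₀ Q ≤ x + (c + Γ)) (trans (cong (∑ (gain Ys)) eq) (sym (*-zeroʳ n))) bound , inj₁ refl
      go {g ∷ gs} eq with ∑-max (gain Ys) g gs
      ... | q , qs , t , b = gain Ys q ,
        ≤-trans bound (+-monoˡ-≤ (c + Γ) (≤-trans (≤-reflexive (cong (∑ (gain Ys)) eq))
          (≤-trans b (*-monoˡ-≤ (gain Ys q) (subst (λ x → length x ≤ n) eq lenC))))) ,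
        inj₂ record
        { q = q ; unused = flat qs ++ flat PQ.rest
        ; perm = ↭-trans (P.↭-reflexive (sym (++-assoc (verts q) (flat qs) (flat PQ.rest))))
            (↭-trans (Pₚ.++⁺ʳ (flat PQ.rest) (concatMap-↭ verts (↭-sym t′))) flatC)
        ; length-q = pick (All-crosses length-cross≤ pq sizes)
        ; balanced = shape⇒balanced {g = q} (pick (All-crosses shape-cross pq shapes))
        ; near = pick PQ.near
        ; gains = ≤-refl }
        where
        t′ : crosses PQ.pairs ↭ q ∷ qs
        t′ = subst (_↭ q ∷ qs) (sym eq) t
        pick : ∀ {P : Pred (Group V) 0ℓ} → All P (crosses PQ.pairs) → P q
        pick ps = All.head (Pₚ.All-resp-↭ t′ ps)

    -- The groups of `Z` with exactly one edge to `q` are the units. Adding the at most two vertices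
    -- of `q` to the kept set changes the other differences by at most `(S + S) * 2`, and that of
    -- `q` itself by at most 2 * 2 = 4.
    split-by-cut : ∀ {M d T T′ D} Z O → (flat Z ++ flat O) ++ D ↭ W₀ → length D ≤ d →
      All (Near (flat Z ++ flat O) 0) Z → All (Near (flat Z ++ flat O) T) O → All Balanced Z → All Balanced O →
      All (λ g → length (verts g) ≤ S + S) Z → All (λ g → length (verts g) ≤ S) O →
      Cut M Z (flat Z ++ flat O) T′ → (S + S) * 2 + T ≤ suc M → 4 + T′ ≤ suc M →
      SplitUpTo (d + length Q) (W₀ ++ Q)
    split-by-cut {M} {d} {T} {T′} {D} Z O p lenD nearZ nearO balZ balO szZ szO cut T≤ T′≤ =
      W′ , D ++ unused , perm′ , length-rest ,
      finish W′ (suc M) units others permG (Allₚ.filter⁺ unit? balZ) unit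
        (balanced ∷ Allₚ.++⁺ (Allₚ.filter⁺ (¬? ∘ unit?) balZ) balO)
        (weak q T′≤ (near-add W q (verts q) length-q length-q near) ∷
          Allₚ.++⁺ (Allₚ.filter⁺ (¬? ∘ unit?) (All.zipWith (λ {g} (c , s) →
              weak g (≤-trans (+-monoʳ-≤ _ z≤n) T≤) (near-add W g (verts q) s length-q c)) (nearZ , szZ)))
            (All.zipWith (λ {g} (c , s) →
              weak g T≤ (near-add W g (verts q) (≤-trans s (m≤m+n S S)) length-q c)) (nearO , szO)))
        (s≤s enough)
      where
      open Cut cut
      W = flat Z ++ flat O
      W′ = verts q ++ W
      unit? : ∀ g → Dec (E (verts q) (verts g) ≡ 1)
      unit? g = E (verts q) (verts g) ≟ 1
      units = filter unit? Z
      others = q ∷ filter (¬? ∘ unit?) Z ++ O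
      weak : ∀ {T U} g → T ≤ U → Near W′ T g → Near W′ U g
      weak g = close-mono {p = E (proj₁ g) W′} {E (proj₂ g) W′}
      unit : All (Unit W′) units
      unit = All.zipWith (λ {g} (c , one) → unit-add W g (verts q) c one) (Allₚ.filter⁺ unit? nearZ , Allₚ.all-filter unit? Z)
      enough : M ≤ length units
      enough = ≤-trans gains (≤-reflexive (trans (∑-map (λ Y → once (E (verts q) Y)) verts Z) (∑-once (λ g → E (verts q) (verts g)) Z)))
      permG : flat units ++ flat others ↭ W′
      permG = ↭-trans (Pₚ.shifts (flat units) (verts q)) (Pₚ.++⁺ˡ (verts q)
        (↭-trans (P.↭-reflexive (trans (cong (flat units ++_) (concatMap-++ verts (filter (¬? ∘ unit?) Z) O))
            (trans (sym (++-assoc (flat units) _ (flat O))) (cong (_++ flat O) (sym (concatMap-++ verts units _))))))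
          (Pₚ.++⁺ʳ (flat O) (concatMap-↭ verts (filter-split unit? Z)))))
      perm′ : W′ ++ (D ++ unused) ↭ W₀ ++ Q
      perm′ = begin
        (verts q ++ W) ++ (D ++ unused)    ↭⟨ Pₚ.++⁺ʳ (D ++ unused) (Pₚ.++-comm (verts q) W) ⟩
        (W ++ verts q) ++ (D ++ unused)    ↭⟨ ++-interchange W (verts q) D unused ⟩
        (W ++ D) ++ (verts q ++ unused)    ↭⟨ Pₚ.++⁺ p perm ⟩
        W₀ ++ Q                            ∎
        where open P.PermutationReasoning
      length-rest : length (D ++ unused) ≤ d + length Q
      length-rest = begin
        length (D ++ unused)               ≡⟨ length-++ D ⟩
        length D + length unused           ≤⟨ +-mono-≤ lenD (begin
          length unused                       ≤⟨ m≤n+m _ (length (verts q)) ⟩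
          length (verts q) + length unused    ≡⟨ length-++ (verts q) ⟨
          length (verts q ++ unused)          ≡⟨ Pₚ.↭-length perm ⟩
          length Q                            ∎) ⟩
        d + length Q                       ∎
        where open ≤-Reasoning

    -- The `suc f` rounds exhaust the initial tolerance `Δ`, the first being applied to single
    -- vertices. `large` demands that the gain `M` of the best pair covers the remaining tolerances
    -- up to one.
    dense-split : ∀ f ρ .{{_ : NonZero ρ}} → Δ < r ^ suc f → 2 ^ suc f ≤ S →
      let d = suc f * ((r + r) * S)
          T = S * d
          Γ = suc f * loss r + loss (suc T) + (n * (2 * θ) + (ρ + ρ) * suc m * Δ)
      in (∀ M → E W₀ Q ≤ n * M + Γ → (S + S) * 2 + T ≤ suc M × 4 + Δ / ρ ≤ suc M) →
      SplitUpTo (d + length Q) (W₀ ++ Q)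
    dense-split f ρ Δ< S≥ large = case zero-pairs refined of λ where
        (Z , O , D , p , lenD , nearZ , nearO , balZ , balO , szZ , szO , gains) →
          case find-cut Z O ρ p szZ gains of λ where
            (M , b , inj₁ M≡0) → contradiction (subst (λ M → 4 + Δ / ρ ≤ suc M) M≡0 (proj₂ (large M b))) λ { (s≤s ()) }
            (M , b , inj₂ cut) → split-by-cut Z O p lenD nearZ nearO balZ balO szZ szO cut
              (proj₁ (large M b)) (proj₂ (large M b))
      where
      refined : State 0 S 0 (suc f * ((r + r) * S)) (suc f * loss r)
      refined = iterate f (m<n*o⇒m/o<n (subst (Δ <_) (*-comm r (r ^ f)) Δ<)) S≥
        (refine (≤-trans (m^n>0 2 (suc f)) S≥) initial)

-- Nearly regular parts and small cuts

m*o≤n⇒m≤n/o : ∀ m n o .{{_ : NonZero o}} → o * m ≤ n → m ≤ n / o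
m*o≤n⇒m≤n/o m n o h = begin
  m           ≡⟨ m*n/n≡m m o ⟨
  m * o / o   ≤⟨ /-monoˡ-≤ o (≤-trans (≤-reflexive (*-comm m o)) h) ⟩
  n / o       ∎
  where open ≤-Reasoning

module Reduction {V : Set} (a : V → V → ℕ) (a-sym : ∀ u v → a u v ≡ a v u)
  (a-irrefl : ∀ v → a v v ≡ 0) (a≤1 : ∀ u v → a u v ≤ 1) where
  open Refinement a a-sym a-irrefl a≤1 public

  MaxDegree : ℕ → List V → Set
  MaxDegree Δ L = All (λ v → e v L ≤ Δ) L

  E-partˡ : ∀ X Y {W} U → X ++ Y ↭ W → E X U ≤ E W U
  E-partˡ X Y U p = ≤-trans (≤-trans (m≤m+n _ _) (≤-reflexive (sym (E-++ˡ X Y U)))) (≤-reflexive (E-↭ˡ U p))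

  All-part : ∀ {P : Pred V 0ℓ} X {Y W} → X ++ Y ↭ W → All P W → All P X
  All-part X p ps = Allₚ.++⁻ˡ X (Pₚ.All-resp-↭ (↭-sym p) ps)

  -- Markov's inequality: each deleted vertex has degree above τ / ρ in `L`. Deletion only lowers
  -- the degrees of the others.
  remove-high-degree : ∀ ρ τ L → ∃ λ L′ → ∃ λ R →
    (L′ ++ R ↭ L) × All (λ v → ρ * e v L′ ≤ τ) L′ × length R * τ ≤ ρ * E L L
  remove-high-degree ρ τ L = low , high , filter-split low? L ,
    All.map (λ {v} b → ≤-trans (*-monoʳ-≤ ρ (e-part v low (filter-split low? L) ≤-refl)) b) (Allₚ.all-filter low? L) ,
    (begin
      length high * τ            ≤⟨ length*≤∑ (All.map (λ h → <⇒≤ (≰⇒> h)) (Allₚ.all-filter (¬? ∘ low?) L)) ⟩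
      ∑ (λ v → ρ * e v L) high   ≡⟨ *-distribˡ-∑ ρ (λ v → e v L) high ⟩
      ρ * E high L               ≤⟨ *-monoʳ-≤ ρ (E-partˡ high low L (↭-trans (Pₚ.++-comm high low) (filter-split low? L))) ⟩
      ρ * E L L                  ∎)
    where
    open ≤-Reasoning
    low? : ∀ v → Dec (ρ * e v L ≤ τ)
    low? v = ρ * e v L ≤? τ
    low high : List V
    low  = filter low? L
    high = filter (¬? ∘ low?) L

  -- If the degree sum is too small for `Δ`, then fewer than n / r vertices have degree above Δ / r,
  -- and deleting them divides the maximum degree by `r`. At `f` = 0 the bound forces `Δ` = 0 and
  -- the density claim is trivial.
  near-regular : ∀ f r .{{_ : NonZero r}} n Δ L → length L ≤ n → MaxDegree Δ L → Δ < r ^ f →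
    ∃ λ L′ → ∃ λ R → ∃ λ Δ′ →
      (L′ ++ R ↭ L) × r * length R ≤ f * n × MaxDegree Δ′ L′ × Δ′ ≤ Δ × n * Δ′ ≤ r * r * E L′ L′
  near-regular zero    r n zero    L l d _ = L , [] , 0 , P.↭-reflexive (++-identityʳ L) , ≤-reflexive (*-zeroʳ r) , d , z≤n ,
    ≤-trans (≤-reflexive (*-zeroʳ n)) z≤n
  near-regular zero    r n (suc Δ) L l d (s≤s ())
  near-regular (suc f) r n Δ L l d Δ< with n * Δ ≤? r * r * E L L
  ... | yes dense = L , [] , Δ , P.↭-reflexive (++-identityʳ L) , ≤-trans (≤-reflexive (*-zeroʳ r)) z≤n , d , ≤-refl , dense
  ... | no sparse with remove-high-degree r Δ L
  ...   | L₁ , R₁ , p , d₁ , b with near-regular f r n (Δ / r) L₁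
            (≤-trans (≤-trans (m≤m+n _ _) (≤-reflexive (trans (sym (length-++ L₁)) (Pₚ.↭-length p)))) l)
            (All.map (λ {v} → m*o≤n⇒m≤n/o (e v L₁) Δ r) d₁)
            (m<n*o⇒m/o<n (subst (Δ <_) (*-comm r (r ^ f)) Δ<))
  ...     | L₂ , R₂ , Δ₂ , q , l₂ , d₂ , Δ₂≤ , dense =
              L₂ , R₂ ++ R₁ , Δ₂ , ↭-trans (P.↭-reflexive (sym (++-assoc L₂ R₂ R₁))) (↭-trans (Pₚ.++⁺ʳ R₁ q) p) ,
              (begin
                r * length (R₂ ++ R₁)            ≡⟨ cong (r *_) (length-++ R₂) ⟩
                r * (length R₂ + length R₁)      ≡⟨ *-distribˡ-+ r (length R₂) (length R₁) ⟩
                r * length R₂ + r * length R₁    ≤⟨ +-mono-≤ l₂ (<⇒≤ few) ⟩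
                f * n + n                        ≡⟨ +-comm (f * n) n ⟩
                n + f * n                        ∎) ,
              d₂ , ≤-trans Δ₂≤ (m/n≤m Δ r) , dense
    where
    open ≤-Reasoning
    few : r * length R₁ < n
    few = *-cancelʳ-< Δ (r * length R₁) n (begin-strict
      r * length R₁ * Δ      ≡⟨ *-assoc r (length R₁) Δ ⟩
      r * (length R₁ * Δ)    ≤⟨ *-monoʳ-≤ r b ⟩
      r * (r * E L L)        ≡⟨ *-assoc r r (E L L) ⟨
      r * r * E L L          <⟨ ≰⇒> sparse ⟩
      n * Δ                  ∎)

  -- Place the vertices of Z one by one on the side where they have more neighbours opposite.
  max-cut : ∀ U Z → ∃ λ Q → ∃ λ Z′ → (Q ++ Z′ ↭ Z) × 2 * E Z U + E Z Z ≤ 4 * E Q (U ++ Z′)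
  max-cut U []      = [] , [] , ↭-refl , z≤n
  max-cut U (z ∷ Z) with max-cut U Z
  ... | Q , Z′ , p , b = choose (≤-total (e z Q) (e z (U ++ Z′)))
    where
    open ≤-Reasoning
    shuffle₁ : ∀ eU EU eZ EZ → 2 * (eU + EU) + (eZ + (eZ + EZ)) ≡ 2 * (eU + eZ) + (2 * EU + EZ)
    shuffle₁ = solve-∀
    shuffle₂ : ∀ x y → 2 * (x + x) + 4 * y ≡ 4 * (x + y)
    shuffle₂ = solve-∀
    expand : 2 * E (z ∷ Z) U + E (z ∷ Z) (z ∷ Z) ≡ 2 * (e z U + e z Z) + (2 * E Z U + E Z Z)
    expand = trans (cong (2 * (e z U + E Z U) +_) (cong₂ _+_ (cong (_+ e z Z) (a-irrefl z))
      (trans (E-++ʳ Z [ z ] Z) (cong (_+ E Z Z) (sym (e≡E z Z))))))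
      (shuffle₁ (e z U) (E Z U) (e z Z) (E Z Z))
    sides : e z U + e z Z ≡ e z (U ++ Z′) + e z Q
    sides = begin-equality
      e z U + e z Z                  ≡⟨ cong (e z U +_) (e-↭ z p) ⟨
      e z U + e z (Q ++ Z′)          ≡⟨ cong (e z U +_) (∑-++ (a z) Q Z′) ⟩
      e z U + (e z Q + e z Z′)       ≡⟨ shuffle (e z U) (e z Q) (e z Z′) ⟩
      e z U + e z Z′ + e z Q         ≡⟨ cong (_+ e z Q) (∑-++ (a z) U Z′) ⟨
      e z (U ++ Z′) + e z Q          ∎
      where
      shuffle : ∀ a b c → a + (b + c) ≡ a + c + b
      shuffle = solve-∀
    -- Here `x` is the number of edges that the placement of `z` adds to the cut; being the larger
    -- of the two options, it is at least half of the degree of `z` into `U` and `Z`.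
    improve : ∀ x → e z (U ++ Z′) ≤ x → e z Q ≤ x → 2 * E (z ∷ Z) U + E (z ∷ Z) (z ∷ Z) ≤ 4 * (x + E Q (U ++ Z′))
    improve x h h′ = begin
      2 * E (z ∷ Z) U + E (z ∷ Z) (z ∷ Z)               ≡⟨ expand ⟩
      2 * (e z U + e z Z) + (2 * E Z U + E Z Z)         ≤⟨ +-mono-≤ (*-monoʳ-≤ 2 (≤-trans (≤-reflexive sides) (+-mono-≤ h h′))) b ⟩
      2 * (x + x) + 4 * E Q (U ++ Z′)                   ≡⟨ shuffle₂ x (E Q (U ++ Z′)) ⟩
      4 * (x + E Q (U ++ Z′))                           ∎
    choose : e z Q ≤ e z (U ++ Z′) ⊎ e z (U ++ Z′) ≤ e z Q →
      ∃ λ Q → ∃ λ Z′ → (Q ++ Z′ ↭ z ∷ Z) × 2 * E (z ∷ Z) U + E (z ∷ Z) (z ∷ Z) ≤ 4 * E Q (U ++ Z′)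
    choose (inj₁ h) = z ∷ Q , Z′ , prep z p , improve (e z (U ++ Z′)) ≤-refl h
    choose (inj₂ h) = Q , z ∷ Z′ , ↭-trans (Pₚ.shift z Q Z′) (prep z p) ,
      ≤-trans (improve (e z Q) h ≤-refl) (≤-reflexive (cong (4 *_) (begin-equality
        e z Q + E Q (U ++ Z′)            ≡⟨ cong (_+ E Q (U ++ Z′)) (e≡E z Q) ⟩
        E Q [ z ] + E Q (U ++ Z′)        ≡⟨ E-++ʳ Q [ z ] (U ++ Z′) ⟨
        E Q (z ∷ U ++ Z′)                ≡⟨ E-↭ʳ Q (Pₚ.shift z U Z′) ⟨
        E Q (U ++ z ∷ Z′)                ∎)))

  -- A block `Z` of about n / r vertices carries a share 1 / r of the degree sum, and `max-cut` puts
  -- at least a quarter of `E Z L` between some `Q` inside `Z` and all other vertices.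
  small-cut : ∀ r .{{_ : NonZero r}} n L → length L ≤ n →
    ∃ λ Q → ∃ λ W → (W ++ Q ↭ L) × length Q ≤ suc (n / r) × E L L ≤ r * (4 * E W Q)
  small-cut r n L l with ∑-chunk (λ v → e v L) (suc (n / r)) r L
    (≤-trans l (<⇒≤ (subst (n <_) (*-comm r (suc (n / r))) (n<m*suc[n/m] n r))))
  ... | Z , U , p , lenZ , b with max-cut U Z
  ...   | Q , Z′ , q , c = Q , U ++ Z′ ,
          (begin
            (U ++ Z′) ++ Q    ≡⟨ ++-assoc U Z′ Q ⟩
            U ++ (Z′ ++ Q)    ↭⟨ Pₚ.++⁺ˡ U (↭-trans (Pₚ.++-comm Z′ Q) q) ⟩
            U ++ Z            ↭⟨ Pₚ.++-comm U Z ⟩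
            Z ++ U            ↭⟨ p ⟩
            L                 ∎) ,
          ≤-trans (≤-trans (m≤m+n _ _) (≤-reflexive (trans (sym (length-++ Q)) (Pₚ.↭-length q)))) lenZ ,
          ≤-trans b (*-monoʳ-≤ r cut≥)
    where
    open P.PermutationReasoning
    cut≥ : E Z L ≤ 4 * E (U ++ Z′) Q
    cut≥ = ≤-trans (≤-reflexive (trans (E-↭ʳ Z (↭-sym p)) (trans (E-++ʳ Z Z U) (+-comm (E Z Z) (E Z U)))))
      (≤-trans (+-monoˡ-≤ (E Z Z) (m≤m+n (E Z U) _)) (≤-trans c (≤-reflexive (cong (4 *_) (E-sym Q (U ++ Z′))))))

-- Graphs of small maximum degree

module Gadgets {V : Set} (a : V → V → ℕ) (a-sym : ∀ u v → a u v ≡ a v u)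
  (a-irrefl : ∀ v → a v v ≡ 0) (a≤1 : ∀ u v → a u v ≤ 1) where
  open Reduction a a-sym a-irrefl a≤1 public

  pick-positive : ∀ {A : Set} (f : A → ℕ) xs → 0 < ∑ f xs → ∃ λ y → ∃ λ ys → (xs ↭ y ∷ ys) × 0 < f y
  pick-positive f (x ∷ xs) h with ∑-max f x xs
  ... | y , ys , p , b = y , ys , p , n≢0⇒n>0 λ z →
    <⇒≱ h (≤-trans b (≤-reflexive (trans (cong (length (x ∷ xs) *_) z) (*-zeroʳ (length (x ∷ xs))))))

  pick-edge : ∀ H → 0 < E H H → ∃ λ u → ∃ λ v → ∃ λ D → (H ↭ u ∷ v ∷ D) × a u v ≡ 1
  pick-edge H h with pick-positive (λ x → e x H) H h
  ... | u , ys , p , h′ with pick-positive (a u) ys (subst (0 <_) (trans (e-↭ u p) (cong (_+ e u ys) (a-irrefl u))) h′)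
  ...   | v , zs , q , h″ = u , v , zs , ↭-trans p (prep u q) , ≤-antisym (a≤1 u v) h″

  remove-neighbours : ∀ u H → ∃ λ D → ∃ λ R → (D ++ R ↭ H) × All (λ x → a u x ≡ 0) D × length R ≤ e u H
  remove-neighbours u H = filter far? H , filter (¬? ∘ far?) H , filter-split far? H , Allₚ.all-filter far? H ,
    ≤-trans (≤-reflexive (sym (*-identityʳ _)))
      (≤-trans (length*≤∑ (All.map n≢0⇒n>0 (Allₚ.all-filter (¬? ∘ far?) H))) (∑-filter-≤ (¬? ∘ far?) (a u) H))
    where
    far? : ∀ x → Dec (a u x ≡ 0)
    far? x = a u x ≟ 0

  e-far : ∀ {u H} → All (λ x → a u x ≡ 0) H → e u H ≡ 0
  e-far []       = refl
  e-far (p ∷ ps) = cong₂ _+_ p (e-far ps)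

  E-remove : ∀ {Δ} D X {H} → D ++ X ↭ H → MaxDegree Δ H → E H H ≤ E D D + 2 * (length X * Δ)
  E-remove {Δ} D X {H} p d = begin
    E H H                                 ≡⟨ E-↭ˡ H p ⟨
    E (D ++ X) H                          ≡⟨ E-++ˡ D X H ⟩
    E D H + E X H                         ≡⟨ cong (_+ E X H) (trans (E-↭ʳ D (↭-sym p)) (E-++ʳ D D X)) ⟩
    E D D + E D X + E X H                 ≤⟨ +-mono-≤ (+-monoʳ-≤ (E D D) (≤-trans (E-partˡ D X X p) (≤-trans (≤-reflexive (E-sym H X)) few))) few ⟩
    E D D + length X * Δ + length X * Δ   ≡⟨ shuffle (E D D) (length X * Δ) ⟩
    E D D + 2 * (length X * Δ)            ∎
    where
    open ≤-Reasoning
    few : E X H ≤ length X * Δ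
    few = E≤length* X H (All-part X (↭-trans (Pₚ.++-comm X D) p) d)
    shuffle : ∀ x y → x + y + y ≡ x + 2 * y
    shuffle = solve-∀

  pair-up : ∀ (H : List V) → ∃ λ os → ∃ λ R → (concatMap unpair os ++ R ↭ H) × length R ≤ 1
  pair-up []          = [] , [] , ↭-refl , z≤n
  pair-up (x ∷ [])    = [] , [ x ] , ↭-refl , ≤-refl
  pair-up (x ∷ y ∷ H) with pair-up H
  ... | os , R , p , l = (x , y) ∷ os , R , prep x (prep y p) , l

  pair-group : V × V → Group V
  pair-group (x , y) = [ x ] , [ y ]

  flat-pair-groups : ∀ ps → flat (map pair-group ps) ≡ concatMap unpair ps
  flat-pair-groups []             = refl
  flat-pair-groups ((x , y) ∷ ps) = cong (λ zs → x ∷ y ∷ zs) (flat-pair-groups ps)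

  Isolating : List V → V × V → Set
  Isolating W (x , y) = e x W ≡ 1 × e y W ≡ 0

  -- The pairs (u, w) and (v, z) become units: `u` and `v` see only each other, `w` and `z` see
  -- nothing. The `removed` vertices stem from the neighbourhoods of these four, whence `4 * Δ`.
  record Gadget (Δ : ℕ) (H : List V) : Set where
    field
      u v w z : V
      core removed : List V
      perm  : (core ++ (u ∷ w ∷ v ∷ z ∷ [])) ++ removed ↭ H
      few   : length removed ≤ 4 * Δ
      edge  : a u v ≡ 1
      uw    : a u w ≡ 0
      uz    : a u z ≡ 0
      vw    : a v w ≡ 0
      vz    : a v z ≡ 0
      wz    : a w z ≡ 0
      far-u : All (λ x → a u x ≡ 0) core
      far-v : All (λ x → a v x ≡ 0) core
      far-w : All (λ x → a w x ≡ 0) core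
      far-z : All (λ x → a z x ≡ 0) core

  part-length : ∀ {A : Set} (X : List A) {Y W} → X ++ Y ↭ W → length W ≡ length X + length Y
  part-length X p = trans (sym (Pₚ.↭-length p)) (length-++ X)

  detach : ∀ u H {k Δ} → e u H ≤ Δ → k + Δ ≤ length H →
    ∃ λ D → ∃ λ R → (D ++ R ↭ H) × All (λ x → a u x ≡ 0) D × length R ≤ Δ × k ≤ length D
  detach u H {k} {Δ} b l with remove-neighbours u H
  ... | D , R , p , f , lR = D , R , p , f , ≤-trans lR b ,
          +-cancelʳ-≤ Δ k (length D) (≤-trans l (≤-trans (≤-reflexive (part-length D p)) (+-monoʳ-≤ (length D) (≤-trans lR b))))

  max-degree-part : ∀ X {Y W Δ} → X ++ Y ↭ W → MaxDegree Δ W → MaxDegree Δ X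
  max-degree-part X p d = All.map (λ {x} → e-part x X p) (All-part X p d)

  isolate-edge : ∀ H {k Δ} → MaxDegree Δ H → 0 < E H H → 2 + (k + Δ + Δ) ≤ length H →
    ∃ λ u → ∃ λ v → ∃ λ D → ∃ λ R → (D ++ (u ∷ v ∷ R) ↭ H) × a u v ≡ 1 ×
      All (λ x → a u x ≡ 0) D × All (λ x → a v x ≡ 0) D × length R ≤ Δ + Δ × k ≤ length D
  isolate-edge H {k} {Δ} d h l with pick-edge H h
  ... | u , v , C₁ , p , uv with Pₚ.All-resp-↭ p d
  ...   | du ∷ dv ∷ _ with detach u C₁ {k + Δ} (≤-trans (sub u) du) (≤-pred (≤-pred (≤-trans l (≤-reflexive (Pₚ.↭-length p)))))
    where
    sub : ∀ x → e x C₁ ≤ e x H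
    sub x = ≤-trans (≤-trans (m≤n+m _ (a x v)) (m≤n+m _ (a x u))) (≤-reflexive (sym (e-↭ x p)))
  ...     | C₂ , R₂ , p₂ , f₂ , r₂ , l₂ with detach v C₂ {k} (≤-trans (e-part v C₂ p₂ (sub v)) dv) l₂
    where
    sub : ∀ x → e x C₁ ≤ e x H
    sub x = ≤-trans (≤-trans (m≤n+m _ (a x v)) (m≤n+m _ (a x u))) (≤-reflexive (sym (e-↭ x p)))
  ...       | C₃ , R₃ , p₃ , f₃ , r₃ , l₃ = u , v , C₃ , R₃ ++ R₂ ,
                ↭-trans (Pₚ.shifts C₃ (u ∷ v ∷ [])) (↭-trans (prep u (prep v (↭-trans
                  (P.↭-reflexive (sym (++-assoc C₃ R₃ R₂))) (↭-trans (Pₚ.++⁺ʳ R₂ p₃) p₂)))) (↭-sym p)) ,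
                uv , All-part C₃ p₃ f₂ , f₃ , ≤-trans (≤-reflexive (length-++ R₃)) (+-mono-≤ r₃ r₂) , l₃

  isolate-vertex : ∀ H {k Δ} → MaxDegree Δ H → 1 + (k + Δ) ≤ length H →
    ∃ λ w → ∃ λ D → ∃ λ R → (D ++ (w ∷ R) ↭ H) × All (λ x → a w x ≡ 0) D × length R ≤ Δ × k ≤ length D
  isolate-vertex (w ∷ H) {k} {Δ} (dw ∷ _) (s≤s l) with detach w H {k} (≤-trans (m≤n+m _ (a w w)) dw) l
  ... | D , R , p , f , r , l′ = w , D , R , ↭-trans (Pₚ.shift w D R) (prep w p) , f , r , l′

  find-gadget : ∀ {Δ} H → MaxDegree Δ H → 0 < E H H → 4 + 4 * Δ ≤ length H → Gadget Δ H
  -- `2 + 2 * Δ` vertices must survive: `w`, `z` and room for their neighbourhoods.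
  find-gadget {Δ} H d h l with isolate-edge H {2 + 2 * Δ} d h (≤-trans (≤-reflexive (shuffle Δ)) l)
    where
    shuffle : ∀ x → 2 + (2 + 2 * x + x + x) ≡ 4 + 4 * x
    shuffle = solve-∀
  ... | u , v , D , R , p , uv , fu , fv , r , l₁ with isolate-vertex D {1 + Δ} (max-degree-part D p d) (≤-trans (≤-reflexive (shuffle Δ)) l₁)
    where
    shuffle : ∀ x → 1 + (1 + x + x) ≡ 2 + 2 * x
    shuffle = solve-∀
  ...   | w , D₁ , R₁ , p₁ , fw , r₁ , l₂ with isolate-vertex D₁ {0} (max-degree-part D₁ p₁ (max-degree-part D p d)) l₂
  ...     | z , D₂ , R₂ , p₂ , fz , r₂ , _ = record
    { u = u ; v = v ; w = w ; z = z ; core = D₂ ; removed = R ++ (R₁ ++ R₂)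
    ; perm = ↭-trans (arrange [ u ] [ v ] [ w ] [ z ]) (↭-trans (Pₚ.++⁺ʳ (u ∷ v ∷ R) (↭-trans (Pₚ.++⁺ʳ (w ∷ R₁) p₂) p₁)) p)
    ; few = subst (_≤ 4 * Δ) (sym (trans (length-++ R) (cong (length R +_) (length-++ R₁))))
        (≤-trans (+-mono-≤ r (+-mono-≤ r₁ r₂)) (≤-reflexive (shuffle Δ)))
    ; edge = uv
    ; uw = head₁ fu ; vw = head₁ fv
    ; uz = head₂ (All-part D₁ p₁ fu) ; vz = head₂ (All-part D₁ p₁ fv) ; wz = head₂ fw
    ; far-u = All-part D₂ p₂ (All-part D₁ p₁ fu)
    ; far-v = All-part D₂ p₂ (All-part D₁ p₁ fv)
    ; far-w = All-part D₂ p₂ fw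
    ; far-z = fz }
    where
    shuffle : ∀ x → x + x + (x + x) ≡ 4 * x
    shuffle = solve-∀
    head₁ : ∀ {P : Pred V 0ℓ} → All P D → P w
    head₁ ps = All.head (Allₚ.++⁻ʳ D₁ (Pₚ.All-resp-↭ (↭-sym p₁) ps))
    head₂ : ∀ {P : Pred V 0ℓ} → All P D₁ → P z
    head₂ ps = All.head (Allₚ.++⁻ʳ D₂ (Pₚ.All-resp-↭ (↭-sym p₂) ps))
    arrange : ∀ U V′ W Z → (D₂ ++ (U ++ (W ++ (V′ ++ Z)))) ++ (R ++ (R₁ ++ R₂)) ↭ ((D₂ ++ (Z ++ R₂)) ++ (W ++ R₁)) ++ (U ++ (V′ ++ R))
    arrange U V′ W Z = solve 8
      (λ u v w z d r r₁ r₂ → ((d ⊕ (u ⊕ (w ⊕ (v ⊕ z)))) ⊕ (r ⊕ (r₁ ⊕ r₂))) ⊜ (((d ⊕ (z ⊕ r₂)) ⊕ (w ⊕ r₁)) ⊕ (u ⊕ (v ⊕ r))))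
      ↭-refl U V′ W Z D₂ R R₁ R₂
      where open import Algebra.Solver.CommutativeMonoid (Pₚ.++-commutativeMonoid {A = V})

  module _ {Δ : ℕ} {H : List V} (g : Gadget Δ H) where
    open Gadget g

    core-perm : core ++ ((u ∷ w ∷ v ∷ z ∷ []) ++ removed) ↭ H
    core-perm = ↭-trans (P.↭-reflexive (sym (++-assoc core _ removed))) perm

    max-degree-core : MaxDegree Δ H → MaxDegree Δ core
    max-degree-core = max-degree-part core core-perm

    -- A gadget takes at most `4 + 4 * Δ` vertices, which costs at most `8 * suc Δ * Δ` in the
    -- degree sum; the additional `suc` guarantees an edge in every round.
    E-core : ∀ m → MaxDegree Δ H → suc m * suc (8 * suc Δ * Δ) ≤ E H H → m * suc (8 * suc Δ * Δ) ≤ E core core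
    E-core m d h = +-cancelʳ-≤ (2 * ((4 + 4 * Δ) * Δ)) _ _ (begin
      m * c + 2 * ((4 + 4 * Δ) * Δ)          ≤⟨ n≤1+n _ ⟩
      suc (m * c + 2 * ((4 + 4 * Δ) * Δ))    ≡⟨ cong suc (trans (+-comm (m * c) _) (cong (_+ m * c) (shuffle Δ))) ⟩
      suc m * c                              ≤⟨ h ⟩
      E H H                                  ≤⟨ E-remove core (u ∷ w ∷ v ∷ z ∷ removed) core-perm d ⟩
      E core core + 2 * ((4 + length removed) * Δ)   ≤⟨ +-monoʳ-≤ (E core core) (*-monoʳ-≤ 2 (*-monoˡ-≤ Δ (+-monoʳ-≤ 4 few))) ⟩
      E core core + 2 * ((4 + 4 * Δ) * Δ)    ∎)
      where
      c = suc (8 * suc Δ * Δ)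
      open ≤-Reasoning
      shuffle : ∀ x → 2 * ((4 + 4 * x) * x) ≡ 8 * suc x * x
      shuffle = solve-∀

    flip : ∀ {x y k} → a x y ≡ k → a y x ≡ k
    flip {x} {y} q = trans (a-sym y x) q
    Far : V → Set
    Far x = a x u ≡ 0 × a x w ≡ 0 × a x v ≡ 0 × a x z ≡ 0
    far : All Far core
    far = All.zipWith (λ ((p , q) , (r , s)) → flip p , flip q , flip r , flip s)
      (All.zipWith id (far-u , far-w) , All.zipWith id (far-v , far-z))
    e-corner : ∀ {x} W → Far x → e x (u ∷ w ∷ v ∷ z ∷ W) ≡ e x W
    e-corner {x} W (xu , xw , xv , xz) = cong₂ _+_ xu (cong₂ _+_ xw (cong₂ _+_ xv (cong (_+ e x W) xz)))
    extend : ∀ W us → All (Isolating W) us → All (λ (x , y) → Far x × Far y) us →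
      All (Isolating (u ∷ w ∷ v ∷ z ∷ W)) us
    extend W []             []             []               = []
    extend W ((x , y) ∷ us) ((i , j) ∷ is) ((fx , fy) ∷ fs) =
      (trans (e-corner W fx) i , trans (e-corner W fy) j) ∷ extend W us is fs
    isolating : ∀ us os {R} → (concatMap unpair us ++ concatMap unpair os) ++ R ↭ core →
      All (Isolating (concatMap unpair us ++ concatMap unpair os)) us →
      All (Isolating (u ∷ w ∷ v ∷ z ∷ (concatMap unpair us ++ concatMap unpair os))) ((u , w) ∷ (v , z) ∷ us)
    isolating us os p iso =
      -- The only edge among the four is uv and none leads to the core, so `u` and `v` have degree
      -- 1, `w` and `z` degree 0.
      ( cong₂ _+_ (a-irrefl u) (cong₂ _+_ uw (cong₂ _+_ edge (cong₂ _+_ uz (small far-u))))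
      , trans (e-corner W (flip uw , a-irrefl w , flip vw , wz)) (small far-w) ) ∷
      ( cong₂ _+_ (flip edge) (cong₂ _+_ vw (cong₂ _+_ (a-irrefl v) (cong₂ _+_ vz (small far-v))))
      , trans (e-corner W (flip uz , flip wz , flip vz , a-irrefl z)) (small far-z) ) ∷
      extend W us iso (unpair-All us (Allₚ.++⁻ˡ (concatMap unpair us) (All-part W p far)))
      where
      W = concatMap unpair us ++ concatMap unpair os
      small : ∀ {x} → All (λ y → a x y ≡ 0) core → e x W ≡ 0
      small f = e-far (All-part W p f)
    arrange : ∀ R W → (u ∷ w ∷ v ∷ z ∷ W) ++ (R ++ removed) ↭ ((W ++ R) ++ (u ∷ w ∷ v ∷ z ∷ [])) ++ removed
    arrange R W = ↭-trans (P.↭-reflexive (cong (λ Y → u ∷ w ∷ v ∷ z ∷ Y) (sym (++-assoc W R removed))))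
      (Pₚ.++⁺ʳ removed (Pₚ.++-comm (u ∷ w ∷ v ∷ z ∷ []) (W ++ R)))

  IsolatedPairs : ℕ → ℕ → List V → Set
  IsolatedPairs m Δ H = ∃ λ us → ∃ λ os → ∃ λ R → ((concatMap unpair us ++ concatMap unpair os) ++ R ↭ H) ×
      m ≤ length us × length R ≤ suc (m * (4 * Δ)) × All (Isolating (concatMap unpair us ++ concatMap unpair os)) us

  -- Deleting the neighbourhoods of u, v, w, z leaves the edge uv and the vertices w, z isolated.
  isolated-pairs : ∀ m {Δ} H → MaxDegree Δ H → m * suc (8 * suc Δ * Δ) ≤ E H H → IsolatedPairs m Δ H
  isolated-pairs zero    H d h with pair-up H
  ... | os , R , p , l = [] , os , R , p , z≤n , l , []
  isolated-pairs (suc m) {Δ} H d h = case find-gadget H d (≤-trans (s≤s z≤n) h) long of λ g →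
    add-gadget g (isolated-pairs m (Gadget.core g) (max-degree-core g d) (E-core g m d h))
    where
    add-gadget : (g : Gadget Δ H) → IsolatedPairs m Δ (Gadget.core g) → IsolatedPairs (suc m) Δ H
    add-gadget g (us , os , R , p , l , lR , iso) =
      (u , w) ∷ (v , z) ∷ us , os , R ++ removed ,
      ↭-trans (arrange g R (concatMap unpair us ++ concatMap unpair os))
        (↭-trans (Pₚ.++⁺ʳ removed (Pₚ.++⁺ʳ (u ∷ w ∷ v ∷ z ∷ []) p)) perm) ,
      -- A gadget contributes two pairs, of which the count claims one.
      ≤-trans (s≤s l) (n≤1+n _) ,
      ≤-trans (≤-reflexive (length-++ R)) (≤-trans (+-mono-≤ lR few) (≤-reflexive (cong suc (+-comm (m * (4 * Δ)) (4 * Δ))))) ,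
      isolating g us os p iso
      where open Gadget g
    c = suc (8 * suc Δ * Δ)
    -- Fewer vertices of degree at most `Δ` could not have a degree sum of `c`.
    long : 4 + 4 * Δ ≤ length H
    long with 4 + 4 * Δ ≤? length H
    ... | yes l = l
    ... | no ¬l = contradiction (begin-strict
        8 * suc Δ * Δ             <⟨ n<1+n _ ⟩
        c                         ≤⟨ m≤m+n c (m * c) ⟩
        suc m * c                 ≤⟨ h ⟩
        E H H                     ≤⟨ E≤length* H H d ⟩
        length H * Δ              ≤⟨ *-monoˡ-≤ Δ (<⇒≤ (≰⇒> ¬l)) ⟩
        (4 + 4 * Δ) * Δ           ≤⟨ *-monoˡ-≤ Δ (m≤m+n (4 + 4 * Δ) (4 + 4 * Δ)) ⟩
        (4 + 4 * Δ + (4 + 4 * Δ)) * Δ ≡⟨ shuffle Δ ⟩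
        8 * suc Δ * Δ             ∎) (<-irrefl refl)
      where
      open ≤-Reasoning
      shuffle : ∀ x → (4 + 4 * x + (4 + 4 * x)) * x ≡ 8 * suc x * x
      shuffle = solve-∀

  -- `Δ` gadgets supply at least `Δ` units, and in the arbitrary pairs `os` both degrees are at most
  -- `Δ`, hence so are their differences. At most `4 * Δ` vertices per gadget and one odd vertex are
  -- lost.
  sparse-split : ∀ Δ H → MaxDegree Δ H → Δ * suc (8 * suc Δ * Δ) ≤ E H H → SplitUpTo (suc (Δ * (4 * Δ))) H
  sparse-split Δ H d h with isolated-pairs Δ H d h
  ... | us , os , R , p , l , lR , iso = W , R , p , lR ,
       finish W Δ (map pair-group us) (map pair-group os)
         (P.↭-reflexive (cong₂ _++_ (flat-pair-groups us) (flat-pair-groups os)))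
         (bal us)
         (Allₚ.map⁺ (All.map (λ {(x , y)} (i , j) → inj₁ (trans (E-singleton x W) (trans i (cong suc (sym (trans (E-singleton y W) j)))))) iso))
         (bal os)
         (Allₚ.map⁺ (All.map (λ {(x , y)} (i , j) → close-bounded (≤-trans (≤-reflexive (E-singleton x W)) i) (≤-trans (≤-reflexive (E-singleton y W)) j))
           (unpair-All os (Allₚ.++⁻ʳ (concatMap unpair us) (max-degree-part W p d)))))
         (≤-trans l (≤-trans (≤-reflexive (sym (length-map pair-group us))) (n≤1+n _)))
    where
    W = concatMap unpair us ++ concatMap unpair os
    bal : ∀ ps → All Balanced (map pair-group ps)
    bal ps = Allₚ.map⁺ (All.universal (λ _ → refl) ps)

-- How large r must be when there are K levels of pairing, so that groups have at most S = 2 ^ K vertices.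
threshold : ℕ → ℕ → ℕ
threshold K S = 32 * (K + 2) + 64 * (S * (4 * S * K + 4 * S * (1 + 2 * (K * (S * S))) + 2)) + 8 * (4 * S + 2 * (K * (S * S))) + 16

16≤threshold : ∀ K S → 16 ≤ threshold K S
16≤threshold K S = m≤n+m 16 _

-- Numerical estimates for large degree

module DenseEstimates (K S r n Δ : ℕ) .{{_ : NonZero r}} .{{_ : NonZero S}} where
  -- The reserved set will receive at least nΔ / (4r³) edges, so a loss of about 2Δ / r⁴ for each of
  -- at most n pairs is smaller by a factor of order r. Then `m` is chosen to satisfy `small`.
  r³ ρ θ σ m T : ℕ
  r³ = r * r * r
  ρ = r * r³
  instance
    r³≢0 : NonZero r³
    r³≢0 = m*n≢0 (r * r) r {{m*n≢0 r r}}
    ρ≢0 : NonZero ρ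
    ρ≢0 = m*n≢0 r r³
  θ = Δ / ρ
  σ = (S + S) * Δ
  m = σ * ρ
  T = S * (K * ((r + r) * S))
  β : ℕ
  β = 4 * S * K + 4 * S * (1 + 2 * (K * (S * S))) + 2

  -- This repeats `loss` of the module `Dense`, so that `Γ` agrees with the total loss in
  -- `dense-split`.
  loss′ : ℕ → ℕ
  loss′ ρ = n * (2 * θ) + (ρ + ρ) * suc m * σ

  Γ : ℕ
  Γ = K * loss′ r + loss′ (suc T) + (n * (2 * θ) + (ρ + ρ) * suc m * Δ)

  small : Δ * ((S + S) * Δ) < suc θ * suc m
  small = begin-strict
    Δ * σ               ≤⟨ *-monoˡ-≤ σ (<⇒≤ (n<m*suc[n/m] Δ ρ)) ⟩
    ρ * suc θ * σ       ≡⟨ shuffle ρ (suc θ) σ ⟩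
    suc θ * m           <⟨ *-monoʳ-< (suc θ) (n<1+n m) ⟩
    suc θ * suc m       ∎
    where
    open ≤-Reasoning
    shuffle : ∀ a b c → a * b * c ≡ b * (c * a)
    shuffle = solve-∀

  module _ (1≤Δ : 1 ≤ Δ) where
    open ≤-Reasoning

    r≤ρ : r ≤ ρ
    r≤ρ = m≤m*n r r³

    suc-m≤ : suc m ≤ 4 * S * (Δ * ρ)
    suc-m≤ = begin
      1 + m                 ≤⟨ +-monoˡ-≤ m (*-mono-≤ (*-mono-≤ (≤-trans (>-nonZero⁻¹ S) (m≤m+n S S)) 1≤Δ) (>-nonZero⁻¹ ρ)) ⟩
      m + m                 ≡⟨ shuffle S Δ ρ ⟩
      4 * S * (Δ * ρ)       ∎
      where
      shuffle : ∀ s d p → (s + s) * d * p + (s + s) * d * p ≡ 4 * s * (d * p)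
      shuffle = solve-∀

    suc-T≤ : suc T ≤ (1 + 2 * (K * (S * S))) * ρ
    suc-T≤ = begin
      1 + T                                 ≤⟨ +-mono-≤ (>-nonZero⁻¹ ρ) (*-monoʳ-≤ S (*-monoʳ-≤ K (*-monoˡ-≤ S (+-mono-≤ r≤ρ r≤ρ)))) ⟩
      ρ + S * (K * ((ρ + ρ) * S))           ≡⟨ shuffle K S ρ ⟩
      (1 + 2 * (K * (S * S))) * ρ           ∎
      where
      shuffle : ∀ k s p → p + s * (k * ((p + p) * s)) ≡ (1 + 2 * (k * (s * s))) * p
      shuffle = solve-∀

    -- The first summand collects the losses of matched pairs in K + 2 pairings, the second those of
    -- unmatched groups. Bounding `r` and `suc T` by multiples of `ρ` makes the latter homogeneous
    -- in `Δ * ρ`.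
    Γ≤ : Γ ≤ (K + 2) * (n * (2 * θ)) + 4 * (S * β) * (Δ * ρ * (Δ * ρ))
    Γ≤ = begin
      Γ
        ≤⟨ +-mono-≤ (+-mono-≤ (*-monoʳ-≤ K (+-monoʳ-≤ N (*-monoˡ-≤ σ (*-mono-≤ (+-mono-≤ r≤ρ r≤ρ) suc-m≤))))
            (+-monoʳ-≤ N (*-monoˡ-≤ σ (*-mono-≤ (+-mono-≤ suc-T≤ suc-T≤) suc-m≤)))) (+-monoʳ-≤ N (*-monoˡ-≤ Δ (*-monoʳ-≤ (ρ + ρ) suc-m≤))) ⟩
      K * (N + (ρ + ρ) * Y * σ) + (N + (c * ρ + c * ρ) * Y * σ) + (N + (ρ + ρ) * Y * Δ)
        ≡⟨ shuffle K S Δ ρ N c ⟩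
      (K + 2) * N + 4 * (S * (4 * S * K + 4 * S * c + 2)) * (Δ * ρ * (Δ * ρ)) ∎
      where
      N = n * (2 * θ)
      Y = 4 * S * (Δ * ρ)
      c = 1 + 2 * (K * (S * S))
      shuffle : ∀ k s d p n c →
        k * (n + (p + p) * (4 * s * (d * p)) * ((s + s) * d)) + (n + (c * p + c * p) * (4 * s * (d * p)) * ((s + s) * d)) + (n + (p + p) * (4 * s * (d * p)) * d)
        ≡ (k + 2) * n + 4 * (s * (4 * s * k + 4 * s * c + 2)) * (d * p * (d * p))
      shuffle = solve-∀

    module _ (Δρ³≤n : Δ * (ρ * ρ * ρ) ≤ n) (large : threshold K S ≤ r) where

      -- The losses are at most half of the guaranteed nΔ / (4r³) edges. Multiplied by 16r³, each
      -- summand of `Γ≤` is at most nΔ: the first because `θ * ρ ≤ Δ`, the second because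
      -- `Δ * (ρ * ρ * ρ) ≤ n`.
      8r³Γ≤nΔ : 8 * r³ * Γ ≤ n * Δ
      8r³Γ≤nΔ = *-cancelˡ-≤ 2 (begin
        2 * (8 * r³ * Γ)
          ≤⟨ *-monoʳ-≤ 2 (*-monoʳ-≤ (8 * r³) Γ≤) ⟩
        2 * (8 * r³ * ((K + 2) * (n * (2 * θ)) + 4 * (S * β) * (Δ * ρ * (Δ * ρ))))
          ≡⟨ shuffle₁ r³ (K + 2) n θ (S * β) (Δ * ρ) ⟩
        32 * (K + 2) * (r³ * θ * n) + 64 * (S * β) * (r³ * (Δ * ρ * (Δ * ρ)))
          ≤⟨ +-mono-≤ (*-monoˡ-≤ (r³ * θ * n) K≤) (*-monoˡ-≤ (r³ * (Δ * ρ * (Δ * ρ))) β≤) ⟩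
        r * (r³ * θ * n) + r * (r³ * (Δ * ρ * (Δ * ρ)))
          ≡⟨ shuffle₂ r r³ θ n Δ ρ ⟩
        n * (θ * ρ) + Δ * (ρ * ρ * ρ) * Δ
          ≤⟨ +-mono-≤ (*-monoʳ-≤ n (m/n*n≤m Δ ρ)) (*-monoˡ-≤ Δ Δρ³≤n) ⟩
        n * Δ + n * Δ
          ≡⟨ cong (n * Δ +_) (+-identityʳ (n * Δ)) ⟨
        2 * (n * Δ) ∎)
        where
        K≤ : 32 * (K + 2) ≤ r
        K≤ = ≤-trans (≤-trans (m≤m+n _ _) (≤-trans (m≤m+n _ _) (m≤m+n _ 16))) large
        β≤ : 64 * (S * β) ≤ r
        β≤ = ≤-trans (≤-trans (m≤n+m _ (32 * (K + 2))) (≤-trans (m≤m+n _ _) (m≤m+n _ 16))) large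
        shuffle₁ : ∀ q k n t b x → 2 * (8 * q * (k * (n * (2 * t)) + 4 * b * (x * x))) ≡ 32 * k * (q * t * n) + 64 * b * (q * (x * x))
        shuffle₁ = solve-∀
        shuffle₂ : ∀ r q t n d p → r * (q * t * n) + r * (q * (d * p * (d * p))) ≡ n * (t * (r * q)) + d * (p * p * (r * q)) * d
        shuffle₂ = solve-∀

      module _ (H : ℕ) (dense : n * Δ ≤ r * r * (r * (4 * H))) (r⁵≤Δ : ρ * r ≤ Δ) where

        instance
          n≢0 : NonZero n
          n≢0 = >-nonZero (≤-trans (*-mono-≤ 1≤Δ (>-nonZero⁻¹ (ρ * ρ * ρ) {{m*n≢0 (ρ * ρ) ρ {{m*n≢0 ρ ρ}}}})) Δρ³≤n)

        module _ (M : ℕ) (h : H ≤ n * M + Γ) where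

          -- Subtracting the losses from the edge bound leaves at least nΔ / (8r³) for `n * M`.
          Δ≤8r³M : Δ ≤ r³ * (8 * M)
          Δ≤8r³M = *-cancelˡ-≤ n (+-cancelʳ-≤ (n * Δ) _ _ (begin
            n * Δ + n * Δ                          ≤⟨ +-mono-≤ dense dense ⟩
            r * r * (r * (4 * H)) + r * r * (r * (4 * H)) ≡⟨ shuffle₁ r H ⟩
            8 * r³ * H                             ≤⟨ *-monoʳ-≤ (8 * r³) h ⟩
            8 * r³ * (n * M + Γ)                   ≡⟨ *-distribˡ-+ (8 * r³) (n * M) Γ ⟩
            8 * r³ * (n * M) + 8 * r³ * Γ          ≤⟨ +-monoʳ-≤ (8 * r³ * (n * M)) 8r³Γ≤nΔ ⟩
            8 * r³ * (n * M) + n * Δ               ≡⟨ cong (_+ n * Δ) (shuffle₂ r³ n M) ⟩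
            n * (r³ * (8 * M)) + n * Δ             ∎))
            where
            shuffle₁ : ∀ r h → r * r * (r * (4 * h)) + r * r * (r * (4 * h)) ≡ 8 * (r * r * r) * h
            shuffle₁ = solve-∀
            shuffle₂ : ∀ q n m → 8 * q * (n * m) ≡ n * (q * (8 * m))
            shuffle₂ = solve-∀

          r²≤8M : r * r ≤ 8 * M
          r²≤8M = *-cancelˡ-≤ r³ (≤-trans (≤-reflexive (shuffle r r³)) (≤-trans r⁵≤Δ Δ≤8r³M))
            where
            shuffle : ∀ r q → q * (r * r) ≡ r * q * r
            shuffle = solve-∀

          -- `T` is linear in `r`, while `M` is at least r² / 8.
          T-small : (S + S) * 2 + T ≤ suc M
          T-small = ≤-trans (*-cancelˡ-≤ 8 (begin
            8 * ((S + S) * 2 + T)                    ≤⟨ *-monoʳ-≤ 8 (+-monoˡ-≤ T (m≤m*n ((S + S) * 2) r)) ⟩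
            8 * ((S + S) * 2 * r + T)                ≡⟨ shuffle S K r ⟩
            8 * (4 * S + 2 * (K * (S * S))) * r      ≤⟨ *-monoˡ-≤ r (≤-trans (≤-trans (m≤n+m _ (32 * (K + 2) + 64 * (S * β))) (m≤m+n _ 16)) large) ⟩
            r * r                                    ≤⟨ r²≤8M ⟩
            8 * M                                    ∎)) (n≤1+n M)
            where
            shuffle : ∀ s k r → 8 * ((s + s) * 2 * r + s * (k * ((r + r) * s))) ≡ 8 * (4 * s + 2 * (k * (s * s))) * r
            shuffle = solve-∀

          16≤r : 16 ≤ r
          16≤r = ≤-trans (16≤threshold K S) large

          -- `M` is at least rθ / 8, hence at least 2θ, and Δ ≥ r⁵ makes `θ` at least 4.
          ratio-small : 4 + Δ / ρ ≤ suc M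
          ratio-small = ≤-trans (≤-trans (+-monoˡ-≤ θ 4≤θ) (*-cancelˡ-≤ 8 (begin
            8 * (θ + θ)      ≡⟨ shuffle₁ θ ⟩
            16 * θ           ≤⟨ *-monoˡ-≤ θ 16≤r ⟩
            r * θ            ≤⟨ *-cancelˡ-≤ r³ (≤-trans (≤-reflexive (shuffle₂ r³ r θ)) (≤-trans (m/n*n≤m Δ ρ) Δ≤8r³M)) ⟩
            8 * M            ∎))) (n≤1+n M)
            where
            shuffle₁ : ∀ t → 8 * (t + t) ≡ 16 * t
            shuffle₁ = solve-∀
            shuffle₂ : ∀ q r t → q * (r * t) ≡ t * (r * q)
            shuffle₂ = solve-∀
            4≤θ : 4 ≤ θ
            4≤θ = m*o≤n⇒m≤n/o 4 Δ ρ (≤-trans (*-monoʳ-≤ ρ (≤-trans (m≤m+n 4 12) 16≤r)) r⁵≤Δ)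

-- Splitting all but a small fraction of a sparse graph

module Assembly {V : Set} (a : V → V → ℕ) (a-sym : ∀ u v → a u v ≡ a v u)
  (a-irrefl : ∀ v → a v v ≡ 0) (a≤1 : ∀ u v → a u v ≤ 1) where
  open Gadgets a a-sym a-irrefl a≤1 public

  AlmostSplit : ℕ → ℕ → List V → Set
  AlmostSplit r b L = ∃ λ kept → ∃ λ rest → (kept ++ rest ↭ L) × r * length rest ≤ b × Split kept

  enlarge : ∀ {r b b′ L L′ R} → L ++ R ↭ L′ → b + r * length R ≤ b′ → AlmostSplit r b L → AlmostSplit r b′ L′
  enlarge {r} {b} {b′} {L} {L′} {R} p l (kept , rest , q , l′ , s) = kept , rest ++ R ,
    ↭-trans (P.↭-reflexive (sym (++-assoc kept rest R))) (↭-trans (Pₚ.++⁺ʳ R q) p) ,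
    (begin
      r * length (rest ++ R)            ≡⟨ cong (r *_) (length-++ rest) ⟩
      r * (length rest + length R)      ≡⟨ *-distribˡ-+ r (length rest) (length R) ⟩
      r * length rest + r * length R    ≤⟨ +-monoˡ-≤ (r * length R) l′ ⟩
      b + r * length R                  ≤⟨ l ⟩
      b′                                ∎) , s
    where open ≤-Reasoning

  almost : ∀ r {b d L} → r * d ≤ b → SplitUpTo d L → AlmostSplit r b L
  almost r h (kept , rest , p , l , s) = kept , rest , p , ≤-trans (*-monoʳ-≤ r l) h , s

  module _ (f r n : ℕ) .{{_ : NonZero r}} where
    private
      K = suc f
      S = 2 ^ K
      instance
        S≢0 : NonZero S
        S≢0 = m^n≢0 2 K
    open DenseEstimates K S r n using (ρ; r³)

    -- Density turns n ≥ r¹³ into a degree sum of at least Δr¹¹, whereas Δ < r⁵ means that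
    -- `sparse-split` needs at most 9Δr¹⁰ and loses O(r¹⁰) vertices.
    split-small-degree : ∀ Δ L → MaxDegree Δ L → n * Δ ≤ r * r * E L L → Δ < ρ 0 * r → threshold K S ≤ r →
      ρ 0 * r * (ρ 0 * r) * (r * r * r) ≤ n → AlmostSplit r n L
    split-small-degree Δ L d dense Δ< large n≥ = almost r rest≤ (sparse-split Δ L d (*-cancelˡ-≤ (r * r) {{m*n≢0 r r}} (begin
        r * r * (Δ * suc (8 * suc Δ * Δ))      ≡⟨ shuffle₁ (r * r) Δ (suc (8 * suc Δ * Δ)) ⟩
        Δ * (r * r * suc (8 * suc Δ * Δ))      ≤⟨ *-monoʳ-≤ Δ (*-monoʳ-≤ (r * r) X≤) ⟩
        Δ * (r * r * (9 * (R * R)))            ≤⟨ *-monoʳ-≤ Δ (*-monoʳ-≤ (r * r) (*-monoˡ-≤ (R * R) 9≤r)) ⟩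
        Δ * (r * r * (r * (R * R)))            ≡⟨ shuffle₂ Δ r R ⟩
        R * R * (r * r * r) * Δ                ≤⟨ *-monoˡ-≤ Δ n≥ ⟩
        n * Δ                                  ≤⟨ dense ⟩
        r * r * E L L                          ∎)))
      where
      open ≤-Reasoning
      R = ρ 0 * r
      16≤r : 16 ≤ r
      16≤r = ≤-trans (16≤threshold K S) large
      9≤r : 9 ≤ r
      9≤r = ≤-trans (m≤m+n 9 7) 16≤r
      1≤R : 1 ≤ R
      1≤R = ≤-trans (s≤s z≤n) Δ<
      RR = *-mono-≤ 1≤R 1≤R
      X≤ : suc (8 * suc Δ * Δ) ≤ 9 * (R * R)
      X≤ = +-mono-≤ RR (≤-trans (*-mono-≤ (*-monoʳ-≤ 8 Δ<) (<⇒≤ Δ<)) (≤-reflexive (*-assoc 8 R R)))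
      shuffle₁ : ∀ a b c → a * (b * c) ≡ b * (a * c)
      shuffle₁ = solve-∀
      shuffle₂ : ∀ d r q → d * (r * r * (r * (q * q))) ≡ q * q * (r * r * r) * d
      shuffle₂ = solve-∀
      rest≤ : r * suc (Δ * (4 * Δ)) ≤ n
      rest≤ = begin
        r * suc (Δ * (4 * Δ))           ≤⟨ *-monoʳ-≤ r (+-mono-≤ RR (≤-trans (*-mono-≤ (<⇒≤ Δ<) (*-monoʳ-≤ 4 (<⇒≤ Δ<))) (≤-reflexive (shuffle₁ R 4 R)))) ⟩
        r * (5 * (R * R))               ≤⟨ *-monoʳ-≤ r (*-monoˡ-≤ (R * R) (≤-trans (m≤m+n 5 11) (≤-trans 16≤r (m≤m*n r r)))) ⟩
        r * (r * r * (R * R))           ≡⟨ shuffle₃ r R ⟩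
        R * R * (r * r * r)             ≤⟨ n≥ ⟩
        n                               ∎
        where
        shuffle₃ : ∀ r q → r * (r * r * (q * q)) ≡ q * q * (r * r * r)
        shuffle₃ = solve-∀

    -- The loss has three parts of at most n / r each: the vertices dropped in the `K` rounds, the
    -- reserved set `Q`, and the rounding in its size.
    split-large-degree : ∀ Δ L → length L ≤ n → MaxDegree Δ L → n * Δ ≤ r * r * E L L → ρ 0 * r ≤ Δ → threshold K S ≤ r →
      Δ < r ^ K → Δ * (ρ 0 * ρ 0 * ρ 0) ≤ n → r * r * r ≤ n → AlmostSplit r (3 * n) L
    split-large-degree Δ L lenL d dense R≤Δ large Δ< Δρ³≤n r³≤n = case small-cut r n L lenL of λ where
        (Q , W , p , lenQ , b) → permute p (almost r (rest≤ lenQ) (go Q W p (≤-trans dense (*-monoʳ-≤ (r * r) b))))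
      where
      open ≤-Reasoning
      module D = DenseEstimates K S r n Δ
      permute : ∀ {L L′ b} → L ↭ L′ → AlmostSplit r b L → AlmostSplit r b L′
      permute p (kept , rest , q , l , s) = kept , rest , ↭-trans q p , l , s
      1≤Δ : 1 ≤ Δ
      1≤Δ = ≤-trans (>-nonZero⁻¹ (D.ρ * r) {{m*n≢0 D.ρ r}}) R≤Δ
      go : ∀ Q W → W ++ Q ↭ L → n * Δ ≤ r * r * (r * (4 * E W Q)) → SplitUpTo (K * ((r + r) * S) + length Q) (W ++ Q)
      go Q W p dense′ = Dense.dense-split W Q Δ n r S D.θ D.m
          (max-degree-part W p d)
          (All.map (λ {v} → e-part v Q p′) (All-part W p d))
          (All.map (λ {v} → e-part v W p) (All-part Q p′ d))
          (≤-trans (≤-trans (m≤m+n _ (length Q)) (≤-reflexive (sym (part-length W p)))) lenL)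
          (≤-trans (≤-trans (m≤m+n _ (length W)) (≤-reflexive (sym (part-length Q p′)))) lenL)
          D.small f D.ρ Δ< ≤-refl
          (λ M h → D.T-small 1≤Δ Δρ³≤n large (E W Q) dense′ R≤Δ M h , D.ratio-small 1≤Δ Δρ³≤n large (E W Q) dense′ R≤Δ M h)
        where
        p′ : Q ++ W ↭ L
        p′ = ↭-trans (Pₚ.++-comm Q W) p
      2KS≤r : K * ((1 + 1) * S) ≤ r
      2KS≤r = begin
        K * (2 * S)                          ≡⟨ shuffle K S ⟩
        2 * (K * S)                          ≤⟨ *-monoʳ-≤ 2 (*-monoʳ-≤ K (m≤m*n S S)) ⟩
        2 * (K * (S * S))                    ≤⟨ m≤n+m _ (4 * S) ⟩
        4 * S + 2 * (K * (S * S))            ≤⟨ m≤n*m _ 8 ⟩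
        8 * (4 * S + 2 * (K * (S * S)))      ≤⟨ m≤n+m _ (32 * (K + 2) + 64 * (S * D.β)) ⟩
        32 * (K + 2) + 64 * (S * D.β) + 8 * (4 * S + 2 * (K * (S * S)))   ≤⟨ m≤m+n _ 16 ⟩
        threshold K S                        ≤⟨ large ⟩
        r                                    ∎
        where
        shuffle : ∀ k s → k * (2 * s) ≡ 2 * (k * s)
        shuffle = solve-∀
      rest≤ : ∀ {q} → q ≤ suc (n / r) → r * (K * ((r + r) * S) + q) ≤ 3 * n
      rest≤ {q} hq = begin
        r * (K * ((r + r) * S) + q)                     ≤⟨ *-monoʳ-≤ r (+-monoʳ-≤ _ hq) ⟩
        r * (K * ((r + r) * S) + suc (n / r))           ≡⟨ shuffle r K S (n / r) ⟩
        r * r * (K * (2 * S)) + (r + n / r * r)         ≤⟨ +-mono-≤ (≤-trans (*-monoʳ-≤ (r * r) 2KS≤r) r³≤n)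
          (+-mono-≤ (≤-trans (m≤n*m r (r * r) {{m*n≢0 r r}}) r³≤n) (m/n*n≤m n r)) ⟩
        n + (n + n)                                     ≡⟨ shuffle₂ n ⟩
        3 * n                                           ∎
        where
        shuffle : ∀ r k s x → r * (k * ((r + r) * s) + suc x) ≡ r * r * (k * (2 * s)) + (r + x * r)
        shuffle = solve-∀
        shuffle₂ : ∀ n → n + (n + n) ≡ 3 * n
        shuffle₂ = solve-∀

    -- Vertices of degree above n / r¹² are deleted first, so that Δr¹² ≤ n as the estimates for
    -- large degree demand. Then the graph is made nearly regular, and Δ < r⁵ decides between the
    -- two constructions. In units of n / r the losses are 2, `K` and 3.
    almost-split : ∀ L .{{_ : NonZero n}} → length L ≤ n → n < r ^ K → threshold K S ≤ r →
      let R = r * r * r * r * r in R * R * (r * r * r) ≤ n → E L L * r ^ 24 ≤ 2 * (n * n) → AlmostSplit r ((K + 5) * n) L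
    almost-split L lenL n< large n≥ sparse = case remove-high-degree (q * q * q) n L of λ where
        (L₁ , R₁ , p₁ , d₁ , few₁) → case near-regular K r n (n / (q * q * q)) L₁ (≤-trans (shorter L₁ p₁) lenL)
            (All.map (λ {v} → m*o≤n⇒m≤n/o (e v L₁) n (q * q * q)) d₁) (≤-<-trans (m/n≤m n (q * q * q)) n<) of λ where
          (L₂ , R₂ , Δ , p₂ , few₂ , d₂ , Δ≤ , dense) →
            enlarge {r} p₁ (total-drop (few R₁ few₁)) (enlarge {r} p₂ (+-monoʳ-≤ (3 * n) few₂)
              (go Δ L₂ (≤-trans (shorter L₂ p₂) (≤-trans (shorter L₁ p₁) lenL)) d₂ dense Δ≤ (Δ <? q * r)))
      where
      open ≤-Reasoning
      q = ρ 0
      instance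
        q≢0 : NonZero q
        q≢0 = m*n≢0 r (r * r * r) {{it}} {{m*n≢0 (r * r) r {{m*n≢0 r r}}}}
        q³≢0 : NonZero (q * q * q)
        q³≢0 = m*n≢0 (q * q) q {{m*n≢0 q q}}
      shorter : ∀ X {Y Z : List V} → X ++ Y ↭ Z → length X ≤ length Z
      shorter X {Y} p = ≤-trans (m≤m+n _ (length Y)) (≤-reflexive (sym (part-length X p)))
      n≥′ : q * r * (q * r) * (r * r * r) ≤ n
      n≥′ = subst (_≤ n) (shuffle r) n≥
        where
        shuffle : ∀ r → r * r * r * r * r * (r * r * r * r * r) * (r * r * r) ≡ r * (r * r * r) * r * (r * (r * r * r) * r) * (r * r * r)
        shuffle = solve-∀
      go : ∀ Δ L₂ → length L₂ ≤ n → MaxDegree Δ L₂ → n * Δ ≤ r * r * E L₂ L₂ → Δ ≤ n / (q * q * q) → Dec (Δ < q * r) →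
        AlmostSplit r (3 * n) L₂
      go Δ L₂ l d dense Δ≤ (yes Δ<) = weaken′ (split-small-degree Δ L₂ d dense Δ< large n≥′)
        where
        weaken′ : AlmostSplit r n L₂ → AlmostSplit r (3 * n) L₂
        weaken′ (kept , rest , p , l , s) = kept , rest , p , ≤-trans l (m≤m+n n _) , s
      go Δ L₂ l d dense Δ≤ (no ¬Δ<) = split-large-degree Δ L₂ l d dense (≮⇒≥ ¬Δ<) large
        (≤-<-trans (≤-trans Δ≤ (m/n≤m n (q * q * q))) n<)
        (≤-trans (*-monoˡ-≤ (q * q * q) Δ≤) (m/n*n≤m n (q * q * q)))
        (≤-trans (m≤n*m (r * r * r) (q * r * (q * r)) {{m*n≢0 (q * r) (q * r) {{m*n≢0 q r}} {{m*n≢0 q r}}}}) n≥′)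
      -- Here q = r⁴. Markov's inequality costs a factor q³, and another q³ is spent on leaving at
      -- most 2n / q³ deletions; this is the source of r²⁴ = q⁶.
      few : ∀ R₁ → length R₁ * n ≤ q * q * q * E L L → r * length R₁ ≤ 2 * n
      few R₁ h = ≤-trans (*-monoˡ-≤ (length R₁) (≤-trans (m≤m*n r (r * r * r) {{m*n≢0 (r * r) r {{m*n≢0 r r}}}}) (m≤n*m q (q * q) {{m*n≢0 q q}})))
        (*-cancelʳ-≤ (q * q * q * length R₁) (2 * n) n (begin
          q * q * q * length R₁ * n           ≡⟨ *-assoc (q * q * q) (length R₁) n ⟩
          q * q * q * (length R₁ * n)         ≤⟨ *-monoʳ-≤ (q * q * q) h ⟩
          q * q * q * (q * q * q * E L L)     ≡⟨ shuffle ⟩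
          E L L * r ^ 24                      ≤⟨ sparse ⟩
          2 * (n * n)                         ≡⟨ *-assoc 2 n n ⟨
          2 * n * n                           ∎))
        where
        q≡r⁴ : ∀ r → r * (r * r * r) ≡ r * (r * (r * (r * 1)))
        q≡r⁴ = solve-∀
        q⁶ : ∀ q x → q * q * q * (q * q * q * x) ≡ x * (q * (q * (q * (q * (q * (q * 1))))))
        q⁶ = solve-∀
        shuffle : q * q * q * (q * q * q * E L L) ≡ E L L * r ^ 24
        shuffle = trans (q⁶ q (E L L)) (cong (E L L *_) (trans (cong (_^ 6) (q≡r⁴ r)) (^-*-assoc r 4 6)))
      total-drop : ∀ {x} → x ≤ 2 * n → 3 * n + K * n + x ≤ (K + 5) * n
      total-drop {x} h = ≤-trans (+-monoʳ-≤ (3 * n + K * n) h) (≤-reflexive (shuffle K n))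
        where
        shuffle : ∀ k n → 3 * n + k * n + 2 * n ≡ (k + 5) * n
        shuffle = solve-∀

-- Distances in graphs of diameter 2

mutual
  -- Agda offers no name for the local function of dist: it is recovered by unification.
  search : ∀ {n} → Graph n → Fin n → Fin n → ℕ → ℕ → ℕ
  search = _

  dist-unfold : ∀ {n} (G : Graph (suc n)) u v →
    dist G u v ≡ (if reach G 0 u v then 0 else search G u v n 1)
  dist-unfold {n} G u v with suc n | G | u | v | 1
  ... | _ | _ | _ | _ | _ = refl

search-≥ : ∀ {n} (G : Graph n) u v f k → k ≤ search G u v f k
search-≥ G u v zero    k = ≤-refl
search-≥ G u v (suc f) k with reach G k u v
... | true  = ≤-refl
... | false = ≤-trans (n≤1+n k) (search-≥ G u v f (suc k))

⌊⌋-true : ∀ {P : Set} (P? : Dec P) → P → ⌊ P? ⌋ ≡ true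
⌊⌋-true (yes _) p = refl
⌊⌋-true (no ¬p) p = contradiction p ¬p

⌊⌋-false : ∀ {P : Set} (P? : Dec P) → ¬ P → ⌊ P? ⌋ ≡ false
⌊⌋-false (yes p) ¬p = contradiction p ¬p
⌊⌋-false (no _)  ¬p = refl

T⇒≡true : ∀ {b} → IsTrue b → b ≡ true
T⇒≡true = Equivalence.to T-≡

⇔⇒≡ : ∀ {b c} → (IsTrue b → IsTrue c) → (IsTrue c → IsTrue b) → b ≡ c
⇔⇒≡ {false} {false} f g = refl
⇔⇒≡ {false} {true}  f g = ⊥-elim (g _)
⇔⇒≡ {true}  {false} f g = ⊥-elim (f _)
⇔⇒≡ {true}  {true}  f g = refl

-- The adjacency of the complement; in diameter 2 it is the relation of having distance 2.
non : ∀ {n} → Graph n → Fin n → Fin n → Bool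
non G u v = not ⌊ u ≟ᶠ v ⌋ ∧ not (adj G u v)

reach-1 : ∀ {n} (G : Graph n) u v → u ≢ v → reach G 1 u v ≡ adj G u v
reach-1 {n} G u v u≢v = trans (cong (_∨ any step (allFin n)) (⌊⌋-false (u ≟ᶠ v) u≢v)) (⇔⇒≡ to from)
  where
  step : Fin n → Bool
  step w = ⌊ u ≟ᶠ w ⌋ ∧ adj G w v
  to : IsTrue (any step (allFin n)) → IsTrue (adj G u v)
  to t with satisfied (any⁻ step (allFin n) t)
  ... | w , h with u ≟ᶠ w
  ...   | yes refl = h
  from : IsTrue (adj G u v) → IsTrue (any step (allFin n))
  from t = any⁺ step (lose (∈-allFin u) (subst (λ b → IsTrue (b ∧ adj G u v)) (sym (⌊⌋-true (u ≟ᶠ u) refl)) t))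

dist-self : ∀ {n} (G : Graph n) u → dist G u u ≡ 0
dist-self {suc n} G u = trans (dist-unfold G u u) (cong (if_then 0 else search G u u n 1) (⌊⌋-true (u ≟ᶠ u) refl))

-- For distinct non-adjacent vertices the search has passed 0 and 1, so it returns at least 2, and
-- the diameter gives at most 2. Two distinct vertices force n ≥ 2, so the search has enough fuel
-- for both tests.
dist-distinct : ∀ {n} (G : Graph n) → Diameter2 G → ∀ u v → u ≢ v → dist G u v ≡ (if adj G u v then 1 else 2)
dist-distinct {1} G diam fzero fzero u≢v = contradiction refl u≢v
dist-distinct {suc (suc n)} G diam u v u≢v = finish (adj G u v) refl
  where
  unfolded : dist G u v ≡ (if adj G u v then 1 else search G u v n 2)
  unfolded = trans (dist-unfold G u v) (trans (cong (if_then 0 else (if reach G 1 u v then 1 else search G u v n 2)) (⌊⌋-false (u ≟ᶠ v) u≢v))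
    (cong (if_then 1 else search G u v n 2) (reach-1 G u v u≢v)))
  finish : ∀ b → adj G u v ≡ b → dist G u v ≡ (if adj G u v then 1 else 2)
  finish true  eq = trans unfolded (trans (cong (if_then 1 else search G u v n 2) eq) (sym (cong (if_then 1 else 2) eq)))
  finish false eq = trans d≡s (trans (≤-antisym (subst (_≤ 2) d≡s (proj₁ diam u v)) (search-≥ G u v n 2))
      (sym (cong (if_then 1 else 2) eq)))
    where
    d≡s : dist G u v ≡ search G u v n 2
    d≡s = trans unfolded (cong (if_then 1 else search G u v n 2) eq)

dist≡1 : ∀ {n} (G : Graph n) → Diameter2 G → ∀ u v → (dist G u v ≡ᵇ 1) ≡ adj G u v
dist≡1 G diam u v with u ≟ᶠ v
... | yes refl = trans (cong (_≡ᵇ 1) (dist-self G u)) (sym (adj-irrefl G u))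
... | no u≢v rewrite dist-distinct G diam u v u≢v with adj G u v
...   | true  = refl
...   | false = refl

dist≡2 : ∀ {n} (G : Graph n) → Diameter2 G → ∀ u v → (dist G u v ≡ᵇ 2) ≡ non G u v
dist≡2 G diam u v with u ≟ᶠ v
... | yes refl = cong (_≡ᵇ 2) (dist-self G u)
... | no u≢v rewrite dist-distinct G diam u v u≢v with adj G u v
...   | true  = refl
...   | false = refl

-- Counting with indicator functions

χ : Bool → ℕ
χ b = if b then 1 else 0

χ≤1 : ∀ b → χ b ≤ 1
χ≤1 true  = ≤-refl
χ≤1 false = z≤n

χ-∧ : ∀ b c → χ (b ∧ c) ≡ χ b * χ c
χ-∧ true  c = sym (+-identityʳ (χ c))
χ-∧ false c = refl

<ᵇ-true : ∀ {m n} → m < n → (m <ᵇ n) ≡ true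
<ᵇ-true h = T⇒≡true (<⇒<ᵇ h)

<ᵇ-false : ∀ {m n} → ¬ m < n → (m <ᵇ n) ≡ false
<ᵇ-false {m} {n} h with m <ᵇ n in eq
... | true  = contradiction (<ᵇ⇒< m n (Equivalence.from T-≡ eq)) h
... | false = refl

∑∑-cong : ∀ {n} {f g : Fin n → Fin n → ℕ} → (∀ i j → f i j ≡ g i j) →
  ∑ (λ i → ∑ (f i) (allFin n)) (allFin n) ≡ ∑ (λ i → ∑ (g i) (allFin n)) (allFin n)
∑∑-cong {n} h = ∑-cong (λ i → ∑-cong (h i) (allFin n)) (allFin n)

countPairs-cong : ∀ {n} {P Q : Fin n → Fin n → Bool} → (∀ i j → P i j ≡ Q i j) → countPairs P ≡ countPairs Q
countPairs-cong h = ∑∑-cong (λ i j → cong (λ b → χ ((toℕ i <ᵇ toℕ j) ∧ b)) (h i j))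

-- Off the diagonal exactly one of (i, j) and (j, i) is inspected by `countPairs`, and the diagonal
-- vanishes.
countPairs-double : ∀ {n} (P : Fin n → Fin n → Bool) → (∀ i j → P i j ≡ P j i) → (∀ i → P i i ≡ false) →
  countPairs P + countPairs P ≡ ∑ (λ i → ∑ (λ j → χ (P i j)) (allFin n)) (allFin n)
countPairs-double {n} P sym-P irr-P = sym (begin
  ∑ (λ i → ∑ (λ j → χ (P i j)) F) F
    ≡⟨ ∑∑-cong orient ⟩
  ∑ (λ i → ∑ (λ j → below i j + below j i) F) F
    ≡⟨ ∑-cong (λ i → ∑-distrib-+ (below i) (λ j → below j i) F) F ⟩
  ∑ (λ i → ∑ (below i) F + ∑ (λ j → below j i) F) F
    ≡⟨ ∑-distrib-+ (λ i → ∑ (below i) F) (λ i → ∑ (λ j → below j i) F) F ⟩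
  countPairs P + ∑ (λ i → ∑ (λ j → below j i) F) F
    ≡⟨ cong (countPairs P +_) (∑-swap (λ i j → below j i) F F) ⟩
  countPairs P + countPairs P ∎)
  where
  open ≡-Reasoning
  F = allFin n
  below : Fin n → Fin n → ℕ
  below i j = χ ((toℕ i <ᵇ toℕ j) ∧ P i j)
  orient : ∀ i j → χ (P i j) ≡ below i j + below j i
  orient i j with <-cmp (toℕ i) (toℕ j)
  ... | tri< lt _ ngt rewrite <ᵇ-true lt | <ᵇ-false ngt = sym (+-identityʳ _)
  ... | tri> nlt _ gt rewrite <ᵇ-true gt | <ᵇ-false nlt = cong χ (sym-P i j)
  ... | tri≈ nlt eq ngt rewrite <ᵇ-false nlt | <ᵇ-false ngt | toℕ-injective eq = cong χ (irr-P j)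

δ : ∀ {n} → Fin n → Fin n → ℕ
δ i j = χ ⌊ i ≟ᶠ j ⌋

δ-refl : ∀ {n} (i : Fin n) → δ i i ≡ 1
δ-refl i = cong χ (⌊⌋-true (i ≟ᶠ i) refl)

δ-≢ : ∀ {n} {i j : Fin n} → i ≢ j → δ i j ≡ 0
δ-≢ {i = i} {j} h = cong χ (⌊⌋-false (i ≟ᶠ j) h)

δ-suc : ∀ {n} (i j : Fin n) → δ (fsuc i) (fsuc j) ≡ δ i j
δ-suc i j = go (i ≟ᶠ j)
  where
  go : Dec (i ≡ j) → δ (fsuc i) (fsuc j) ≡ δ i j
  go (yes refl) = trans (δ-refl (fsuc i)) (sym (δ-refl i))
  go (no i≢j)   = trans (δ-≢ (i≢j ∘ suc-injectiveᶠ)) (sym (δ-≢ i≢j))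

∑-allFin : ∀ {n} (f : Fin (suc n) → ℕ) → ∑ f (allFin (suc n)) ≡ f fzero + ∑ (f ∘ fsuc) (allFin n)
∑-allFin {n} f = cong (f fzero +_) (trans (cong (∑ f) (sym (map-tabulate id fsuc))) (∑-map f fsuc (allFin n)))

∑-δ : ∀ {n} i (f : Fin n → ℕ) → ∑ (λ j → δ i j * f j) (allFin n) ≡ f i
∑-δ {suc n} fzero    f = trans (∑-allFin (λ j → δ fzero j * f j)) (trans (cong₂ _+_ (+-identityʳ (f fzero)) (∑-zero (allFin n))) (+-identityʳ (f fzero)))
∑-δ {suc n} (fsuc i) f = trans (∑-allFin (λ j → δ (fsuc i) j * f j))
  (trans (∑-cong (λ j → cong (_* f (fsuc j)) (δ-suc i j)) (allFin n)) (∑-δ i (f ∘ fsuc)))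

δ-sym : ∀ {n} (i j : Fin n) → δ i j ≡ δ j i
δ-sym i j = go (i ≟ᶠ j)
  where
  go : Dec (i ≡ j) → δ i j ≡ δ j i
  go (yes refl) = refl
  go (no i≢j)   = trans (δ-≢ i≢j) (sym (δ-≢ (i≢j ∘ sym)))

-- Lists without repetition as vertex sets

mult : ∀ {n} → List (Fin n) → Fin n → ℕ
mult A i = ∑ (λ x → δ x i) A

-- Sums over a list become weighted sums over all vertices, the form in which `countV` and
-- `countPairs` are given.
∑-mult : ∀ {n} A (f : Fin n → ℕ) → ∑ (λ i → mult A i * f i) (allFin n) ≡ ∑ f A
∑-mult {n} A f = begin
  ∑ (λ i → mult A i * f i) (allFin n)
    ≡⟨ ∑-cong (λ i → trans (*-comm (mult A i) (f i)) (sym (*-distribˡ-∑ (f i) (λ x → δ x i) A))) (allFin n) ⟩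
  ∑ (λ i → ∑ (λ x → f i * δ x i) A) (allFin n)
    ≡⟨ ∑-swap (λ i x → f i * δ x i) (allFin n) A ⟩
  ∑ (λ x → ∑ (λ i → f i * δ x i) (allFin n)) A
    ≡⟨ ∑-cong (λ x → trans (∑-cong (λ i → *-comm (f i) (δ x i)) (allFin n)) (∑-δ x f)) A ⟩
  ∑ f A ∎
  where open ≡-Reasoning

mult-allFin : ∀ {n} (i : Fin n) → mult (allFin n) i ≡ 1
mult-allFin {n} i = trans (∑-cong (λ x → trans (δ-sym x i) (sym (*-identityʳ (δ i x)))) (allFin n)) (∑-δ i (λ _ → 1))

∑-one : ∀ {X : Set} (A : List X) → ∑ (λ _ → 1) A ≡ length A
∑-one []      = refl
∑-one (_ ∷ A) = cong suc (∑-one A)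

χ-≡ᵇ1 : ∀ {m} → m ≤ 1 → χ (m ≡ᵇ 1) ≡ m
χ-≡ᵇ1 z≤n       = refl
χ-≡ᵇ1 (s≤s z≤n) = refl

-- Sub-multisets of allFin n are the sets of vertices.
module _ {n : ℕ} (A R : List (Fin n)) (p : A ++ R ↭ allFin n) where

  mult≤1 : ∀ i → mult A i ≤ 1
  mult≤1 i = begin
    mult A i                  ≤⟨ m≤m+n _ _ ⟩
    mult A i + mult R i       ≡⟨ ∑-++ (λ x → δ x i) A R ⟨
    mult (A ++ R) i           ≡⟨ ∑-↭ (λ x → δ x i) p ⟩
    mult (allFin n) i         ≡⟨ mult-allFin i ⟩
    1                         ∎
    where open ≤-Reasoning

  vset : VSet n
  vset i = mult A i ≡ᵇ 1

  χ-vset : ∀ i → χ (vset i) ≡ mult A i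
  χ-vset i = χ-≡ᵇ1 (mult≤1 i)

  countV-vset : countV vset ≡ length A
  countV-vset = trans (∑-cong (λ i → trans (χ-vset i) (sym (*-identityʳ (mult A i)))) (allFin n))
    (trans (∑-mult A (λ _ → 1)) (∑-one A))

  ∑∑-vset : ∀ (Q : Fin n → Fin n → Bool) →
    ∑ (λ i → ∑ (λ j → χ (vset i ∧ vset j ∧ Q i j)) (allFin n)) (allFin n) ≡ ∑ (λ x → ∑ (λ y → χ (Q x y)) A) A
  ∑∑-vset Q = begin
    ∑ (λ i → ∑ (λ j → χ (vset i ∧ vset j ∧ Q i j)) F) F
      ≡⟨ ∑∑-cong (λ i j → trans (χ-∧ (vset i) (vset j ∧ Q i j)) (cong₂ _*_ (χ-vset i)
           (trans (χ-∧ (vset j) (Q i j)) (cong (_* χ (Q i j)) (χ-vset j))))) ⟩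
    ∑ (λ i → ∑ (λ j → mult A i * (mult A j * χ (Q i j))) F) F
      ≡⟨ ∑-cong (λ i → *-distribˡ-∑ (mult A i) (λ j → mult A j * χ (Q i j)) F) F ⟩
    ∑ (λ i → mult A i * ∑ (λ j → mult A j * χ (Q i j)) F) F
      ≡⟨ ∑-cong (λ i → cong (mult A i *_) (∑-mult A (λ j → χ (Q i j)))) F ⟩
    ∑ (λ i → mult A i * ∑ (λ y → χ (Q i y)) A) F
      ≡⟨ ∑-mult A (λ i → ∑ (λ y → χ (Q i y)) A) ⟩
    ∑ (λ x → ∑ (λ y → χ (Q x y)) A) A ∎
    where
    open ≡-Reasoning
    F = allFin n

  Dmult-double : ∀ G k (Q : Fin n → Fin n → Bool) → (∀ i j → Q i j ≡ Q j i) → (∀ i → Q i i ≡ false) →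
    (∀ i j → (dist G i j ≡ᵇ k) ≡ Q i j) →
    Dmult G vset k + Dmult G vset k ≡ ∑ (λ x → ∑ (λ y → χ (Q x y)) A) A
  Dmult-double G k Q sym-Q irr-Q h = trans (cong₂ _+_ eq eq) (trans (countPairs-double P sym-P irr-P) (∑∑-vset Q))
    where
    P : Fin n → Fin n → Bool
    P i j = vset i ∧ vset j ∧ Q i j
    eq : Dmult G vset k ≡ countPairs P
    eq = countPairs-cong (λ i j → cong (λ b → vset i ∧ vset j ∧ b) (h i j))
    sym-P : ∀ i j → P i j ≡ P j i
    sym-P i j with vset i | vset j
    ... | true  | true  = sym-Q i j
    ... | true  | false = refl
    ... | false | true  = refl
    ... | false | false = refl
    irr-P : ∀ i → P i i ≡ false
    irr-P i with vset i
    ... | true  = irr-Q i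
    ... | false = refl

  ∑∑-δ : ∑ (λ x → ∑ (λ y → δ x y) A) A ≡ length A
  ∑∑-δ = begin
    ∑ (λ x → ∑ (λ y → δ x y) A) A              ≡⟨ ∑-cong (λ x → ∑-cong (λ y → δ-sym x y) A) A ⟩
    ∑ (mult A) A                               ≡⟨ ∑-mult A (mult A) ⟨
    ∑ (λ i → mult A i * mult A i) (allFin n)   ≡⟨ ∑-cong (λ i → square (mult≤1 i)) (allFin n) ⟩
    ∑ (λ i → mult A i * 1) (allFin n)          ≡⟨ ∑-mult A (λ _ → 1) ⟩
    ∑ (λ _ → 1) A                              ≡⟨ ∑-one A ⟩
    length A                                   ∎
    where
    open ≡-Reasoning
    square : ∀ {m} → m ≤ 1 → m * m ≡ m * 1
    square z≤n       = refl
    square (s≤s z≤n) = refl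

  -- Each ordered pair is adjacent, distinct and non-adjacent, or equal. Hence `length A` and either
  -- count determine the other.
  adj+non : ∀ G → ∑ (λ x → ∑ (λ y → χ (adj G x y)) A) A + ∑ (λ x → ∑ (λ y → χ (non G x y)) A) A + length A
    ≡ length A * length A
  adj+non G = begin
    ∑ (λ x → ∑ (α x) A) A + ∑ (λ x → ∑ (ν x) A) A + length A
      ≡⟨ cong₂ _+_ (∑-distrib-+ (λ x → ∑ (α x) A) (λ x → ∑ (ν x) A) A) ∑∑-δ ⟨
    ∑ (λ x → ∑ (α x) A + ∑ (ν x) A) A + ∑ (λ x → ∑ (δ x) A) A
      ≡⟨ ∑-distrib-+ (λ x → ∑ (α x) A + ∑ (ν x) A) (λ x → ∑ (δ x) A) A ⟨
    ∑ (λ x → ∑ (α x) A + ∑ (ν x) A + ∑ (δ x) A) A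
      ≡⟨ ∑-cong (λ x → trans (cong (_+ ∑ (δ x) A) (sym (∑-distrib-+ (α x) (ν x) A))) (sym (∑-distrib-+ (λ y → α x y + ν x y) (δ x) A))) A ⟩
    ∑ (λ x → ∑ (λ y → α x y + ν x y + δ x y) A) A
      ≡⟨ ∑-cong (λ x → trans (∑-cong (trichotomy x) A) (∑-one A)) A ⟩
    ∑ (λ _ → length A) A
      ≡⟨ trans (∑-cong (λ _ → sym (*-identityʳ (length A))) A) (trans (*-distribˡ-∑ (length A) (λ _ → 1) A) (cong (length A *_) (∑-one A))) ⟩
    length A * length A ∎
    where
    open ≡-Reasoning
    α ν : Fin n → Fin n → ℕ
    α x y = χ (adj G x y)
    ν x y = χ (non G x y)
    trichotomy : ∀ x y → α x y + ν x y + δ x y ≡ 1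
    trichotomy x y with x ≟ᶠ y
    ... | yes refl rewrite adj-irrefl G x = refl
    ... | no _ with adj G x y
    ...   | true  = refl
    ...   | false = refl

non-sym : ∀ {n} (G : Graph n) u v → non G u v ≡ non G v u
non-sym G u v with u ≟ᶠ v | v ≟ᶠ u
... | yes _    | yes _   = refl
... | yes refl | no v≢v  = contradiction refl v≢v
... | no u≢u   | yes refl = contradiction refl u≢u
... | no _     | no _    = cong not (adj-sym G u v)

non-irrefl : ∀ {n} (G : Graph n) u → non G u u ≡ false
non-irrefl G u = cong (λ b → not b ∧ not (adj G u u)) (⌊⌋-true (u ≟ᶠ u) refl)

+-self-injective : ∀ {m n} → m + m ≡ n + n → m ≡ n
+-self-injective {m} {n} h = *-cancelˡ-≡ m n 2 (trans (cong (m +_) (+-identityʳ m)) (trans h (sym (cong (n +_) (+-identityʳ n)))))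

-- Distinct vertices have distance 1 or 2, so only these two multiplicities matter, and twice each
-- of them is an ordered count from the hypotheses.
homometric : ∀ {n} (G : Graph n) → Diameter2 G → ∀ A R (p : A ++ R ↭ allFin n) B S (q : B ++ S ↭ allFin n) →
  ∑ (λ x → ∑ (λ y → χ (adj G x y)) A) A ≡ ∑ (λ x → ∑ (λ y → χ (adj G x y)) B) B →
  ∑ (λ x → ∑ (λ y → χ (non G x y)) A) A ≡ ∑ (λ x → ∑ (λ y → χ (non G x y)) B) B →
  Homometric G (vset A R p) (vset B S q)
homometric {n} G diam A R p B S q eq₁ eq₂ = go
  where
  double : ∀ k (Q : Fin n → Fin n → Bool) → (∀ i j → Q i j ≡ Q j i) → (∀ i → Q i i ≡ false) →
    (∀ i j → (dist G i j ≡ᵇ k) ≡ Q i j) → ∑ (λ x → ∑ (λ y → χ (Q x y)) A) A ≡ ∑ (λ x → ∑ (λ y → χ (Q x y)) B) B →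
    Dmult G (vset A R p) k ≡ Dmult G (vset B S q) k
  double k Q sym-Q irr-Q h eq = +-self-injective (trans (Dmult-double A R p G k Q sym-Q irr-Q h)
    (trans eq (sym (Dmult-double B S q G k Q sym-Q irr-Q h))))
  -- Only pairs i < j are examined: on the diagonal the distance is 0, which must not enter the
  -- multiplicity of 0.
  vanish : ∀ k (Z : VSet n) → (∀ i j → toℕ i < toℕ j → (dist G i j ≡ᵇ k) ≡ false) → Dmult G Z k ≡ 0
  vanish k Z h = trans (∑∑-cong {g = λ _ _ → 0} zeros) (trans (∑-cong (λ _ → ∑-zero (allFin n)) (allFin n)) (∑-zero (allFin n)))
    where
    zeros : ∀ i j → χ ((toℕ i <ᵇ toℕ j) ∧ Z i ∧ Z j ∧ (dist G i j ≡ᵇ k)) ≡ 0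
    zeros i j with toℕ i <? toℕ j
    ... | no ¬lt rewrite <ᵇ-false ¬lt = refl
    ... | yes lt rewrite h i j lt | ∧-zeroʳ (Z j) | ∧-zeroʳ (Z i) | ∧-zeroʳ (toℕ i <ᵇ toℕ j) = refl
  distinct : ∀ {i j : Fin n} → toℕ i < toℕ j → i ≢ j
  distinct lt refl = <-irrefl refl lt
  other : ∀ k → (∀ b → ((if b then 1 else 2) ≡ᵇ k) ≡ false) → Dmult G (vset A R p) k ≡ Dmult G (vset B S q) k
  other k h = trans (vanish k (vset A R p) z) (sym (vanish k (vset B S q) z))
    where
    z : ∀ i j → toℕ i < toℕ j → (dist G i j ≡ᵇ k) ≡ false
    z i j lt = trans (cong (_≡ᵇ k) (dist-distinct G diam i j (distinct lt))) (h (adj G i j))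
  go : Homometric G (vset A R p) (vset B S q)
  go 0 = other 0 λ { true → refl ; false → refl }
  go 1 = double 1 (adj G) (adj-sym G) (adj-irrefl G) (dist≡1 G diam) eq₁
  go 2 = double 2 (non G) (non-sym G) (non-irrefl G) (dist≡2 G diam) eq₂
  go (suc (suc (suc k))) = other (suc (suc (suc k))) λ { true → refl ; false → refl }

-- As `A ++ B` is itself part of `allFin n`, a vertex has total multiplicity at most 1 in `A` and
-- `B`.
disjoint : ∀ {n} A R (p : A ++ R ↭ allFin n) B S (q : B ++ S ↭ allFin n) R′ → (A ++ B) ++ R′ ↭ allFin n →
  Disjoint (vset A R p) (vset B S q)
disjoint {n} A R p B S q R′ t i = go (mult A i) (mult B i)
    (subst (_≤ 1) (∑-++ (λ x → δ x i) A B) (mult≤1 (A ++ B) R′ t i))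
  where
  go : ∀ a b → a + b ≤ 1 → (a ≡ᵇ 1) ∧ (b ≡ᵇ 1) ≡ false
  go 0             b             _ = refl
  go 1             0             _ = refl
  go 1             (suc b)       (s≤s ())
  go (suc (suc a)) b             (s≤s ())

-- Binomial coefficients, powers and integer roots

n*n≡nC2+nC2+n : ∀ n → n * n ≡ n C 2 + n C 2 + n
n*n≡nC2+nC2+n zero    = refl
n*n≡nC2+nC2+n (suc n) = begin
  suc n * suc n                              ≡⟨ shuffle₁ n ⟩
  n * n + n + suc n                          ≡⟨ cong (λ x → x + n + suc n) (n*n≡nC2+nC2+n n) ⟩
  n C 2 + n C 2 + n + n + suc n              ≡⟨ shuffle₂ (n C 2) n ⟩
  (n + n C 2) + (n + n C 2) + suc n          ≡⟨ cong (λ x → x + x + suc n) (trans (cong (_+ n C 2) (sym (nC1≡n n))) (nCk+nC[k+1]≡[n+1]C[k+1] n 1)) ⟩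
  suc n C 2 + suc n C 2 + suc n              ∎
  where
  open ≡-Reasoning
  shuffle₁ : ∀ n → suc n * suc n ≡ n * n + n + suc n
  shuffle₁ = solve-∀
  shuffle₂ : ∀ c n → c + c + n + n + suc n ≡ (n + c) + (n + c) + suc n
  shuffle₂ = solve-∀

^-distribʳ-* : ∀ m n o → (m * n) ^ o ≡ m ^ o * n ^ o
^-distribʳ-* m n zero    = refl
^-distribʳ-* m n (suc o) = trans (cong (m * n *_) (^-distribʳ-* m n o)) (shuffle m n (m ^ o) (n ^ o))
  where
  shuffle : ∀ a b c d → a * b * (c * d) ≡ a * c * (b * d)
  shuffle = solve-∀

^-cancelʳ-≤ : ∀ o .{{_ : NonZero o}} m n → m ^ o ≤ n ^ o → m ≤ n
^-cancelʳ-≤ o m n h with m ≤? n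
... | yes m≤n = m≤n
... | no m≰n  = contradiction (<-≤-trans (^-monoˡ-< o (≰⇒> m≰n)) h) (<-irrefl refl)

^-cancelʳ-< : ∀ o m n → m ^ o < n ^ o → m < n
^-cancelʳ-< o m n h with m <? n
... | yes m<n = m<n
... | no m≮n  = contradiction (<-≤-trans h (^-monoˡ-≤ o (≮⇒≥ m≮n))) (<-irrefl refl)

floor-root : ∀ k .{{_ : NonZero k}} n → ∃ λ r → r ^ k ≤ n × n < suc r ^ k
floor-root k zero    = 0 , ≤-reflexive (0^k k) , m^n>0 1 k
  where
  0^k : ∀ k .{{_ : NonZero k}} → 0 ^ k ≡ 0
  0^k (suc k) = refl
floor-root k (suc n) with floor-root k n
... | r , lo , hi with suc r ^ k ≤? suc n
...   | yes h = suc r , h , ≤-<-trans hi (^-monoˡ-< k (n<1+n (suc r)))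
...   | no h  = r , m≤n⇒m≤1+n lo , ≰⇒> h

-- The hypothesis reads x ≤ n^(2 - p/q), and r^24 is at most n^(1/q), hence at most n^(p/q). To stay
-- within the natural numbers, everything is compared after raising to the power `q`.
sparse-power : ∀ q p n x r .{{_ : NonZero q}} .{{_ : NonZero p}} .{{_ : NonZero n}} →
  x ^ q * n ^ p ≤ n ^ (2 * q) → r ^ (24 * q) ≤ n → x * r ^ 24 ≤ n * n
sparse-power q p n x r h root = ^-cancelʳ-≤ q (x * r ^ 24) (n * n) (begin
  (x * r ^ 24) ^ q          ≡⟨ ^-distribʳ-* x (r ^ 24) q ⟩
  x ^ q * (r ^ 24) ^ q      ≡⟨ cong (x ^ q *_) (^-*-assoc r 24 q) ⟩
  x ^ q * r ^ (24 * q)      ≤⟨ *-monoʳ-≤ (x ^ q) root ⟩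
  x ^ q * n                 ≡⟨ cong (x ^ q *_) (^-identityʳ n) ⟨
  x ^ q * n ^ 1             ≤⟨ *-monoʳ-≤ (x ^ q) (^-monoʳ-≤ n (>-nonZero⁻¹ p)) ⟩
  x ^ q * n ^ p             ≤⟨ h ⟩
  n ^ (2 * q)               ≡⟨ ^-*-assoc n 2 q ⟨
  (n ^ 2) ^ q               ≡⟨ cong (λ y → (n * y) ^ q) (*-identityʳ n) ⟩
  (n * n) ^ q               ∎)
  where open ≤-Reasoning

Σ² : ∀ {n} → (Fin n → Fin n → Bool) → List (Fin n) → ℕ
Σ² R A = ∑ (λ x → ∑ (λ y → χ (R x y)) A) A

-- r is the integer part of the k-th root of n; with k = 24 q this gives r²⁴ ≤ n^α for α ≥ 1/q.
record Root (k t n : ℕ) : Set where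
  field
    r     : ℕ
    large : t ≤ r
    lower : r ^ k ≤ n
    upper : n < r ^ suc (k + k)
    lower-13 : let R = r * r * r * r * r in R * R * (r * r * r) ≤ n

root : ∀ k .{{_ : NonZero k}} t n → 13 ≤ k → 2 ≤ t → t ^ k < n → Root k t n
root k t n 13≤k 2≤t h with floor-root k n
... | r , lo , hi = record
  { r = r ; large = t≤r ; lower = lo
  -- From `suc r ≤ r * r` follows n < r^(2k), so that suc (k + k) levels of pairing suffice.
  ; upper = begin-strict
      n                  <⟨ hi ⟩
      suc r ^ k          ≤⟨ ^-monoˡ-≤ k suc-r≤ ⟩
      (r * r) ^ k        ≡⟨ ^-distribʳ-* r r k ⟩
      r ^ k * r ^ k      ≡⟨ ^-distribˡ-+-* r k k ⟨
      r ^ (k + k)        ≤⟨ ^-monoʳ-≤ r (n≤1+n (k + k)) ⟩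
      r ^ suc (k + k)    ∎
  ; lower-13 = ≤-trans (≤-reflexive r¹³) (≤-trans (^-monoʳ-≤ r 13≤k) lo)
  }
  where
  open ≤-Reasoning
  t≤r : t ≤ r
  t≤r = ≤-pred (^-cancelʳ-< k t (suc r) (<-trans h hi))
  instance
    r≢0 : NonZero r
    r≢0 = >-nonZero (≤-trans (s≤s z≤n) (≤-trans 2≤t t≤r))
  suc-r≤ : suc r ≤ r * r
  suc-r≤ = begin
    1 + r       ≤⟨ +-monoˡ-≤ r (>-nonZero⁻¹ r) ⟩
    r + r       ≡⟨ cong (r +_) (+-identityʳ r) ⟨
    2 * r       ≤⟨ *-monoˡ-≤ r (≤-trans 2≤t t≤r) ⟩
    r * r       ∎
  r¹³ : r * r * r * r * r * (r * r * r * r * r) * (r * r * r) ≡ r ^ 13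
  r¹³ = trans (cong₂ _*_ (cong₂ _*_ (five r) (five r)) (three r))
    (trans (cong (_* r ^ 3) (sym (^-distribˡ-+-* r 5 5))) (sym (^-distribˡ-+-* r 10 3)))
    where
    five : ∀ r → r * r * r * r * r ≡ r * (r * (r * (r * (r * 1))))
    five = solve-∀
    three : ∀ r → r * r * r ≡ r * (r * (r * 1))
    three = solve-∀

-- From splits to large homometric sets

threshold-nonZero : ∀ K S r → threshold K S ≤ r → NonZero r
threshold-nonZero K S r h = >-nonZero (≤-trans (s≤s z≤n) (≤-trans (16≤threshold K S) h))

16≤-+ : ∀ K S c → 16 ≤ threshold K S + c
16≤-+ K S c = ≤-trans (16≤threshold K S) (m≤m+n (threshold K S) c)

-- `R` is `adj G` when there are few edges and `non G` when there are few non-edges; `x` is the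
-- number of edges of `R`.
split-relation : ∀ {n k t} .{{_ : NonZero n}} (R : Fin n → Fin n → Bool) → (∀ i j → R i j ≡ R j i) → (∀ i → R i i ≡ false) →
  (ρ : Root k t n) → threshold (suc (k + k)) (2 ^ suc (k + k)) ≤ t →
  ∀ x → Σ² R (allFin n) ≡ x + x → x * Root.r ρ ^ 24 ≤ n * n →
  ∃ λ A → ∃ λ B → ∃ λ rest → ((A ++ B) ++ rest ↭ allFin n) × length A ≡ length B ×
    Root.r ρ * length rest ≤ (suc (k + k) + 5) * n × Σ² R A ≡ Σ² R B
split-relation {n} {k} {t} R R-sym R-irrefl ρ t≥ x Ex h =
  case Assembly.almost-split (λ i j → χ (R i j)) (λ i j → cong χ (R-sym i j)) (λ i → cong χ (R-irrefl i)) (λ i j → χ≤1 (R i j))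
    (k + k) r n {{threshold-nonZero (suc (k + k)) (2 ^ suc (k + k)) r (≤-trans t≥ large)}} (allFin n) (≤-reflexive (length-tabulate id)) upper (≤-trans t≥ large) lower-13 dense of λ where
      (kept , rest , p , few , A , B , q , l , eq) → A , B , rest , ↭-trans (Pₚ.++⁺ʳ rest q) p , l , few , eq
  where
  open Root ρ
  double : ∀ x y → (x + x) * y ≡ 2 * (x * y)
  double x y = trans (*-distribʳ-+ y x x) (cong (x * y +_) (sym (+-identityʳ (x * y))))
  dense : Σ² R (allFin n) * r ^ 24 ≤ 2 * (n * n)
  dense = ≤-trans (≤-reflexive (trans (cong (_* r ^ 24) Ex) (double x (r ^ 24)))) (*-monoʳ-≤ 2 h)

small-rest : ∀ {n r} b c ℓ .{{_ : NonZero r}} → b * c ≤ r → r * ℓ ≤ c * n → b * ℓ ≤ n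
small-rest {n} {r} b c ℓ fine h = *-cancelˡ-≤ r (begin
  r * (b * ℓ)          ≡⟨ shuffle r b ℓ ⟩
  b * (r * ℓ)          ≤⟨ *-monoʳ-≤ b h ⟩
  b * (c * n)          ≡⟨ *-assoc b c n ⟨
  b * c * n            ≤⟨ *-monoˡ-≤ n fine ⟩
  r * n                ∎)
  where
  open ≤-Reasoning
  shuffle : ∀ r b l → r * (b * l) ≡ b * (r * l)
  shuffle = solve-∀

-- With ε = a / b the inequality says h ≥ n/2 - εn. It follows from n = 2 * length A + length R and
-- `b * length R ≤ n`.
homometric-pair : ∀ {n} (G : Graph n) → Diameter2 G → ∀ a b A B R → 1 ≤ a → (A ++ B) ++ R ↭ allFin n → length A ≡ length B →
  b * length R ≤ n → Σ² (adj G) A ≡ Σ² (adj G) B → Σ² (non G) A ≡ Σ² (non G) B →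
  ∃[ h ] (b * n ≤ 2 * b * h + 2 * a * n × HomPair G h)
homometric-pair {n} G diam a b A B R 1≤a p |A|≡|B| few eq₁ eq₂ =
  length A , size , vset A (B ++ R) pA , vset B (A ++ R) pB ,
  disjoint A (B ++ R) pA B (A ++ R) pB R p ,
  countV-vset A (B ++ R) pA , trans (countV-vset B (A ++ R) pB) (sym |A|≡|B|) ,
  homometric G diam A (B ++ R) pA B (A ++ R) pB eq₁ eq₂
  where
  pA : A ++ (B ++ R) ↭ allFin n
  pA = ↭-trans (P.↭-reflexive (sym (++-assoc A B R))) p
  pB : B ++ (A ++ R) ↭ allFin n
  pB = ↭-trans (Pₚ.shifts B A) pA
  open ≤-Reasoning
  size : b * n ≤ 2 * b * length A + 2 * a * n
  size = begin
    b * n                                             ≡⟨ cong (b *_) (trans (sym (length-tabulate {n = n} id)) (sym (Pₚ.↭-length pA))) ⟩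
    b * length (A ++ (B ++ R))                        ≡⟨ cong (b *_) (trans (length-++ A) (cong (length A +_) (trans (length-++ B) (cong (_+ length R) (sym |A|≡|B|))))) ⟩
    b * (length A + (length A + length R))            ≡⟨ shuffle b (length A) (length R) ⟩
    2 * b * length A + b * length R                   ≤⟨ +-monoʳ-≤ (2 * b * length A) (≤-trans few (≤-trans (≤-reflexive (sym (*-identityˡ n)))
                                                           (*-monoˡ-≤ n (≤-trans 1≤a (m≤n*m a 2))))) ⟩
    2 * b * length A + 2 * a * n                      ∎
    where
    shuffle : ∀ b x y → b * (x + (x + y)) ≡ 2 * b * x + b * y
    shuffle = solve-∀

adj-double : ∀ {n} (G : Graph n) → Σ² (adj G) (allFin n) ≡ edges G + edges G
adj-double G = sym (countPairs-double (adj G) (adj-sym G) (adj-irrefl G))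

adj+non-allFin : ∀ {n} (G : Graph n) → Σ² (adj G) (allFin n) + Σ² (non G) (allFin n) + n ≡ n * n
adj+non-allFin {n} G = subst (λ m → Σ² (adj G) (allFin n) + Σ² (non G) (allFin n) + m ≡ m * m) (length-tabulate {n = n} id)
  (adj+non (allFin n) [] (P.↭-reflexive (++-identityʳ (allFin n))) G)

non-double : ∀ {n} (G : Graph n) → Σ² (non G) (allFin n) ≡ (n C 2 ∸ edges G) + (n C 2 ∸ edges G)
non-double {n} G = trans (sym half) (cong (λ z → z + z) (begin
    x                     ≡⟨ m+n∸m≡n (edges G) x ⟨
    edges G + x ∸ edges G ≡⟨ cong (_∸ edges G) (+-self-injective sum≡) ⟩
    n C 2 ∸ edges G       ∎))
  where
  open ≡-Reasoning
  x = countPairs (non G)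
  half : x + x ≡ Σ² (non G) (allFin n)
  half = countPairs-double (non G) (non-sym G) (non-irrefl G)
  sum≡ : (edges G + x) + (edges G + x) ≡ n C 2 + n C 2
  sum≡ = +-cancelʳ-≡ n _ _ (begin
    (edges G + x) + (edges G + x) + n                           ≡⟨ shuffle (edges G) x n ⟩
    (edges G + edges G) + (x + x) + n                           ≡⟨ cong₂ (λ s t → s + t + n) (sym (adj-double G)) half ⟩
    Σ² (adj G) (allFin n) + Σ² (non G) (allFin n) + n           ≡⟨ adj+non-allFin G ⟩
    n * n                                                       ≡⟨ n*n≡nC2+nC2+n n ⟩
    n C 2 + n C 2 + n                                           ∎)
    where
    shuffle : ∀ e x n → (e + x) + (e + x) + n ≡ (e + e) + (x + x) + n
    shuffle = solve-∀

-- By `adj+non` the two counts have the same sum for sets of equal size.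
adj≡⇒non≡ : ∀ {n} (G : Graph n) A R (p : A ++ R ↭ allFin n) B S (q : B ++ S ↭ allFin n) → length A ≡ length B →
  (Σ² (adj G) A ≡ Σ² (adj G) B → Σ² (non G) A ≡ Σ² (non G) B) × (Σ² (non G) A ≡ Σ² (non G) B → Σ² (adj G) A ≡ Σ² (adj G) B)
adj≡⇒non≡ G A R p B S q |A|≡|B| =
  (λ eq → +-cancelˡ-≡ (Σ² (adj G) A) _ _ (trans totals (cong (_+ Σ² (non G) B) (sym eq)))) ,
  (λ eq → +-cancelʳ-≡ (Σ² (non G) A) _ _ (trans totals (cong (Σ² (adj G) B +_) (sym eq))))
  where
  totals : Σ² (adj G) A + Σ² (non G) A ≡ Σ² (adj G) B + Σ² (non G) B
  totals = +-cancelʳ-≡ (length A) _ _ (trans (adj+non A R p G) (trans (cong (λ m → m * m) |A|≡|B|)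
    (trans (sym (adj+non B S q G)) (cong (Σ² (adj G) B + Σ² (non G) B +_) (sym |A|≡|B|)))))

module Threshold (p q a b k : ℕ) .{{_ : NonZero p}} .{{_ : NonZero q}} (1≤a : 1 ≤ a) (24q≤k : 24 * q ≤ k) (24≤k : 24 ≤ k) where
  K t : ℕ
  K = suc (k + k)
  -- The first summand serves the pairing estimates, the second makes the lost vertices at most n /
  -- b.
  t = threshold K (2 ^ K) + b * (K + 5)
  threshold≤t : threshold K (2 ^ K) ≤ t
  threshold≤t = m≤m+n (threshold K (2 ^ K)) (b * (K + 5))
  16≤t : 16 ≤ t
  16≤t = 16≤-+ K (2 ^ K) (b * (K + 5))
  k≢0 : NonZero k
  k≢0 = >-nonZero (≤-trans (s≤s z≤n) 24≤k)

  module _ (n : ℕ) (tᵏ<n : t ^ k < n) (G : Graph n) (diam : Diameter2 G) where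
    ρ : Root k t n
    ρ = root k {{k≢0}} t n (≤-trans (m≤m+n 13 11) 24≤k) (≤-trans (m≤m+n 2 14) 16≤t) tᵏ<n
    open Root ρ using (r; lower; large)
    n≢0 : NonZero n
    n≢0 = >-nonZero (≤-trans (s≤s z≤n) tᵏ<n)
    r≢0 : NonZero r
    r≢0 = threshold-nonZero K (2 ^ K) r (≤-trans threshold≤t large)
    power : r ^ (24 * q) ≤ n
    power = ≤-trans (^-monoʳ-≤ r {{r≢0}} 24q≤k) lower

    conclude : ∀ A B R → (A ++ B) ++ R ↭ allFin n → length A ≡ length B → r * length R ≤ (K + 5) * n →
      (∀ (pA : A ++ (B ++ R) ↭ allFin n) (pB : B ++ (A ++ R) ↭ allFin n) →
        Σ² (adj G) A ≡ Σ² (adj G) B × Σ² (non G) A ≡ Σ² (non G) B) →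
      ∃[ h ] (b * n ≤ 2 * b * h + 2 * a * n × HomPair G h)
    conclude A B R p l few eqs = homometric-pair G diam a b A B R 1≤a p l
        (small-rest b (K + 5) (length R) {{r≢0}} (≤-trans (m≤n+m _ (threshold K (2 ^ K))) large) few) (proj₁ both) (proj₂ both)
      where
      pA : A ++ (B ++ R) ↭ allFin n
      pA = ↭-trans (P.↭-reflexive (sym (++-assoc A B R))) p
      both = eqs pA (↭-trans (Pₚ.shifts B A) pA)

    homometric-sets : ((edges G) ^ q * n ^ p ≤ n ^ (2 * q) ⊎ ((n C 2) ∸ edges G) ^ q * n ^ p ≤ n ^ (2 * q)) →
      ∃[ h ] (b * n ≤ 2 * b * h + 2 * a * n × HomPair G h)
    homometric-sets (inj₁ sparse) = case split-relation {{n≢0}} (adj G) (adj-sym G) (adj-irrefl G) ρ threshold≤t (edges G) (adj-double G)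
        (sparse-power q p n (edges G) r {{it}} {{it}} {{n≢0}} sparse power) of λ where
      (A , B , R , s , l , few , eq) → conclude A B R s l few
        (λ pA pB → eq , proj₁ (adj≡⇒non≡ G A (B ++ R) pA B (A ++ R) pB l) eq)
    homometric-sets (inj₂ sparse) = case split-relation {{n≢0}} (non G) (non-sym G) (non-irrefl G) ρ threshold≤t (n C 2 ∸ edges G) (non-double G)
        (sparse-power q p n (n C 2 ∸ edges G) r {{it}} {{it}} {{n≢0}} sparse power) of λ where
      (A , B , R , s , l , few , eq) → conclude A B R s l few
        (λ pA pB → proj₂ (adj≡⇒non≡ G A (B ++ R) pA B (A ++ R) pB l) eq , eq)

theorem7 : (p q a b : ℕ) → 1 ≤ p → 1 ≤ q → 1 ≤ a → 1 ≤ b →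
    ∃[ N ] ((n : ℕ) → N < n → (G : Graph n) → Diameter2 G →
    ((edges G) ^ q * n ^ p ≤ n ^ (2 * q)
    ⊎ ((n C 2) ∸ edges G) ^ q * n ^ p ≤ n ^ (2 * q)) →
    ∃[ h ] (b * n ≤ 2 * b * h + 2 * a * n × HomPair G h))
-- Here α = p / q and ε = a / b. Beyond this bound the integer part of the 24q-th root of `n` is at
-- least `t`.
theorem7 p q a b 1≤p 1≤q 1≤a 1≤b = t ^ (24 * q) , homometric-sets
  where
  open Threshold p q a b (24 * q) {{>-nonZero 1≤p}} {{>-nonZero 1≤q}} 1≤a ≤-refl (m≤m*n 24 q {{>-nonZero 1≤q}})
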